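{- Let $n$ and $m$ be integers such that $m$ is even and $n+2\leq m\leq 2n-2$. Then $$R(K_{1,n},W_m)=\begin{cases}2n+m/2-1, & \text{if both } n \text{ and } m/2 \text{ are even};\\ 2n+m/2, & \text{otherwise.}\end{cases}$$
   Context: All graphs are finite and simple. For graphs $G_1,G_2$, the Ramsey number $R(G_1,G_2)$ is the least integer $r$ such that for every graph $G$ on $r$ vertices, either $G$ contains a subgraph isomorphic to $G_1$ or the complement $\overline{G}$ contains a subgraph isomorphic to $G_2$. $K_{1,n}$ is the star with $n$ leaves. For $m\geq 3$, the wheel $W_m$ is the graph on $m+1$ vertices obtained from a cycle $C_m$ by adding one new vertex adjacent to all vertices of the cycle. -}

module Defs where

open import Data.Nat using (ℕ; zero; suc; _+_; _*_; _∸_; _≤_; _<_; _%_)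
open import Data.Fin using (Fin; toℕ) renaming (zero to fzero; suc to fsuc)
open import Data.Bool using (Bool; true; false; not; _∨_; _∧_)
open import Data.Product using (Σ; _×_; ∃)
open import Data.Sum using (_⊎_)
open import Relation.Nullary using (¬_)
open import Relation.Nullary.Decidable using (⌊_⌋)
open import Relation.Binary.PropositionalEquality using (_≡_)
open import Function.Definitions using (Injective)
import Data.Nat as N
import Data.Fin as F

Graph : ℕ → Set
Graph n = Fin n → Fin n → Bool

IsSimple : ∀ {n} → Graph n → Set
IsSimple {n} G = (∀ (i j : Fin n) → G i j ≡ G j i) × (∀ (i : Fin n) → G i i ≡ false)

complement : ∀ {n} → Graph n → Graph n
complement G i j = not ⌊ i F.≟ j ⌋ ∧ not (G i j)

Contains : ∀ {n k} → Graph n → Graph k → Set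
Contains {n} {k} G H =
  Σ (Fin k → Fin n) λ f → Injective _≡_ _≡_ f × (∀ i j → H i j ≡ true → G (f i) (f j) ≡ true)

Arrows : ℕ → ∀ {a b} → Graph a → Graph b → Set
Arrows r G1 G2 = (G : Graph r) → IsSimple G → Contains G G1 ⊎ Contains (complement G) G2

IsRamseyNumber : ∀ {a b} → Graph a → Graph b → ℕ → Set
IsRamseyNumber G1 G2 r = Arrows r G1 G2 × (∀ s → s < r → ¬ Arrows s G1 G2)

Star : (n : ℕ) → Graph (suc n)
Star n fzero fzero = false
Star n fzero (fsuc _) = true
Star n (fsuc _) fzero = true
Star n (fsuc _) (fsuc _) = false

Cycle : (m : ℕ) → Graph m
Cycle zero () _
Cycle (suc m) i j = ⌊ toℕ j N.≟ (suc (toℕ i)) % suc m ⌋ ∨ ⌊ toℕ i N.≟ (suc (toℕ j)) % suc m ⌋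

Wheel : (m : ℕ) → Graph (suc m)
Wheel m fzero fzero = false
Wheel m fzero (fsuc _) = true
Wheel m (fsuc _) fzero = true
Wheel m (fsuc i) (fsuc j) = Cycle m i j

{-# OPTIONS --safe #-}
{-
Let H be the complement of a graph without K_{1,n}, so every vertex of H has at most n - 1 non-neighbours.

Upper bound.  A degree count, with parity when n and k = m/2 are even, gives a vertex v of degree at least n + k in H;
let X consist of n + k of its neighbours and A of the remaining vertices.  If u in X has k neighbours p in X with
d_X(u) + d_X(p) small, then Jackson's theorem on bipartite graphs gives a 2k-cycle between these p and the neighbours
of u in A, hence a wheel with hub u.  So a vertex u whose degree δ in X is minimal has a neighbour t in X with
d_X(t) + δ at least |X|.  Pósa rotations of a longest path in X - t lead to a longest path both of whose ends are
adjacent to t.  If it has at least 2k - 1 vertices, counting the chords from t and from an end leaves no room to avoid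
a 2k-cycle in X, hence a wheel with hub v.  Otherwise its vertex set is a union of components of X - t; the smaller side
S then is (k-1)-regular and complete to A and t, and either two further edges in A and t allow a 2k-cycle to be woven
between A and S, or A is complete to X - t and parity gives a vertex to which Jackson's theorem applies.

Lower bound.  The disjoint union of K_n and the join of two regular graphs of suitable orders and degrees.
-}
module Submission where

open import Defs
open import Data.Nat renaming (_≟_ to _≟ℕ_)
open import Data.Nat.Properties hiding (_≟_)
open import Data.Nat.DivMod using (m<n⇒m%n≡m; n%n≡0; m*n%n≡0; [m+n]%n≡m%n; [m+kn]%n≡m%n)
open import Data.Nat.ListAction using (sum)
open import Data.Nat.Tactic.RingSolver using (solve; solve-∀)
open import Data.Fin using (Fin; zero; suc; toℕ; fromℕ; inject₁; inject≤; splitAt; _≟_)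
open import Data.Fin.Properties using (toℕ<n; toℕ-inject₁; inject≤-injective; any?; all?)
import Data.Fin.Properties as Fin
open import Data.Bool using (Bool; true; false; not; _∧_; _∨_; if_then_else_)
import Data.Bool as Bool
open import Data.Bool.Properties using (∧-comm; ∧-identityʳ; ∨-zeroʳ)
open import Data.List using (List; []; _∷_; length; map; _++_; reverse; take; tabulate)
import Data.List as List
open import Data.List.Properties using (map-++; length-map; length-++; length-reverse; length-take; length-tabulate; ++-assoc; ++-identityʳ; unfold-reverse)
open import Data.List.Membership.Propositional using (_∈_)
open import Data.List.Membership.Propositional.Properties using (∈-map⁺; ∈-++⁺ˡ; ∈-++⁺ʳ; ∈-∃++; ∈-lookup)
import Data.List.Membership.DecPropositional as DecMembership
open import Data.List.Relation.Unary.Any using (here; there)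
open import Data.List.Relation.Unary.All as All using (All)
import Data.List.Relation.Unary.All.Properties as All
open import Data.List.Relation.Unary.AllPairs as AllPairs using (AllPairs; []; _∷_)
import Data.List.Relation.Unary.AllPairs.Properties as AllPairs
open import Data.List.Relation.Unary.Unique.Propositional using (Unique)
import Data.List.Relation.Unary.Unique.Propositional.Properties as Unique
open import Data.List.Relation.Binary.Permutation.Propositional using (_↭_; prep; ↭-refl; ↭-sym; ↭-trans; ↭-reflexive; ↭⇒↭ₛ)
open import Data.List.Relation.Binary.Permutation.Propositional.Properties using (++-comm; shift; map⁺; ∷↭∷ʳ; ++⁺ʳ; All-resp-↭; ∈-resp-↭; ↭-length; ↭-reverse)
import Data.List.Relation.Binary.Permutation.Setoid.Properties as Permutation
open import Data.Product using (_×_; _,_; proj₁; proj₂; ∃)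
open import Data.Sum as Sum using (_⊎_; inj₁; inj₂)
open import Data.Empty using (⊥; ⊥-elim)
open import Relation.Nullary using (¬_; yes; no; Dec)
open import Relation.Nullary.Decidable using (⌊_⌋; _×-dec_; _→-dec_; ¬?; map′)
open import Relation.Binary.PropositionalEquality hiding ([_])
open import Function using (_∘_; id; const; _∋_)
open import Data.Vec as Vec using (Vec; []; _∷_)
open import Data.Vec.Properties using (lookup∘tabulate)

-- With order 2n + k - 1 + θ every vertex of H has degree at least n + k - 1 + θ, and |A| = n - 1 +
-- θ. The hypothesis n + 2 ≤ 2k enters as |A| ≤ 2k - 2, the bound on the second side in Jackson's
-- theorem; it also gives |X| ≤ 3k - 2, which limits how far a path in X can exceed 2k vertices. The
-- hypothesis 2k ≤ 2n - 2 is used as k < n.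
--
-- The two values of the Ramsey number are treated together through θ. For θ = 1 the decisive counts
-- have a unit to spare: the chords of a long path outnumber the places for them. For θ = 0 the
-- counts may be met with equality, and much of the work is to refute equality: the chord pattern is
-- then so rigid that chords of t propagate along the path by fixed distances until two of them
-- close a 2k-cycle. The remaining cases use parity, either n + k ≠ 2k + 1 or the absence of regular
-- graphs of odd order and odd degree.
--
-- The main steps derive ⊥ from the absence of wheels, so longest paths and maximal cycles are
-- assumed rather than constructed; decidability of subgraph containment is used once, to leave this
-- setting.

-- Linear arithmetic

eq≤ : ∀ {a b : ℕ} → a ≡ b → a ≤ b
eq≤ = ≤-reflexive

eq≥ : ∀ {a b : ℕ} → a ≡ b → b ≤ a
eq≥ h = ≤-reflexive (sym h)

-- Farkas certificates: l ≤ r is a combination of the hypotheses and c is the slack in its use.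
lin : ∀ {a b l r} c → l ≤ r → b + l ≡ a + r + c → a ≤ b
lin {a} {b} {l} {r} c h e = +-cancelʳ-≤ l a b (subst (a + l ≤_) (sym e) (≤-trans (+-monoʳ-≤ a h) (m≤m+n (a + r) c)))

-- Integer rounding: the certificate proves only `suc g * a ≤ suc g * b + g`, and the remainder `g`
-- is lost on division by `suc g`.
linᵍ : ∀ g {a b l r} c → l ≤ r → suc g * b + g + l ≡ suc g * a + r + c → a ≤ b
linᵍ g {a} {b} {l} {r} c h e = ≤-pred (*-cancelˡ-< (suc g) a (suc b) (≤-trans (s≤s (lin {suc g * a} {suc g * b + g} c h e)) (≤-reflexive (aux g b))))
  where
  aux : ∀ g b → suc (suc g * b + g) ≡ suc g * suc b
  aux = solve-∀

lin⊥ : ∀ {l r} c → l ≤ r → l ≡ 1 + r + c → ⊥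
lin⊥ {l} {r} c h e = 1+n≰n (≤-trans (s≤s (≤-trans h (m≤m+n r c))) (≤-reflexive (sym e)))

lin≡ : ∀ {a b l r} → l ≡ r → b + l ≡ a + r + 0 → a ≡ b
lin≡ {a} {b} {l} refl e = +-cancelʳ-≡ l a b (trans (sym (+-identityʳ (a + l))) (sym e))

infixr 5 _⊹_ _⊹≡_
_⊹_ : ∀ {a b c d} → a ≤ b → c ≤ d → a + c ≤ b + d
_⊹_ = +-mono-≤

_⊹≡_ : ∀ {a b c d : ℕ} → a ≡ b → c ≡ d → a + c ≡ b + d
_⊹≡_ = cong₂ _+_

infix 6 _⊠_ _⊠≡_
_⊠_ : ∀ {a b} k → a ≤ b → k * a ≤ k * b
k ⊠ h = *-monoʳ-≤ k h

_⊠≡_ : ∀ {a b} k → a ≡ b → k * a ≡ k * b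
k ⊠≡ h = cong (k *_) h

-- Unambiguous names for the constructors of a list of variables.
infixr 5 _⨾_
_⨾_ : ℕ → List ℕ → List ℕ
_⨾_ = _∷_

ε : List ℕ
ε = []

-- Counting subsets of Fin n

∑ : ∀ {n} → (Fin n → ℕ) → ℕ
∑ {zero}  f = 0
∑ {suc n} f = f zero + ∑ (f ∘ suc)

∑-mono : ∀ {n} {f g : Fin n → ℕ} → (∀ i → f i ≤ g i) → ∑ f ≤ ∑ g
∑-mono {zero}  h = z≤n
∑-mono {suc n} h = +-mono-≤ (h zero) (∑-mono (h ∘ suc))

∑-cong : ∀ {n} {f g : Fin n → ℕ} → (∀ i → f i ≡ g i) → ∑ f ≡ ∑ g
∑-cong {zero}  h = refl
∑-cong {suc n} h = cong₂ _+_ (h zero) (∑-cong (h ∘ suc))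

∑-+ : ∀ {n} (f g : Fin n → ℕ) → ∑ (λ i → f i + g i) ≡ ∑ f + ∑ g
∑-+ {zero}  f g = refl
∑-+ {suc n} f g = trans (cong (f zero + g zero +_) (∑-+ (f ∘ suc) (g ∘ suc)))
  (swap (f zero) (g zero) (∑ (f ∘ suc)) (∑ (g ∘ suc)))
  where
  swap : ∀ a b c d → a + b + (c + d) ≡ a + c + (b + d)
  swap = solve-∀

∑-const : ∀ n c → ∑ {n} (const c) ≡ n * c
∑-const zero    c = refl
∑-const (suc n) c = cong (c +_) (∑-const n c)

Subset : ℕ → Set
Subset n = Fin n → Bool

b2n : Bool → ℕ
b2n true  = 1
b2n false = 0

b2n≤1 : ∀ b → b2n b ≤ 1
b2n≤1 true  = ≤-refl
b2n≤1 false = z≤n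

opaque
  count : ∀ {n} → Subset n → ℕ
  count S = ∑ (b2n ∘ S)

  count-∑ : ∀ {n} (S : Subset n) → count S ≡ ∑ (b2n ∘ S)
  count-∑ S = refl

module _ {n : ℕ} where

  _∩_ : Subset n → Subset n → Subset n
  (S ∩ T) x = S x ∧ T x

  ∁ : Subset n → Subset n
  ∁ S x = not (S x)

  _∖_ : Subset n → Subset n → Subset n
  S ∖ T = S ∩ ∁ T

  ⁅_⁆ : Fin n → Subset n
  ⁅ x ⁆ y = ⌊ y ≟ x ⌋

  _⊆_ : Subset n → Subset n → Set
  S ⊆ T = ∀ x → S x ≡ true → T x ≡ true

  infixl 7 _∩_ _∖_
  infix  4 _⊆_

∧-true : ∀ {a b} → a ≡ true → b ≡ true → a ∧ b ≡ true
∧-true refl refl = refl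

∧-left : ∀ {a b} → a ∧ b ≡ true → a ≡ true
∧-left {true} _ = refl

∧-right : ∀ {a b} → a ∧ b ≡ true → b ≡ true
∧-right {true} h = h

not-true : ∀ {a} → not a ≡ true → a ≡ false
not-true {false} _ = refl

false-true : ∀ {a} → a ≡ false → a ≡ true → ⊥
false-true refl ()

≢true : ∀ {a} → ¬ a ≡ true → a ≡ false
≢true {true}  h = ⊥-elim (h refl)
≢true {false} h = refl

⁅⁆-refl : ∀ {n} (x : Fin n) → ⁅ x ⁆ x ≡ true
⁅⁆-refl x with x ≟ x
... | yes _ = refl
... | no ¬p = ⊥-elim (¬p refl)

⁅⁆-≡ : ∀ {n} {x y : Fin n} → ⁅ x ⁆ y ≡ true → y ≡ x
⁅⁆-≡ {x = x} {y} h with y ≟ x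
... | yes p = p

⁅⁆-≢ : ∀ {n} {x y : Fin n} → ¬ y ≡ x → ⁅ x ⁆ y ≡ false
⁅⁆-≢ {x = x} {y} h with y ≟ x
... | yes p = ⊥-elim (h p)
... | no _  = refl

⁅⁆-sym : ∀ {n} (i j : Fin n) → ⁅ i ⁆ j ≡ ⁅ j ⁆ i
⁅⁆-sym i j with j ≟ i | i ≟ j
... | yes _   | yes _   = refl
... | no  _   | no  _   = refl
... | yes j≡i | no  i≢j = ⊥-elim (i≢j (sym j≡i))
... | no  j≢i | yes i≡j = ⊥-elim (j≢i (sym i≡j))

module _ {n : ℕ} where

  ∖⁅⁆ : ∀ {S : Subset n} {x y} → S y ≡ true → ¬ y ≡ x → (S ∖ ⁅ x ⁆) y ≡ true
  ∖⁅⁆ p q = ∧-true p (cong not (⁅⁆-≢ q))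

  ∖⁅⁆-≢ : ∀ {S : Subset n} {x y} → (S ∖ ⁅ x ⁆) y ≡ true → ¬ y ≡ x
  ∖⁅⁆-≢ {S} {x} {y} h refl = false-true (not-true (∧-right {S y} h)) (⁅⁆-refl y)

  opaque
    unfolding count

    count-mono : ∀ {S T : Subset n} → S ⊆ T → count S ≤ count T
    count-mono {S} {T} h = ∑-mono λ i → pointwise (S i) (T i) (h i)
      where
      pointwise : ∀ a b → (a ≡ true → b ≡ true) → b2n a ≤ b2n b
      pointwise false b     h = z≤n
      pointwise true  true  h = ≤-refl
      pointwise true  false h with () ← h refl

    -- Inclusion-exclusion, with any common superset in place of the union.
    count-∪ : ∀ {S T U : Subset n} → S ⊆ U → T ⊆ U → count S + count T ≤ count U + count (S ∩ T)
    count-∪ {S} {T} {U} S⊆U T⊆U = begin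
      count S + count T                     ≡⟨ ∑-+ (b2n ∘ S) (b2n ∘ T) ⟨
      ∑ (λ i → b2n (S i) + b2n (T i))       ≤⟨ ∑-mono (λ i → pointwise (S i) (T i) (U i) (S⊆U i) (T⊆U i)) ⟩
      ∑ (λ i → b2n (U i) + b2n ((S ∩ T) i)) ≡⟨ ∑-+ (b2n ∘ U) (b2n ∘ (S ∩ T)) ⟩
      count U + count (S ∩ T)               ∎
      where
      open ≤-Reasoning
      pointwise : ∀ a b c → (a ≡ true → c ≡ true) → (b ≡ true → c ≡ true) → b2n a + b2n b ≤ b2n c + b2n (a ∧ b)
      pointwise true  true  c p q rewrite p refl = ≤-refl
      pointwise true  false c p q rewrite p refl = ≤-refl
      pointwise false true  c p q rewrite q refl = ≤-refl
      pointwise false false c p q = z≤n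

    count-split : ∀ (S T : Subset n) → count S ≡ count (S ∩ T) + count (S ∖ T)
    count-split S T = trans (∑-cong λ i → pointwise (S i) (T i)) (∑-+ (b2n ∘ (S ∩ T)) (b2n ∘ (S ∖ T)))
      where
      pointwise : ∀ a b → b2n a ≡ b2n (a ∧ b) + b2n (a ∧ not b)
      pointwise true  true  = refl
      pointwise true  false = refl
      pointwise false b     = refl

    count-full : count {n} (const true) ≡ n
    count-full = trans (∑-const n 1) (*-identityʳ n)

  count-∁ : ∀ (S : Subset n) → count S + count (∁ S) ≡ n
  count-∁ S = trans (sym (count-split (const true) S)) count-full

opaque
  unfolding count

  count-⁅⁆ : ∀ {n} (x : Fin n) → count ⁅ x ⁆ ≡ 1
  count-⁅⁆ {suc n} zero = cong suc (trans (∑-const n 0) (*-zeroʳ n))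
  count-⁅⁆ {suc n} (suc x) = trans (∑-cong λ i → cong b2n (step i)) (count-⁅⁆ x)
    where
    step : ∀ i → ⁅ suc x ⁆ (suc i) ≡ ⁅ x ⁆ i
    step i with i ≟ x
    ... | yes _ = refl
    ... | no  _ = refl

module _ {n : ℕ} where

  opaque
    unfolding count

    count-remove : ∀ {S : Subset n} {x} → S x ≡ true → count S ≡ suc (count (S ∖ ⁅ x ⁆))
    count-remove {S} {x} h = trans (count-split S ⁅ x ⁆) (cong (_+ count (S ∖ ⁅ x ⁆)) (trans (∑-cong λ i → cong b2n (same i)) (count-⁅⁆ x)))
      where
      same : ∀ i → (S ∩ ⁅ x ⁆) i ≡ ⁅ x ⁆ i
      same i with i ≟ x
      ... | yes refl rewrite h = refl
      ... | no  _ with S i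
      ...   | true  = refl
      ...   | false = refl

  tally : Subset n → List (Fin n) → ℕ
  tally S [] = 0
  tally S (x ∷ xs) = b2n (S x) + tally S xs

  tally-cong : ∀ {S T : Subset n} xs → All (λ x → S x ≡ T x) xs → tally S xs ≡ tally T xs
  tally-cong [] _ = refl
  tally-cong (x ∷ xs) (p All.∷ ps) = cong₂ (λ a b → b2n a + b) p (tally-cong xs ps)

  tally-∖⁅⁆ : ∀ {S : Subset n} {x} xs → All (λ y → ¬ x ≡ y) xs → tally (S ∖ ⁅ x ⁆) xs ≡ tally S xs
  tally-∖⁅⁆ {S} {x} xs h = tally-cong xs (All.map (λ {y} ¬p → same y (¬p ∘ sym)) h)
    where
    same : ∀ y → ¬ y ≡ x → (S ∖ ⁅ x ⁆) y ≡ S y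
    same y ¬p with S y
    ... | false = refl
    ... | true  = cong not (⁅⁆-≢ ¬p)

  tally≤count : ∀ {S : Subset n} {xs} → Unique xs → tally S xs ≤ count S
  tally≤count {S} {[]} _ = z≤n
  tally≤count {S} {x ∷ xs} (x∉ ∷ u) with S x in eq
  ... | true  = ≤-trans (s≤s (≤-trans (eq≥ (tally-∖⁅⁆ xs x∉)) (tally≤count {S ∖ ⁅ x ⁆} u)))
                        (eq≥ (count-remove eq))
  ... | false = tally≤count u

  tally-all : ∀ {S : Subset n} {xs} → All (λ x → S x ≡ true) xs → tally S xs ≡ length xs
  tally-all All.[] = refl
  tally-all (p All.∷ ps) = cong₂ (λ a b → b2n a + b) p (tally-all ps)

  length≤count : ∀ {S : Subset n} {xs} → Unique xs → All (λ x → S x ≡ true) xs → length xs ≤ count S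
  length≤count u a = ≤-trans (eq≥ (tally-all a)) (tally≤count u)

  opaque
    unfolding count

    count≡0 : ∀ {S : Subset n} → (∀ x → S x ≡ false) → count S ≡ 0
    count≡0 {S} h = trans (∑-cong λ i → cong b2n (h i)) (trans (∑-const n 0) (*-zeroʳ n))

  count≤tally : ∀ {S : Subset n} xs → (∀ {x} → S x ≡ true → x ∈ xs) → count S ≤ tally S xs
  count≤tally {S} [] h = eq≤ (count≡0 λ x → ≢true λ p → nowhere (h p))
    where
    nowhere : ∀ {x : Fin n} → x ∈ [] → ⊥
    nowhere ()
  count≤tally {S} (x ∷ xs) h with S x in eq
  ... | true  = ≤-trans (eq≤ (count-remove eq)) (s≤s (≤-trans (count≤tally xs rest) (weaken xs)))
    where
    rest : ∀ {y} → (S ∖ ⁅ x ⁆) y ≡ true → y ∈ xs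
    rest {y} p with h (∧-left {S y} p)
    ... | here y≡x = ⊥-elim (∖⁅⁆-≢ {S = S} p y≡x)
    ... | there q  = q
    weaken : ∀ xs → tally (S ∖ ⁅ x ⁆) xs ≤ tally S xs
    weaken [] = z≤n
    weaken (y ∷ ys) = +-mono-≤ (le (S y) _) (weaken ys)
      where
      le : ∀ a b → b2n (a ∧ b) ≤ b2n a
      le true  b = b2n≤1 b
      le false b = z≤n
  ... | false = count≤tally xs rest
    where
    rest : ∀ {y} → S y ≡ true → y ∈ xs
    rest p with h p
    ... | here refl = ⊥-elim (false-true eq p)
    ... | there q   = q

  tally≤length : ∀ (S : Subset n) xs → tally S xs ≤ length xs
  tally≤length S [] = z≤n
  tally≤length S (x ∷ xs) = +-mono-≤ (b2n≤1 (S x)) (tally≤length S xs)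

  inhabited : ∀ {S : Subset n} → 0 < count S → ∃ λ x → S x ≡ true
  inhabited {S} h with Fin.any? (λ x → S x Bool.≟ true)
  ... | yes p = p
  ... | no ¬p = ⊥-elim (n≮0 (≤-trans h (eq≤ (count≡0 λ x → ≢true λ q → ¬p (x , q)))))

  escape : ∀ {S : Subset n} xs → length xs < count S → ∃ λ x → S x ≡ true × All (λ y → ¬ x ≡ y) xs
  escape {S} xs h with Fin.any? (λ x → (S x Bool.≟ true) ×-dec All.all? (λ y → ¬? (x ≟ y)) xs)
  ... | yes p = p
  ... | no ¬p = ⊥-elim (1+n≰n (≤-trans h (≤-trans (count≤tally xs covered) (tally≤length S xs))))
    where
    open DecMembership (_≟_ {n}) using (_∈?_)
    covered : ∀ {x} → S x ≡ true → x ∈ xs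
    covered {x} p with x ∈? xs
    ... | yes q = q
    ... | no ¬q = ⊥-elim (¬p (x , p , All.¬Any⇒All¬ xs ¬q))

  sublist : ∀ (S : Subset n) m → m ≤ count S → ∃ λ xs → Unique xs × All (λ x → S x ≡ true) xs × length xs ≡ m
  sublist S zero    h = [] , [] , All.[] , refl
  sublist S (suc m) h with sublist S m (≤-trans (n≤1+n m) h)
  ... | xs , u , a , refl with escape xs h
  ... | x , p , x∉ = x ∷ xs , x∉ ∷ u , p All.∷ a , refl

opaque
  unfolding count

  subset : ∀ {n} (S : Subset n) m → m ≤ count S → ∃ λ (T : Subset n) → T ⊆ S × count T ≡ m
  subset {zero}  S zero h = S , (λ _ p → p) , refl
  subset {suc n} S m h with S zero in eq | m
  ... | true  | zero  = const false , (λ _ ()) , trans (∑-const n 0) (*-zeroʳ n)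
  ... | true  | suc m with T , T⊆S , c ← subset (S ∘ suc) m (≤-pred h) =
    (λ { zero → true ; (suc i) → T i }) , (λ { zero _ → eq ; (suc i) p → T⊆S i p }) , cong suc c
  ... | false | m with T , T⊆S , c ← subset (S ∘ suc) m h =
    (λ { zero → false ; (suc i) → T i }) , (λ { (suc i) p → T⊆S i p }) , c

pigeonhole : ∀ {n} {S T U : Subset n} → S ⊆ U → T ⊆ U → count U < count S + count T →
             ∃ λ x → S x ≡ true × T x ≡ true
pigeonhole {S = S} {T} {U} S⊆U T⊆U h
  with x , p ← inhabited {S = S ∩ T} (+-cancelˡ-≤ (count U) 1 _
                 (≤-trans (eq≤ (+-comm (count U) 1)) (≤-trans h (count-∪ S⊆U T⊆U))))
  = x , ∧-left p , ∧-right {S x} p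

-- Peeling off the vertex 0 leaves every edge at 0 counted twice.
opaque
  unfolding count

  handshake : ∀ {n} (E : Fin n → Fin n → Bool) → (∀ x y → E x y ≡ E y x) → (∀ x → E x x ≡ false) →
              ∃ λ m → ∑ (λ x → count (E x)) ≡ 2 * m
  handshake {zero}  E sy ir = 0 , refl
  handshake {suc n} E sy ir with handshake (λ x y → E (suc x) (suc y)) (λ x y → sy (suc x) (suc y)) (ir ∘ suc)
  ... | m , eq = count (E zero ∘ suc) + m , (begin
    b2n (E zero zero) + c + ∑ (λ x → b2n (E (suc x) zero) + count (E (suc x) ∘ suc))
      ≡⟨ cong₂ (λ a b → b2n a + c + b) (ir zero) (∑-+ (λ x → b2n (E (suc x) zero)) (λ x → count (E (suc x) ∘ suc))) ⟩
    c + (∑ (λ x → b2n (E (suc x) zero)) + ∑ (λ x → count (E (suc x) ∘ suc)))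
      ≡⟨ cong₂ (λ a b → c + (a + b)) (∑-cong λ x → cong b2n (sy (suc x) zero)) eq ⟩
    c + (c + 2 * m)
      ≡⟨ double c m ⟩
    2 * (c + m) ∎)
    where
    open ≡-Reasoning
    c : ℕ
    c = count (E zero ∘ suc)
    double : ∀ c m → c + (c + 2 * m) ≡ 2 * (c + m)
    double = solve-∀

-- Paths and cycles

data Path {A : Set} (R : A → A → Set) : A → List A → A → Set where
  stop : ∀ a → Path R a (a ∷ []) a
  _∷_ : ∀ {a b c xs} → R a b → Path R b xs c → Path R a (a ∷ xs) c

module _ {A : Set} {R : A → A → Set} where

  join : ∀ {a b c d xs ys} → Path R a xs b → R b c → Path R c ys d → Path R a (xs ++ ys) d
  join (stop a) e q = e ∷ q
  join (f ∷ p) e q = f ∷ join p e q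

  reversePath : (∀ {a b} → R a b → R b a) → ∀ {a b xs} → Path R a xs b → Path R b (reverse xs) a
  reversePath sy (stop a) = stop a
  reversePath sy (_∷_ {a} {b} {c} {xs} e p) rewrite unfold-reverse a xs = join (reversePath sy p) (sy e) (stop a)

  head-All : ∀ {P : A → Set} {a b xs} → Path R a xs b → All P xs → P a
  head-All (stop a) (p All.∷ _) = p
  head-All (e ∷ π)  (p All.∷ _) = p

  last-All : ∀ {P : A → Set} {a b xs} → Path R a xs b → All P xs → P b
  last-All (stop a) (p All.∷ _)  = p
  last-All (e ∷ π)  (_ All.∷ ps) = last-All π ps

  head-≡ : ∀ {a b c xs} → Path R a (c ∷ xs) b → a ≡ c
  head-≡ (stop a) = refl
  head-≡ (e ∷ p) = refl

  split : ∀ {a b} x xs y ys → Path R a (x ∷ xs ++ y ∷ ys) b →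
          ∃ λ c → Path R a (x ∷ xs) c × R c y × Path R y (y ∷ ys) b
  split x []        y ys (e ∷ p) with refl ← head-≡ p = x , stop x , e , p
  split x (x′ ∷ xs) y ys (e ∷ p) with refl ← head-≡ p with c , q , f , r ← split x′ xs y ys p = c , e ∷ q , f , r

mapPath : ∀ {A B : Set} {R : A → A → Set} {Q : B → B → Set} (f : A → B) → (∀ {a b} → R a b → Q (f a) (f b)) →
          ∀ {a b xs} → Path R a xs b → Path Q (f a) (map f xs) (f b)
mapPath f h (stop a) = stop (f a)
mapPath f h (e ∷ p) = h e ∷ mapPath f h p

Closed : ∀ {A : Set} (R : A → A → Set) → List A → Set
Closed R xs = ∃ λ a → ∃ λ b → Path R a xs b × R b a

rotate : ∀ {A : Set} {R : A → A → Set} xs ys → Closed R (xs ++ ys) → Closed R (ys ++ xs)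
rotate []       ys       c rewrite ++-identityʳ ys = c
rotate (x ∷ xs) []       c rewrite ++-identityʳ (x ∷ xs) = c
rotate (x ∷ xs) (y ∷ ys) (a , b , p , e) with c , q , f , r ← split x xs y ys p = y , c , join r e q , f

Unique-↭ : ∀ {A : Set} {xs ys : List A} → xs ↭ ys → Unique xs → Unique ys
Unique-↭ {A} p = Permutation.Unique-resp-↭ (setoid A) (↭⇒↭ₛ p)

Cycles : ∀ {A : Set} (R : A → A → Set) (S : A → Set) → ℕ → Set
Cycles R S m = ∃ λ xs → Closed R xs × Unique xs × All S xs × length xs ≡ m

-- Cycles in bipartite graphs

module _ {n : ℕ} where

  elem : List (Fin n) → Subset n
  elem []       x = false
  elem (y ∷ ys) x = ⁅ y ⁆ x ∨ elem ys x

  elem-∈ : ∀ {x} xs → elem xs x ≡ true → x ∈ xs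
  elem-∈ {x} (y ∷ ys) h with ⁅ y ⁆ x in eq
  ... | true  = here (⁅⁆-≡ eq)
  ... | false = there (elem-∈ ys h)

  ∈-elem : ∀ {x xs} → x ∈ xs → elem xs x ≡ true
  ∈-elem {x} (here refl) rewrite ⁅⁆-refl x = refl
  ∈-elem {x} {y ∷ ys} (there h) rewrite ∈-elem h = ∨-zeroʳ (⁅ y ⁆ x)

  tally-mono : ∀ {S T : Subset n} xs → S ⊆ T → tally S xs ≤ tally T xs
  tally-mono {S} {T} [] h = z≤n
  tally-mono {S} {T} (x ∷ xs) h = +-mono-≤ (le (S x) (T x) (h x)) (tally-mono xs h)
    where
    le : ∀ a b → (a ≡ true → b ≡ true) → b2n a ≤ b2n b
    le false b    h = z≤n
    le true  b    h rewrite h refl = ≤-refl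

  count-off : ∀ (S : Subset n) xs → count S ≤ tally S xs + count (S ∖ elem xs)
  count-off S xs = ≤-trans (eq≤ (count-split S (elem xs)))
    (+-monoˡ-≤ _ (≤-trans (count≤tally xs λ p → elem-∈ xs (∧-right {S _} p))
                          (tally-mono xs λ x → ∧-left)))

  count-∖elem : ∀ {S : Subset n} {xs} → Unique xs → All (λ x → S x ≡ true) xs →
                length xs + count (S ∖ elem xs) ≤ count S
  count-∖elem {S} {xs} u a = ≤-trans (+-monoˡ-≤ _ (length≤count {S = S ∩ elem xs} u (All.tabulate both))) (eq≥ (count-split S (elem xs)))
    where
    both : ∀ {x} → x ∈ xs → (S ∩ elem xs) x ≡ true
    both p = ∧-true (All.lookup a p) (∈-elem p)

  shrink-sum : ∀ {A : Set} (N : A → Subset n) (U : Subset n) x ys →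
               All (λ y → ∀ z → U z ≡ true → N x z ≡ true → N y z ≡ true → ⊥) ys →
               sum (map (λ y → count (U ∩ N y)) ys) ≤ sum (map (λ y → count (U ∖ N x ∩ N y)) ys)
  shrink-sum N U x [] _ = z≤n
  shrink-sum N U x (y ∷ ys) (h All.∷ hs) = +-mono-≤ (count-mono {S = U ∩ N y} {T = U ∖ N x ∩ N y} λ z p →
    ∧-true (∧-true (∧-left p) (cong not (≢true λ q → h z (∧-left p) q (∧-right {U z} p)))) (∧-right {U z} p))
    (shrink-sum N U x ys hs)

  -- Only disjointness within `U` is assumed, so the induction can replace `U` by what `N x` leaves
  -- of it.
  disjoint-sum : ∀ {A : Set} (N : A → Subset n) (U : Subset n) xs →
                 AllPairs (λ x y → ∀ z → U z ≡ true → N x z ≡ true → N y z ≡ true → ⊥) xs →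
                 sum (map (λ x → count (U ∩ N x)) xs) ≤ count U
  disjoint-sum N U [] _ = z≤n
  disjoint-sum N U (x ∷ xs) (d ∷ ds) = ≤-trans
    (+-monoʳ-≤ (count (U ∩ N x)) (≤-trans (shrink-sum N U x xs d)
      (disjoint-sum N (U ∖ N x) xs (AllPairs.map (λ h z p → h z (∧-left p)) ds))))
    (eq≥ (count-split U (N x)))

private
  -- Let the cycle have `r` pairs and `t` neighbours of p. Off the cycle p has at least k - t
  -- neighbours, the first cycle vertex at least k - r, and each of the other t - 1 successors at
  -- least one. If these sets are disjoint they fill 2k - 1 - r places, but only 2k - 2 - r are
  -- left.
  overfull : ∀ k r cQ cQ₀ dp dc s t S → k ≤ t + dp → k ≤ r + dc → s ≤ S → suc s ≡ t →
             dp + (dc + S) ≤ cQ₀ → r + cQ₀ ≤ cQ → cQ + 2 ≤ 2 * k → ⊥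
  overfull k r cQ cQ₀ dp dc s t S h₁ h₂ h₃ h₄ h₅ h₆ h₇ = lin⊥ 0 (h₁ ⊹ h₂ ⊹ h₃ ⊹ eq≥ h₄ ⊹ h₅ ⊹ h₆ ⊹ h₇) (solve (S ⨾ cQ ⨾ cQ₀ ⨾ dc ⨾ dp ⨾ k ⨾ r ⨾ s ⨾ t ⨾ ε))

  crowded : ∀ k r cQ cQ₀ cS dx → k ≤ r + dx → k ≤ suc cS → r + cQ₀ ≤ cQ → cQ + 2 ≤ 2 * k → cQ₀ < cS + dx
  crowded k r cQ cQ₀ cS dx h₁ h₂ h₃ h₄ = lin 0 (h₁ ⊹ h₂ ⊹ h₃ ⊹ h₄) (solve (cQ ⨾ cQ₀ ⨾ cS ⨾ dx ⨾ k ⨾ r ⨾ ε))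

module Bipartite {n : ℕ} (E : Fin n → Fin n → Bool) (E-sym : ∀ x y → E x y ≡ E y x)
  (P Q : Subset n) (PQ : ∀ x → P x ≡ true → Q x ≡ true → ⊥) where

  _~_ : Fin n → Fin n → Set
  x ~ y = E x y ≡ true

  ~-sym : ∀ {x y} → x ~ y → y ~ x
  ~-sym {x} {y} h = trans (E-sym y x) h

  Pair : Set
  Pair = Fin n × Fin n

  _⇒_ : Pair → Pair → Set
  c ⇒ d = proj₂ c ~ proj₁ d

  Ok : Pair → Set
  Ok (p , q) = P p ≡ true × Q q ≡ true × p ~ q

  ps qs : List Pair → List (Fin n)
  ps = map proj₁
  qs = map proj₂

  -- The cycle p, q, p′, q′, ... is kept as pairs so that the two sides can be permuted and compared
  -- separately. A single edge counts as a cycle with one pair, which gives the induction on length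
  -- its start.
  record Alternating (C : List Pair) : Set where
    constructor alt
    field
      closed : Closed _⇒_ C
      uniqP  : Unique (ps C)
      uniqQ  : Unique (qs C)
      ok     : All Ok C
  open Alternating

  rotateAlt : ∀ C D → Alternating (C ++ D) → Alternating (D ++ C)
  rotateAlt C D a = alt (rotate C D (closed a)) (Unique-↭ (map⁺ proj₁ (++-comm C D)) (uniqP a))
    (Unique-↭ (map⁺ proj₂ (++-comm C D)) (uniqQ a)) (All-resp-↭ (++-comm C D) (ok a))

  -- p is joined to the last q of C and C is traversed backwards, so every q moves to the next pair.
  flip : Fin n → List Pair → Fin n → List Pair
  flip p []            z = (p , z) ∷ []
  flip p ((p₁ , q₁) ∷ C) z = flip p C q₁ ++ (p₁ , z) ∷ []

  flip-ps : ∀ p C z → ps (flip p C z) ↭ p ∷ ps C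
  flip-ps p [] z = ↭-refl
  flip-ps p ((p₁ , q₁) ∷ C) z rewrite map-++ proj₁ (flip p C q₁) ((p₁ , z) ∷ []) =
    ↭-trans (++⁺ʳ (p₁ ∷ []) (flip-ps p C q₁)) (prep p (↭-sym (∷↭∷ʳ p₁ (ps C))))

  flip-qs : ∀ p C z → qs (flip p C z) ↭ z ∷ qs C
  flip-qs p [] z = ↭-refl
  flip-qs p ((p₁ , q₁) ∷ C) z rewrite map-++ proj₂ (flip p C q₁) ((p₁ , z) ∷ []) =
    ↭-trans (++⁺ʳ (z ∷ []) (flip-qs p C q₁)) (↭-sym (∷↭∷ʳ z (q₁ ∷ qs C)))

  flip-path : ∀ {p z c d C} → Path _⇒_ c C d → All Ok C → p ~ proj₂ d → P p ≡ true → Q z ≡ true → proj₁ c ~ z →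
              Path _⇒_ (p , proj₂ d) (flip p C z) (proj₁ c , z) × All Ok (flip p C z)
  flip-path (stop (p₁ , q₁)) ((P₁ , Q₁ , e₁) All.∷ All.[]) e Pp Qz ez =
    ~-sym e₁ ∷ stop (p₁ , _) , (Pp , Q₁ , e) All.∷ (P₁ , Qz , ez) All.∷ All.[]
  flip-path (_∷_ {a = p₁ , q₁} f π) ((P₁ , Q₁ , e₁) All.∷ oks) e Pp Qz ez
    with π′ , oks′ ← flip-path π oks e Pp Q₁ (~-sym f) =
    join π′ (~-sym e₁) (stop (p₁ , _)) , All.++⁺ oks′ ((P₁ , Qz , ez) All.∷ All.[])

  module Grow {k C} (a : Alternating C) (maximal : ∀ D → Alternating D → ¬ length D ≡ suc (length C))
    (C<k : length C < k) (Q<2k : count Q + 2 ≤ 2 * k) (degree : ∀ p → P p ≡ true → k ≤ count (Q ∩ E p))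
    {p} (Pp : P p ≡ true) (p∉ : All (λ y → ¬ p ≡ y) (ps C)) where

    Q₀ : Subset n
    Q₀ = Q ∖ elem (qs C)

    d₀ : Fin n → ℕ
    d₀ x = count (Q₀ ∩ E x)

    d₀-lower : ∀ x → P x ≡ true → k ≤ tally (E x) (qs C) + d₀ x
    d₀-lower x p = begin
      k                                                                ≤⟨ degree x p ⟩
      count (Q ∩ E x)                                                  ≤⟨ count-off (Q ∩ E x) (qs C) ⟩
      tally (Q ∩ E x) (qs C) + count (Q ∩ E x ∖ elem (qs C))           ≤⟨ +-mono-≤ (tally-mono (qs C) λ z → ∧-right {Q z})
         (count-mono {S = Q ∩ E x ∖ elem (qs C)} {T = Q₀ ∩ E x} λ z h →
           ∧-true (∧-true (∧-left (∧-left h)) (∧-right {(Q ∩ E x) z} h)) (∧-right {Q z} (∧-left h))) ⟩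
      tally (E x) (qs C) + d₀ x                                        ∎
      where open ≤-Reasoning

    d₀-weak : ∀ x → P x ≡ true → k ≤ length C + d₀ x
    d₀-weak x p = ≤-trans (d₀-lower x p) (+-monoˡ-≤ (d₀ x) (≤-trans (tally≤length (E x) (qs C)) (eq≤ (length-map proj₂ C))))

    Q₀-size : length C + count Q₀ ≤ count Q
    Q₀-size = ≤-trans (eq≤ (cong (_+ count Q₀) (sym (length-map proj₂ C))))
      (count-∖elem (uniqQ a) (All.map⁺ (All.map (λ o → proj₁ (proj₂ o)) (ok a))))

    off : ∀ {z} → Q₀ z ≡ true → All (λ y → ¬ z ≡ y) (qs C)
    off {z} h = All.tabulate λ {y} y∈ z≡y → false-true (not-true (∧-right {Q z} h)) (∈-elem (subst (_∈ qs C) (sym z≡y) y∈))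

    NoCommon : Fin n → Fin n → Set
    NoCommon x y = ∀ z → Q₀ z ≡ true → x ~ z → y ~ z → ⊥

    module _ {D} (σ : C ↭ D) (α : Alternating D) where

      private
        off-D : ∀ {z} → Q₀ z ≡ true → All (λ y → ¬ z ≡ y) (qs D)
        off-D h = All-resp-↭ (map⁺ proj₂ σ) (off h)
        p∉D : All (λ y → ¬ p ≡ y) (ps D)
        p∉D = All-resp-↭ (map⁺ proj₁ σ) p∉
        size : length D ≡ length C
        size = sym (↭-length σ)

      -- With a common neighbour z, the pair (p , z) could be inserted between the last pair and the
      -- first.
      no-common-p : ∀ {c d} → Path _⇒_ c D d → p ~ proj₂ d → NoCommon p (proj₁ c)
      no-common-p {c} {d} π e z Qz pz cz = maximal (D ++ (p , z) ∷ []) (alt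
        (c , (p , z) , join π (~-sym e) (stop (p , z)) , ~-sym cz)
        (Unique-↭ (↭-trans (∷↭∷ʳ p (ps D)) (↭-reflexive (sym (map-++ proj₁ D _)))) (p∉D ∷ uniqP α))
        (Unique-↭ (↭-trans (∷↭∷ʳ z (qs D)) (↭-reflexive (sym (map-++ proj₂ D _)))) (off-D Qz ∷ uniqQ α))
        (All.++⁺ (ok α) ((Pp , ∧-left Qz , pz) All.∷ All.[])))
        (trans (length-++ D) (trans (+-comm (length D) 1) (cong suc size)))

    -- A common neighbour z would close a longer cycle: from p backwards through `X`, then z, then
    -- forwards through `Y` and back to p.
    no-common : ∀ {c d c′ d′} X Y → C ↭ X ++ Y → Alternating (X ++ Y) → Path _⇒_ c X d → Path _⇒_ c′ Y d′ →
                p ~ proj₂ d → p ~ proj₂ d′ → NoCommon (proj₁ c) (proj₁ c′)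
    no-common {c} {d} {c′} {d′} X Y σ α π π′ e e′ z Qz cz c′z
      with π″ , oks ← flip-path π (All.++⁻ˡ X (ok α)) e Pp (∧-left Qz) cz =
      maximal (flip p X z ++ Y) (alt
        ((p , proj₂ d) , d′ , join π″ (~-sym c′z) π′ , ~-sym e′)
        (Unique-↭ (↭-trans (prep p (↭-reflexive (map-++ proj₁ X Y))) (↭-trans (++⁺ʳ (ps Y) (↭-sym (flip-ps p X z)))
           (↭-reflexive (sym (map-++ proj₁ (flip p X z) Y))))) (All-resp-↭ (map⁺ proj₁ σ) p∉ ∷ uniqP α))
        (Unique-↭ (↭-trans (prep z (↭-reflexive (map-++ proj₂ X Y))) (↭-trans (++⁺ʳ (qs Y) (↭-sym (flip-qs p X z)))
           (↭-reflexive (sym (map-++ proj₂ (flip p X z) Y))))) (All-resp-↭ (map⁺ proj₂ σ) (off Qz) ∷ uniqQ α))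
        (All.++⁺ oks (All.++⁻ʳ X (ok α))))
        (trans (length-++ (flip p X z)) (trans (cong (_+ length Y) (flip-length X z))
          (cong suc (trans (sym (length-++ X)) (sym (↭-length σ))))))
      where
      flip-length : ∀ X z → length (flip p X z) ≡ suc (length X)
      flip-length [] z = refl
      flip-length ((p₁ , q₁) ∷ X) z = trans (length-++ (flip p X q₁)) (trans (+-comm _ 1) (cong suc (flip-length X q₁)))

    -- The `P`-vertices following the neighbours of `p` on the cycle. The follower of the last pair
    -- is the first vertex of the cycle; it is missing here and counted apart.
    succs : Pair → List Pair → List (Fin n)
    succs c [] = []
    succs c (d ∷ D) = if E p (proj₂ c) then proj₁ d ∷ succs d D else succs d D

    succs-P : ∀ c D → All Ok D → All (λ s → P s ≡ true) (succs c D)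
    succs-P c [] _ = All.[]
    succs-P c (d ∷ D) (o All.∷ os) with E p (proj₂ c)
    ... | true  = proj₁ o All.∷ succs-P d D os
    ... | false = succs-P d D os

    succs-length : ∀ {c D l} → Path _⇒_ c (c ∷ D) l → p ~ proj₂ l → suc (length (succs c D)) ≡ tally (E p) (qs (c ∷ D))
    succs-length (stop c) e rewrite e = refl
    succs-length {c} {d ∷ D} (f ∷ π) e with refl ← head-≡ π with E p (proj₂ c)
    ... | true  = cong suc (succs-length π e)
    ... | false = succs-length π e

    Occurs : Pair → List Pair → Pair → Fin n → Set
    Occurs c D l s = ∃ λ X → ∃ λ Y → ∃ λ a → ∃ λ b →
      X ++ Y ≡ c ∷ D × Path _⇒_ c X b × Path _⇒_ a Y l × p ~ proj₂ b × s ≡ proj₁ a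

    occurs : ∀ {c D l} → Path _⇒_ c (c ∷ D) l → All (Occurs c D l) (succs c D)
    occurs (stop c) = All.[]
    occurs {c} {d ∷ D} (f ∷ π) with refl ← head-≡ π with E p (proj₂ c) in eq
    ... | true  = (c ∷ [] , d ∷ D , d , c , refl , stop c , π , eq , refl) All.∷ All.map later (occurs π)
      where
      later : ∀ {s} → Occurs d D _ s → Occurs c (d ∷ D) _ s
      later (X , Y , a , b , eq , πX , πY , e , s≡) = c ∷ X , Y , a , b , cong (c ∷_) eq , f ∷ πX , πY , e , s≡
    ... | false = All.map later (occurs π)
      where
      later : ∀ {s} → Occurs d D _ s → Occurs c (d ∷ D) _ s
      later (X , Y , a , b , eq , πX , πY , e , s≡) = c ∷ X , Y , a , b , cong (c ∷_) eq , f ∷ πX , πY , e , s≡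

    module Last {c D l} (C≡ : C ≡ c ∷ D) (π : Path _⇒_ c (c ∷ D) l) (l⇒c : l ⇒ c) (p~l : p ~ proj₂ l) where

      α : Alternating (c ∷ D)
      α = subst Alternating C≡ a

      pairwise : ∀ Z x X → Z ++ x ∷ X ≡ c ∷ D → Path _⇒_ c (Z ++ x ∷ []) x → Path _⇒_ x (x ∷ X) l →
                 AllPairs NoCommon (succs x X)
      pairwise Z x []      eq πZ πX = []
      pairwise Z x (y ∷ Y) eq πZ (f ∷ πY) with refl ← head-≡ πY with E p (proj₂ x) in p~x
      ... | false = pairwise (Z ++ x ∷ []) y Y (trans (++-assoc Z (x ∷ []) (y ∷ Y)) eq) (join πZ f (stop y)) πY
      ... | true  = All.map apart (occurs πY) ∷
                    pairwise (Z ++ x ∷ []) y Y (trans (++-assoc Z (x ∷ []) (y ∷ Y)) eq) (join πZ f (stop y)) πY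
        where
        pre = Z ++ x ∷ []
        apart : ∀ {s} → Occurs y Y l s → NoCommon (proj₁ y) s
        apart (V , W , a′ , b , VW , πV , πW , p~b , refl) =
          -- The cycle is turned to begin at `y`; it then falls into `V`, ending at the pair before
          -- `s`, and the rest, ending at `x`. Both ends are adjacent to `p`.
          no-common V (W ++ pre) (subst (C ↭_) eq′ (↭-trans (↭-reflexive (trans C≡ (sym eq″))) (++-comm pre (V ++ W))))
            (subst Alternating eq′ (rotateAlt pre (V ++ W) (subst Alternating (sym eq″) α))) πV (join πW l⇒c πZ) p~b p~x
          where
          eq′ : (V ++ W) ++ pre ≡ V ++ (W ++ pre)
          eq′ = ++-assoc V W pre
          eq″ : pre ++ (V ++ W) ≡ c ∷ D
          eq″ = trans (cong (pre ++_) VW) (trans (++-assoc Z (x ∷ []) (y ∷ Y)) eq)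

      apart-p : ∀ {s} → Occurs c D l s → NoCommon p s
      apart-p (X , Y , a′ , b , XY , πX , πY , p~b , refl) =
        no-common-p (↭-trans (↭-reflexive (trans C≡ (sym XY))) (++-comm X Y))
          (rotateAlt X Y (subst Alternating (sym XY) α)) (join πY l⇒c πX) p~b

      apart-c : ∀ {s} → Occurs c D l s → NoCommon (proj₁ c) s
      apart-c (X , Y , a′ , b , XY , πX , πY , p~b , refl) =
        no-common X Y (↭-reflexive (trans C≡ (sym XY))) (subst Alternating (sym XY) α) πX πY p~b p~l

      absurd : ⊥
      absurd = overfull k (length C) (count Q) (count Q₀) (d₀ p) (d₀ (proj₁ c)) _ _ _ (d₀-lower p Pp) (d₀-weak (proj₁ c) Pc)
        (spread (succs c D) (succs-P c D (All.tail oks))) (trans (succs-length π p~l) (cong (tally (E p) ∘ qs) (sym C≡)))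
        (disjoint-sum (λ x → E x) Q₀ (p ∷ proj₁ c ∷ succs c D)
          ((no-common-p (↭-reflexive C≡) α π p~l All.∷ All.map apart-p (occurs π)) ∷
           All.map apart-c (occurs π) ∷ pairwise [] c D refl (stop c) π))
        Q₀-size Q<2k
        where
        oks : All Ok (c ∷ D)
        oks = ok α
        Pc : P (proj₁ c) ≡ true
        Pc = proj₁ (All.head oks)
        spread : ∀ xs → All (λ s → P s ≡ true) xs → length xs ≤ sum (map d₀ xs)
        spread [] _ = z≤n
        spread (x ∷ xs) (h All.∷ hs) = +-mono-≤ (+-cancelˡ-≤ (length C) 1 (d₀ x)
          (≤-trans (eq≤ (+-comm (length C) 1)) (≤-trans C<k (d₀-weak x h)))) (spread xs hs)

    pick : ∀ (S : Subset n) x → P x ≡ true → S ⊆ Q₀ → k ≤ suc (count S) → ∃ λ z → S z ≡ true × x ~ z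
    pick S x Px S⊆ k≤ =
      let z , Sz , e = pigeonhole {S = S} {T = Q₀ ∩ E x} {U = Q₀} S⊆ (λ _ → ∧-left)
                         (crowded k (length C) (count Q) (count Q₀) (count S) (d₀ x) (d₀-weak x Px) k≤ Q₀-size Q<2k)
      in z , Sz , ∧-right {Q₀ z} e

    module None {c D l} (C≡ : C ≡ c ∷ D) (π : Path _⇒_ c (c ∷ D) l) (l⇒c : l ⇒ c) (none : tally (E p) (qs C) ≡ 0) where

      α : Alternating (c ∷ D)
      α = subst Alternating C≡ a

      Pc : P (proj₁ c) ≡ true
      Pc = proj₁ (All.head (ok α))

      p∉α : All (λ y → ¬ p ≡ y) (ps (c ∷ D))
      p∉α = subst (λ L → All (λ y → ¬ p ≡ y) (ps L)) C≡ p∉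

      offα : ∀ {z} → Q₀ z ≡ true → All (λ y → ¬ z ≡ y) (qs (c ∷ D))
      offα {z} h = subst (λ L → All (λ y → ¬ z ≡ y) (qs L)) C≡ (off h)

      k≤d₀p : k ≤ d₀ p
      k≤d₀p = ≤-trans (d₀-lower p Pp) (eq≤ (cong (_+ d₀ p) none))

      insert : ∀ z z′ → Q₀ z ≡ true → proj₁ c ~ z → p ~ z → Q₀ z′ ≡ true → p ~ z′ → ¬ z′ ≡ z →
               Closed _⇒_ ((proj₁ c , z) ∷ (p , z′) ∷ D) → ⊥
      insert z z′ Qz c~z p~z Qz′ p~z′ z′≢z cl = maximal ((proj₁ c , z) ∷ (p , z′) ∷ D) (alt cl
        (((λ q → All.head p∉α (sym q)) All.∷ AllPairs.head (uniqP α)) ∷ All.tail p∉α ∷ AllPairs.tail (uniqP α))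
        (((z′≢z ∘ sym) All.∷ All.tail (offα Qz)) ∷ All.tail (offα Qz′) ∷ AllPairs.tail (uniqQ α))
        ((Pc , ∧-left Qz , c~z) All.∷ (Pp , ∧-left Qz′ , p~z′) All.∷ All.tail (ok α))) (cong (suc ∘ length) (sym C≡))

      next : List Pair → Fin n
      next []      = proj₁ c
      next (d ∷ _) = proj₁ d

      P-next : ∀ X → All Ok X → P (next X) ≡ true
      P-next []      _           = Pc
      P-next (d ∷ _) (o All.∷ _) = proj₁ o

      close : ∀ {z z′} X → Path _⇒_ c (c ∷ X) l → p ~ z → next X ~ z′ → Closed _⇒_ ((proj₁ c , z) ∷ (p , z′) ∷ X)
      close []      (stop _) p~z x~z′ = _ , _ , ~-sym p~z ∷ stop _ , ~-sym x~z′
      close (d ∷ X) (f ∷ πX) p~z x~z′ with refl ← head-≡ πX = _ , _ , ~-sym p~z ∷ ~-sym x~z′ ∷ πX , l⇒c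

      -- All of the at least k neighbours of `p` are off the cycle, so `p` shares one with every
      -- `P`-vertex of the cycle. The `Q`-vertex of the first pair is given up and z, p, z′ take its
      -- place.
      absurd : ⊥
      absurd =
        let z , Sz , c~z = pick (Q₀ ∩ E p) (proj₁ c) Pc (λ _ → ∧-left) (≤-trans k≤d₀p (n≤1+n _))
            -- Excluding z keeps z′ distinct; `pick` tolerates the loss of this one vertex.
            z′ , S′ , x~z′ = pick (Q₀ ∩ E p ∖ ⁅ z ⁆) (next D) (P-next D (All.tail (ok α))) (λ _ h → ∧-left (∧-left h))
               (≤-trans k≤d₀p (eq≤ (count-remove {S = Q₀ ∩ E p} Sz)))
        in insert z z′ (∧-left Sz) c~z (∧-right {Q₀ z} Sz) (∧-left (∧-left S′)) (∧-right {Q₀ z′} (∧-left S′))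
             (∖⁅⁆-≢ {S = Q₀ ∩ E p} S′) (close D π (∧-right {Q₀ z} Sz) x~z′)

  flatten : List Pair → List (Fin n)
  flatten [] = []
  flatten ((p , q) ∷ C) = p ∷ q ∷ flatten C

  flatten-↭ : ∀ C → flatten C ↭ ps C ++ qs C
  flatten-↭ [] = ↭-refl
  flatten-↭ ((p , q) ∷ C) = prep p (↭-trans (prep q (flatten-↭ C)) (↭-sym (shift q (ps C) (qs C))))

  flatten-path : ∀ {c C d} → Path _⇒_ c C d → All Ok C → Path _~_ (proj₁ c) (flatten C) (proj₂ d)
  flatten-path (stop c) (o All.∷ _)  = proj₂ (proj₂ o) ∷ stop _
  flatten-path (e ∷ π)  (o All.∷ os) = proj₂ (proj₂ o) ∷ e ∷ flatten-path π os

  module Step {k} (Q<2k : count Q + 2 ≤ 2 * k) (degree : ∀ p → P p ≡ true → k ≤ count (Q ∩ E p)) {p} (Pp : P p ≡ true) where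

    Stuck : List Pair → Set
    Stuck C = ∀ D → Alternating D → length D ≡ suc (length C) → ⊥

    nowhere : ∀ C → Alternating C → length C < k → Stuck C → All (λ y → ¬ p ≡ y) (ps C) → tally (E p) (qs C) ≡ 0 → ⊥
    nowhere []      (alt (_ , _ , () , _) _ _ _)
    nowhere (x ∷ X) a@(alt (c , l , π , l⇒c) _ _ _) C<k stuck p∉ t≡0 with refl ← head-≡ π =
      Grow.None.absurd a stuck C<k Q<2k degree Pp p∉ refl π l⇒c t≡0

    ends : ∀ {x c l} Z → Path _⇒_ c (Z ++ x ∷ []) l → l ≡ x
    ends []           (stop _) = refl
    ends (z ∷ [])     (_ ∷ π)  = ends [] π
    ends (z ∷ z′ ∷ Z) (_ ∷ π)  = ends (z′ ∷ Z) π

    somewhere : ∀ C → Alternating C → length C < k → Stuck C → All (λ y → ¬ p ≡ y) (ps C) →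
                ∀ {x} → (∃ λ Z → C ≡ Z ++ x ∷ []) → p ~ proj₂ x → ⊥
    somewhere []      (alt (_ , _ , () , _) _ _ _)
    somewhere (d ∷ D) a@(alt (c , l , π , l⇒c) _ _ _) C<k stuck p∉ {x} (Z , eq) p~x
      with refl ← head-≡ π | refl ← ends Z (subst (λ L → Path _⇒_ c L l) eq π) =
      Grow.Last.absurd a stuck C<k Q<2k degree Pp p∉ refl π l⇒c p~x

    step : ∀ C → Alternating C → length C < k → Stuck C → All (λ y → ¬ p ≡ y) (ps C) →
           (∃ λ X → ∃ λ x → ∃ λ Y → C ≡ X ++ x ∷ Y × p ~ proj₂ x) ⊎ tally (E p) (qs C) ≡ 0 → ⊥
    step C a C<k stuck p∉ (inj₂ t≡0) = nowhere C a C<k stuck p∉ t≡0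
    step C a C<k stuck p∉ (inj₁ (X , x , Y , C≡ , p~x)) = somewhere (Y ++ X ++ x ∷ [])
      (rotateAlt (X ++ x ∷ []) Y (subst Alternating C≡′ a)) (subst (_< k) size C<k)
      (λ D α eq → stuck D α (trans eq (cong suc (sym size)))) (All-resp-↭ (map⁺ proj₁ turn) p∉)
      (Y ++ X , sym (++-assoc Y X (x ∷ []))) p~x
      where
      C≡′ : C ≡ (X ++ x ∷ []) ++ Y
      C≡′ = trans C≡ (sym (++-assoc X (x ∷ []) Y))
      turn : C ↭ Y ++ X ++ x ∷ []
      turn = ↭-trans (↭-reflexive C≡′) (++-comm (X ++ x ∷ []) Y)
      size : length C ≡ length (Y ++ X ++ x ∷ [])
      size = ↭-length turn

    locate : ∀ C → (∃ λ X → ∃ λ x → ∃ λ Y → C ≡ X ++ x ∷ Y × p ~ proj₂ x) ⊎ tally (E p) (qs C) ≡ 0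
    locate [] = inj₂ refl
    locate (d ∷ D) with E p (proj₂ d) in eq | locate D
    ... | true  | _                           = inj₁ ([] , d , D , refl , eq)
    ... | false | inj₁ (X , x , Y , eq′ , e) = inj₁ (d ∷ X , x , Y , cong (d ∷_) eq′ , e)
    ... | false | inj₂ t≡0                   = inj₂ t≡0

  -- Jackson's theorem on long cycles in bipartite graphs, for the case in which all degrees on one side are at least k.
  alternatingCycle : ∀ {k} → 1 ≤ k → k ≤ count P → count Q + 2 ≤ 2 * k → (∀ p → P p ≡ true → k ≤ count (Q ∩ E p)) →
                     ¬ Cycles _~_ (λ x → P x ≡ true ⊎ Q x ≡ true) (2 * k) → ⊥
  alternatingCycle {k} 1≤k k≤P Q<2k degree noCycle = ofLength k 1≤k ≤-refl finish
    where
    ofLength : ∀ r → 1 ≤ r → r ≤ k → (∀ C → Alternating C → length C ≡ r → ⊥) → ⊥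
    ofLength 1 _ _ none =
      let p , Pp = inhabited {S = P} (≤-trans 1≤k k≤P)
          q , h  = inhabited {S = Q ∩ E p} (≤-trans 1≤k (degree p Pp))
      in none ((p , q) ∷ []) (alt (_ , _ , stop _ , ~-sym (∧-right {Q q} h)) (All.[] ∷ []) (All.[] ∷ [])
           ((Pp , ∧-left h , ∧-right {Q q} h) All.∷ All.[])) refl
    ofLength (suc (suc r)) _ r<k none = ofLength (suc r) (s≤s z≤n) (≤-trans (n≤1+n (suc r)) r<k) λ C a eq →
      let C<k = subst (_< k) (sym eq) r<k
          p , Pp , p∉ = escape {S = P} (ps C) (≤-trans (s≤s (eq≤ (length-map proj₁ C))) (≤-trans C<k k≤P))
      in Step.step Q<2k degree Pp C a C<k (λ D α eq′ → none D α (trans eq′ (cong suc eq))) p∉ (Step.locate Q<2k degree Pp C)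

    finish : ∀ C → Alternating C → length C ≡ k → ⊥
    finish C a refl with c , l , π , l⇒c ← closed a = noCycle (flatten C ,
      (_ , _ , flatten-path π (ok a) , l⇒c) ,
      Unique-↭ (↭-sym (flatten-↭ C)) (Unique.++⁺ (uniqP a) (uniqQ a) (λ (h , h′) → PQ _ (All.lookup allP h) (All.lookup allQ h′))) ,
      All-resp-↭ (↭-sym (flatten-↭ C)) (All.++⁺ (All.map inj₁ allP) (All.map inj₂ allQ)) ,
      size C)
      where
      allP : All (λ x → P x ≡ true) (ps C)
      allP = All.map⁺ (All.map proj₁ (ok a))
      allQ : All (λ x → Q x ≡ true) (qs C)
      allQ = All.map⁺ (All.map (proj₁ ∘ proj₂) (ok a))
      size : ∀ C → length (flatten C) ≡ 2 * length C
      size [] = refl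
      size (_ ∷ C) = trans (cong (2 +_) (size C)) (sym (*-suc 2 (length C)))

-- Longest paths avoiding a vertex

-- The second argument counts steps, so the list has one entry more and is never empty.
up : ℕ → ℕ → List ℕ
up i zero    = i ∷ []
up i (suc d) = i ∷ up (suc i) d

down : ℕ → ℕ → List ℕ
down i d = reverse (up i d)

up-length : ∀ i d → length (up i d) ≡ suc d
up-length i zero    = refl
up-length i (suc d) = cong suc (up-length (suc i) d)

down-length : ∀ i d → length (down i d) ≡ suc d
down-length i d = trans (length-reverse (up i d)) (up-length i d)

-- Every path or cycle below is pieced together from runs of indices. Recording the interval of each
-- run reduces distinctness of the vertices to comparing the end points of intervals.
Block : ℕ → ℕ → List ℕ → Set
Block lo hi is = Unique is × All (λ z → lo ≤ z × z ≤ hi) is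

up-bounds : ∀ d {i j} → d + i ≡ j → All (λ z → i ≤ z × z ≤ j) (up i d)
up-bounds zero    refl = (≤-refl , ≤-refl) All.∷ All.[]
up-bounds (suc d) {i} refl = (≤-refl , m≤n+m i (suc d)) All.∷
  All.map (λ (l , u) → ≤-trans (n≤1+n i) l , u) (up-bounds d (+-suc d i))

up-block : ∀ d {i j} → d + i ≡ j → Block i j (up i d)
up-block d {i} eq = unique d i , up-bounds d eq
  where
  unique : ∀ d i → Unique (up i d)
  unique zero    i = All.[] ∷ []
  unique (suc d) i = All.map (λ (l , _) i≡z → 1+n≰n (≤-trans l (eq≥ i≡z))) (up-bounds d refl) ∷ unique d (suc i)

down-block : ∀ d {i j} → d + i ≡ j → Block i j (down i d)
down-block d eq = let u , b = up-block d eq in Unique-↭ (↭-sym (↭-reverse _)) u , All-resp-↭ (↭-sym (↭-reverse _)) b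

single : ∀ i → Block i i (i ∷ [])
single i = All.[] ∷ [] , (≤-refl , ≤-refl) All.∷ All.[]

widen : ∀ {a b c d is} → a ≤ b → c ≤ d → Block b c is → Block a d is
widen p q (u , b) = u , All.map (λ (l , h) → ≤-trans p l , ≤-trans h q) b

block-< : ∀ {a b c d is js} → b < c → Block a b is → Block c d js → a ≤ c → b ≤ d → Block a d (is ++ js)
block-< b<c (u , b) (u′ , b′) a≤c b≤d =
  AllPairs.++⁺ u u′ (All.map (λ (_ , h) → All.map (λ (l , _) eq → 1+n≰n (≤-trans (≤-trans (s≤s h) (≤-trans b<c l)) (eq≥ eq))) b′) b) ,
  All.++⁺ (All.map (λ (l , h) → l , ≤-trans h b≤d) b) (All.map (λ (l , h) → ≤-trans a≤c l , h) b′)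

block-> : ∀ {a b c d is js} → d < a → Block a b is → Block c d js → c ≤ a → d ≤ b → Block c b (is ++ js)
block-> d<a (u , b) (u′ , b′) c≤a d≤b =
  AllPairs.++⁺ u u′ (All.map (λ (l , _) → All.map (λ (_ , h) eq → 1+n≰n (≤-trans (≤-trans (s≤s h) (≤-trans d<a l)) (eq≤ eq))) b′) b) ,
  All.++⁺ (All.map (λ (l , h) → ≤-trans c≤a l , h) b) (All.map (λ (l , h) → l , ≤-trans h d≤b) b′)

tallyℕ : (ℕ → Bool) → List ℕ → ℕ
tallyℕ f []       = 0
tallyℕ f (i ∷ is) = b2n (f i) + tallyℕ f is

tally-map : ∀ {n} (S : Subset n) (y : ℕ → Fin n) is → tally S (map y is) ≡ tallyℕ (S ∘ y) is
tally-map S y []       = refl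
tally-map S y (i ∷ is) = cong (b2n (S (y i)) +_) (tally-map S y is)

tally-shift : ∀ {f g : ℕ → Bool} d {i} → (∀ {z} → i ≤ z → z ≤ d + i → b2n (f (suc z)) ≤ b2n (g z)) →
              tallyℕ f (up (suc i) d) ≤ tallyℕ g (up i d)
tally-shift zero    h = +-monoˡ-≤ 0 (h ≤-refl ≤-refl)
tally-shift (suc d) {i} h = +-mono-≤ (h ≤-refl (m≤n+m i (suc d)))
  (tally-shift d λ l u → h (≤-trans (n≤1+n i) l) (≤-trans u (eq≤ (+-suc d i))))

tally-snoc : ∀ f i d → tallyℕ f (up i (suc d)) ≡ tallyℕ f (up i d) + b2n (f (suc d + i))
tally-snoc f i zero    = trans (cong (b2n (f i) +_) (+-identityʳ _)) (cong (_+ b2n (f (suc i))) (sym (+-identityʳ _)))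
tally-snoc f i (suc d) = trans (cong (b2n (f i) +_) (tally-snoc f (suc i) d))
  (trans (sym (+-assoc (b2n (f i)) _ _)) (cong (λ z → b2n (f i) + tallyℕ f (up (suc i) d) + b2n (f z)) (+-suc (suc d) i)))

b2n-pair : ∀ {a b} → (a ≡ true → b ≡ true → ⊥) → b2n a + b2n b ≤ 1
b2n-pair {true}  {true}  h = ⊥-elim (h refl refl)
b2n-pair {true}  {false} h = ≤-refl
b2n-pair {false} {b}     h = b2n≤1 b

private
  interchange : ∀ a c {b e d} → a + c ≤ 1 → b + e ≤ suc d → (a + b) + (c + e) ≤ suc (suc d)
  interchange a c {b} {e} {d} h₁ h₂ = lin 0 (h₁ ⊹ h₂) (solve (a ⨾ b ⨾ c ⨾ d ⨾ e ⨾ ε))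

tally-pair : ∀ {f g : ℕ → Bool} d {i j} → (∀ {z} → z ≤ d → f (z + i) ≡ true → g (z + j) ≡ true → ⊥) →
             tallyℕ f (up i d) + tallyℕ g (up j d) ≤ suc d
tally-pair {f} {g} zero {i} {j} h = ≤-trans (eq≤ (cong₂ _+_ (+-identityʳ (b2n (f i))) (+-identityʳ (b2n (g j))))) (b2n-pair (h z≤n))
tally-pair {f} {g} (suc d) {i} {j} h = interchange (b2n (f i)) (b2n (g j)) (b2n-pair (h z≤n))
  (tally-pair d λ {z} z≤d a b → h (s≤s z≤d) (trans (cong f (sym (+-suc z i))) a) (trans (cong g (sym (+-suc z j))) b))
private
  degree-sum : ∀ δ a b d → δ ≤ 1 + a → δ ≤ 1 + b → a + b ≤ suc d → 2 * δ ≤ 3 + d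
  degree-sum δ a b d h₁ h₂ h₃ = lin 0 (h₁ ⊹ h₂ ⊹ h₃) (solve (a ⨾ b ⨾ d ⨾ δ ⨾ ε))

∈-up : ∀ d {i z} → i ≤ z → z ≤ d + i → z ∈ up i d
∈-up zero    l u = here (≤-antisym u l)
∈-up (suc d) {i} {z} l u with i ≟ℕ z
... | yes refl = here refl
... | no  i≢z  = there (∈-up d (≤∧≢⇒< l i≢z) (≤-trans u (eq≥ (+-suc d i))))

-- Position 0 holds `t`, and past the end the last entry is repeated, since each entry becomes the
-- default for those after it.
at : ∀ {A : Set} → A → List A → ℕ → A
at t xs       zero    = t
at t []       (suc i) = t
at t (x ∷ xs) (suc i) = at x xs i

at-last : ∀ {A : Set} {R : A → A → Set} {a b xs} t → Path R a xs b → at t xs (length xs) ≡ b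
at-last t (stop a)              = refl
at-last t (_∷_ {a} e p) = at-last a p

at-adj : ∀ {A : Set} {R : A → A → Set} {a b xs} t → Path R a xs b → ∀ {i} → 1 ≤ i → i < length xs → R (at t xs i) (at t xs (suc i))
at-adj t (stop a) {suc i} _ (s≤s ())
at-adj t (_∷_ {xs = []} e ())
at-adj t (_∷_ {a} {xs = x ∷ xs} e p) {suc zero}    _ h with refl ← head-≡ p = e
at-adj t (_∷_ {a} {xs = x ∷ xs} e p) {suc (suc i)} _ (s≤s h) = at-adj a p (s≤s z≤n) h

at-∈ : ∀ {A : Set} (t : A) xs i → at t xs i ∈ t ∷ xs
at-∈ t xs       zero    = here refl
at-∈ t []       (suc i) = here refl
at-∈ t (x ∷ xs) (suc i) = there (at-∈ x xs i)

at-inj : ∀ {A : Set} {t : A} {xs} → Unique (t ∷ xs) → ∀ {i j} → i ≤ length xs → j ≤ length xs → at t xs i ≡ at t xs j → i ≡ j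
at-inj u {zero} {zero} _ _ eq = refl
at-inj {t = t} {x ∷ xs} (t∉ ∷ u) {zero}  {suc j} _ h eq = ⊥-elim (All.lookup t∉ (at-∈ x xs j) eq)
at-inj {t = t} {x ∷ xs} (t∉ ∷ u) {suc i} {zero}  h _ eq = ⊥-elim (All.lookup t∉ (at-∈ x xs i) (sym eq))
at-inj {xs = x ∷ xs} (_ ∷ u) {suc i} {suc j} (s≤s h) (s≤s h′) eq = cong suc (at-inj u h h′ eq)

module Lasso {n : ℕ} (E : Fin n → Fin n → Bool) (E-sym : ∀ x y → E x y ≡ E y x) (E-irr : ∀ x → E x x ≡ false)
  (X : Subset n) (t : Fin n) where

  _~_ : Fin n → Fin n → Set
  x ~ y = E x y ≡ true

  ~-sym : ∀ {x y} → x ~ y → y ~ x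
  ~-sym {x} {y} h = trans (E-sym y x) h

  InX : Fin n → Set
  InX x = X x ≡ true

  -- A path y 1, …, y q in X - t, with t stored as y 0.
  record Lasso (q : ℕ) : Set where
    constructor lasso
    field
      y   : ℕ → Fin n
      y0  : y 0 ≡ t
      inj : ∀ {i j} → i ≤ q → j ≤ q → y i ≡ y j → i ≡ j
      adj : ∀ {i} → 1 ≤ i → i < q → y i ~ y (suc i)
      inX : ∀ {i} → i ≤ q → InX (y i)

  fromPath : ∀ {a b xs} → Path _~_ a xs b → Unique (t ∷ xs) → All InX (t ∷ xs) → Lasso (length xs)
  fromPath {xs = xs} p u all = lasso (at t xs) refl (at-inj u) (at-adj t p) (λ {i} _ → All.lookup all (at-∈ t xs i))

  module Routes {q} (L : Lasso q) where
    open Lasso L public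

    Route : ℕ → List ℕ → ℕ → Set
    Route = Path (λ a b → y a ~ y b)

    upRoute : ∀ d {i j} → d + i ≡ j → 1 ≤ i → j ≤ q → Route i (up i d) j
    upRoute zero    refl _ _ = stop _
    upRoute (suc d) {i} refl 1≤i j≤q =
      adj 1≤i (≤-trans (s≤s (m≤n+m i d)) j≤q) ∷ upRoute d (+-suc d i) (s≤s z≤n) j≤q

    downRoute : ∀ d {i j} → d + i ≡ j → 1 ≤ i → j ≤ q → Route j (down i d) i
    downRoute d eq 1≤i j≤q = reversePath ~-sym (upRoute d eq 1≤i j≤q)

    map-unique : ∀ {is} → Block 0 q is → Unique (map y is)
    map-unique (u , b) = AllPairs.map⁺ (go u b)
      where
      go : ∀ {is} → Unique is → All (λ z → 0 ≤ z × z ≤ q) is → AllPairs (λ i j → ¬ y i ≡ y j) is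
      go [] _ = []
      go (d ∷ u) ((_ , h) All.∷ hs) = All.zipWith (λ (i≢j , _ , h′) eq → i≢j (inj h h′ eq)) (d , hs) ∷ go u hs

    map-inX : ∀ {lo is} → Block lo q is → All InX (map y is)
    map-inX (_ , b) = All.map⁺ (All.map (λ (_ , h) → inX h) b)

    cycle : ∀ {a b is} → Route a is b → y b ~ y a → Block 0 q is → Cycles _~_ InX (length is)
    cycle {is = is} r e bl = map y is , (_ , _ , mapPath y id r , e) , map-unique bl , map-inX bl , length-map y is

    reroute : ∀ {a b is} → Route a is b → Block 1 q is → Lasso (length (map y is))
    reroute {is = is} r bl@(u , b) = fromPath (mapPath y id r)
      (subst (λ x → Unique (x ∷ map y is)) y0 (map-unique {0 ∷ is}
        (All.map (λ (l , _) eq → 1+n≰n (≤-trans l (eq≥ eq))) b ∷ u , (z≤n , z≤n) All.∷ All.map (λ (_ , h) → z≤n , h) b)))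
      (subst InX y0 (inX z≤n) All.∷ map-inX bl)

    reroute-first : ∀ {a b is} (r : Route a is b) (bl : Block 1 q is) → Lasso.y (reroute r bl) 1 ≡ y a
    reroute-first (stop _)  _ = refl
    reroute-first (e ∷ r) _ = refl

    reroute-last : ∀ {a b is} (r : Route a is b) (bl : Block 1 q is) → Lasso.y (reroute r bl) (length (map y is)) ≡ y b
    reroute-last r bl = at-last t (mapPath {Q = _~_} y id r)

    vertices : List (Fin n)
    vertices = map y (up 0 q)

    ∈-vertices : ∀ {i} → i ≤ q → y i ∈ vertices
    ∈-vertices h = ∈-map⁺ y (∈-up q z≤n (≤-trans h (eq≥ (+-identityʳ q))))

    extend : ∀ {z a b is} → InX z → elem vertices z ≡ false → Route a is b → Block 1 q is → z ~ y a → Lasso (suc (length (map y is)))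
    extend {z} {is = is} Xz z∉ r bl@(u , b) e = fromPath (e ∷ mapPath y id r)
      ((t≢z All.∷ t∉) ∷ All.map⁺ (All.map (λ (_ , h) eq → z≢y h eq) b) ∷ map-unique (widen z≤n ≤-refl bl))
      (Xt All.∷ Xz All.∷ map-inX bl)
      where
      z≢y : ∀ {i} → i ≤ q → ¬ z ≡ y i
      z≢y h refl = false-true z∉ (∈-elem (∈-vertices h))
      t≢z : ¬ t ≡ z
      t≢z eq = z≢y z≤n (trans (sym eq) (sym y0))
      Xt : InX t
      Xt = subst InX y0 (inX z≤n)
      t∉ : All (λ x → ¬ t ≡ x) (map y is)
      t∉ = All.map⁺ (All.map (λ (l , h) eq → 1+n≰n (≤-trans l (eq≥ (inj z≤n h (trans y0 eq))))) b)

  b2n-imp : ∀ {a b} → (a ≡ true → b ≡ true) → b2n a ≤ b2n b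
  b2n-imp {false} h = z≤n
  b2n-imp {true}  h rewrite h refl = ≤-refl

  reversed : ∀ {q} → Lasso q → Lasso q
  reversed {q} L = lasso y′ refl inj′ adj′ inX′
    where
    open Lasso L
    y′ : ℕ → Fin n
    y′ zero    = t
    y′ (suc i) = y (q ∸ i)
    t≢ : ∀ {j} → suc j ≤ q → ¬ t ≡ y (q ∸ j)
    t≢ {j} h eq = n≮0 (≤-trans (m<n⇒0<n∸m h) (eq≥ (inj z≤n (m∸n≤m q j) (trans y0 eq))))
    inj′ : ∀ {i j} → i ≤ q → j ≤ q → y′ i ≡ y′ j → i ≡ j
    inj′ {zero}  {zero}  _ _ _  = refl
    inj′ {zero}  {suc j} _ h eq = ⊥-elim (t≢ h eq)
    inj′ {suc i} {zero}  h _ eq = ⊥-elim (t≢ h (sym eq))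
    inj′ {suc i} {suc j} h h′ eq = cong suc (∸-cancelˡ-≡ (≤-trans (n≤1+n i) h) (≤-trans (n≤1+n j) h′) (inj (m∸n≤m q i) (m∸n≤m q j) eq))
    adj′ : ∀ {i} → 1 ≤ i → i < q → y′ i ~ y′ (suc i)
    adj′ {suc i} _ h = ~-sym (subst (λ z → y (q ∸ suc i) ~ y z) (sym next)
      (adj (m<n⇒0<n∸m h) (≤-trans (eq≥ next) (m∸n≤m q i))))
      where
      next : q ∸ i ≡ suc (q ∸ suc i)
      next = +-∸-assoc 1 (≤-trans (n≤1+n (suc i)) h)
    inX′ : ∀ {i} → i ≤ q → InX (y′ i)
    inX′ {zero}  _ = subst InX y0 (inX z≤n)
    inX′ {suc i} _ = inX (m∸n≤m q i)

  reversed-at : ∀ {q} (L : Lasso q) {i j} → 1 ≤ i → i + j ≡ suc q → Lasso.y (reversed L) i ≡ Lasso.y L j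
  reversed-at L {suc i} {j} _ refl = cong (Lasso.y L) (m+n∸m≡n i j)

  module Longest {q} (longest : ∀ {q′} → q < q′ → Lasso q′ → ⊥) {δ}
    (δ≤ : ∀ {x} → InX x → δ ≤ count (X ∩ E x)) (dominating : count X ≤ count (X ∩ E t) + δ) where

    neighbours : (L : Lasso q) → 1 ≤ q → ∀ {z} → InX z → Lasso.y L 1 ~ z → z ∈ Routes.vertices L
    neighbours L (s≤s {n = d} _) {z} Xz e with elem (Routes.vertices L) z in eq
    ... | true  = elem-∈ (Routes.vertices L) eq
    ... | false = ⊥-elim (longest (s≤s (eq≥ (trans (length-map y (up 1 d)) (up-length 1 d))))
                    (extend Xz eq (upRoute d (+-comm d 1) ≤-refl ≤-refl) (up-block d (+-comm d 1)) (~-sym e)))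
      where open Routes L

    degree-tally : (L : Lasso q) → 1 ≤ q → δ ≤ tallyℕ (λ i → E (Lasso.y L 1) (Lasso.y L i)) (up 0 q)
    degree-tally L 1≤q = begin
      δ                                        ≤⟨ δ≤ (inX 1≤q) ⟩
      count (X ∩ E (y 1))                      ≤⟨ count≤tally vertices (λ {z} h → neighbours L 1≤q (∧-left h) (∧-right {X z} h)) ⟩
      tally (X ∩ E (y 1)) vertices             ≤⟨ tally-mono vertices (λ z → ∧-right {X z}) ⟩
      tally (E (y 1)) vertices                 ≡⟨ tally-map (E (y 1)) y (up 0 q) ⟩
      tallyℕ (λ i → E (y 1) (y i)) (up 0 q)    ∎
      where
      open ≤-Reasoning
      open Routes L

    -- Pósa rotation: y j, ..., y 1, y (j + 1), ..., y q. The last vertex stays in place.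
    rotation : (L : Lasso q) → ∀ {j} → 1 ≤ j → suc j ≤ q → Lasso.y L 1 ~ Lasso.y L (suc j) →
               ∃ λ (L′ : Lasso q) → Lasso.y L′ 1 ≡ Lasso.y L j × Lasso.y L′ q ≡ Lasso.y L q
    rotation L {suc i} _ j<q e with d , d≡ ← m≤n⇒∃[o]m+o≡n j<q =
      subst (λ m → ∃ λ (L′ : Lasso m) → Lasso.y L′ 1 ≡ y (suc i) × Lasso.y L′ m ≡ y q) size
        (reroute r bl , reroute-first r bl , reroute-last r bl)
      where
      open Routes L
      d≡′ : d + suc (suc i) ≡ q
      d≡′ = trans (+-comm d (suc (suc i))) d≡
      i≤q : suc i ≤ q
      i≤q = ≤-trans (n≤1+n _) j<q
      r  = join (downRoute i (+-comm i 1) ≤-refl i≤q) e (upRoute d d≡′ (s≤s z≤n) ≤-refl)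
      bl = block-< ≤-refl (down-block i (+-comm i 1)) (up-block d d≡′) (s≤s z≤n) i≤q
      size : length (map y (down 1 i ++ up (suc (suc i)) d)) ≡ q
      size = trans (length-map y (down 1 i ++ up (suc (suc i)) d)) (trans (length-++ (down 1 i))
               (trans (cong₂ _+_ (down-length 1 i) (up-length (suc (suc i)) d))
                 (trans (+-suc (suc i) d) d≡)))

    -- Rotating at neighbours of the first vertex yields more first vertices than t has non-neighbours.
    adjacentEnd : (L : Lasso q) → 1 ≤ q → 1 ≤ δ →
                  ((L′ : Lasso q) → t ~ Lasso.y L′ 1 → Lasso.y L′ q ≡ Lasso.y L q → ⊥) → ⊥
    adjacentEnd L 1≤q 1≤δ found = go q refl
      where
      open Routes L
      Xt : InX t
      Xt = subst InX y0 (inX z≤n)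
      t≁y1 : E t (y 1) ≡ false
      t≁y1 = ≢true λ e → found L e refl
      y1≁t : E (y 1) (y 0) ≡ false
      y1≁t = trans (cong (E (y 1)) y0) (trans (E-sym (y 1) t) t≁y1)
      others : Subset n
      others = X ∖ E t ∖ ⁅ t ⁆
      t∈ : (X ∖ E t) t ≡ true
      t∈ = ∧-true Xt (cong not (E-irr t))
      -- `t` is one of its own non-neighbours, which makes the inequality strict.
      few : count others < δ
      few = +-cancelˡ-≤ (count (X ∩ E t)) _ _ (≤-trans (eq≥ (trans (count-split X (E t)) (cong (count (X ∩ E t) +_) (count-remove {S = X ∖ E t} t∈)))) dominating)
      go : ∀ m → q ≡ m → ⊥
      go zero    refl = n≮0 1≤q
      go (suc zero) refl = n≮0 (≤-trans 1≤δ (≤-trans (degree-tally L 1≤q)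
        (eq≤ (cong₂ (λ a b → b2n a + (b2n b + 0)) y1≁t (E-irr (y 1))))))
      go (suc (suc d)) refl = 1+n≰n (≤-trans few (begin
        δ                                             ≤⟨ degree-tally L 1≤q ⟩
        tallyℕ A (up 0 (suc (suc d)))                 ≡⟨ cong₂ (λ a b → b2n a + (b2n b + tallyℕ A (up 2 d))) y1≁t (E-irr (y 1)) ⟩
        tallyℕ A (up 2 d)                             ≤⟨ tally-shift d step ⟩
        tallyℕ (others ∘ y) (up 1 d)                  ≡⟨ tally-map others y (up 1 d) ⟨
        tally others (map y (up 1 d))                 ≤⟨ tally≤count (map-unique (widen z≤n (n≤1+n _) (up-block d (+-comm d 1)))) ⟩
        count others                                  ∎))
        where
        open ≤-Reasoning
        A : ℕ → Bool
        A i = E (y 1) (y i)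
        step : ∀ {z} → 1 ≤ z → z ≤ d + 1 → b2n (A (suc z)) ≤ b2n (others (y z))
        step {z} 1≤z z≤ = b2n-imp λ e → ∧-true (∧-true (inX z≤q) (cong not (≢true λ e′ → found′ e e′)))
          (cong not (⁅⁆-≢ λ eq → 1+n≰n (≤-trans 1≤z (eq≤ (inj z≤q z≤n (trans eq (sym y0)))))))
          where
          z<q : suc z ≤ suc (suc d)
          z<q = s≤s (≤-trans z≤ (eq≤ (+-comm d 1)))
          z≤q : z ≤ suc (suc d)
          z≤q = ≤-trans (n≤1+n z) z<q
          found′ : A (suc z) ≡ true → E t (y z) ≡ true → ⊥
          found′ e e′ = let L′ , first , last = rotation L 1≤z z<q e in found L′ (subst (t ~_) (sym first) e′) last

    -- One end is made adjacent to `t`, the path is reversed, and the other end is treated; the end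
    -- already settled is now last and is not moved.
    bothEnds : Lasso q → 1 ≤ q → 1 ≤ δ → ((L : Lasso q) → t ~ Lasso.y L 1 → t ~ Lasso.y L q → ⊥) → ⊥
    bothEnds L 1≤q 1≤δ found = adjacentEnd L 1≤q 1≤δ λ L₁ e _ →
      adjacentEnd (reversed L₁) 1≤q 1≤δ λ L₃ e′ last → found L₃ e′ (subst (t ~_) (sym (trans last (reversed-at L₁ 1≤q (+-comm q 1)))) e)

    neighbours-last : (L : Lasso q) → 1 ≤ q → ∀ {z} → InX z → Lasso.y L q ~ z → z ∈ Routes.vertices L
    neighbours-last L (s≤s {n = d} _) {z} Xz e with elem (Routes.vertices L) z in eq
    ... | true  = elem-∈ (Routes.vertices L) eq
    ... | false = ⊥-elim (longest (s≤s (eq≥ (trans (length-map y (down 1 d)) (down-length 1 d))))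
                    (extend Xz eq (downRoute d (+-comm d 1) ≤-refl ≤-refl) (down-block d (+-comm d 1)) (~-sym e)))
      where open Routes L

    degree-tally-last : (L : Lasso q) → 1 ≤ q → δ ≤ tallyℕ (λ i → E (Lasso.y L q) (Lasso.y L i)) (up 0 q)
    degree-tally-last L 1≤q = begin
      δ                                        ≤⟨ δ≤ (inX ≤-refl) ⟩
      count (X ∩ E (y q))                      ≤⟨ count≤tally vertices (λ {z} h → neighbours-last L 1≤q (∧-left h) (∧-right {X z} h)) ⟩
      tally (X ∩ E (y q)) vertices             ≤⟨ tally-mono vertices (λ z → ∧-right {X z}) ⟩
      tally (E (y q)) vertices                 ≡⟨ tally-map (E (y q)) y (up 0 q) ⟩
      tallyℕ (λ i → E (y q) (y i)) (up 0 q)    ∎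
      where
      open ≤-Reasoning
      open Routes L

    -- A crossing closes the path into a cycle, which can be opened at any of its vertices.
    crossing : (L : Lasso q) → ∀ {i} → 1 ≤ i → suc i ≤ q → Lasso.y L 1 ~ Lasso.y L (suc i) → Lasso.y L q ~ Lasso.y L i →
               ∀ {j z} → 1 ≤ j → j ≤ q → InX z → elem (Routes.vertices L) z ≡ false → Lasso.y L j ~ z → ⊥
    crossing L {suc i} _ i<q e₁ e₂ {j} {z} 1≤j j≤q Xz z∉ e with d , d≡ ← m≤n⇒∃[o]m+o≡n i<q =
      go (∈-∃++ j∈C)
      where
      open Routes L
      d≡′ : d + suc (suc i) ≡ q
      d≡′ = trans (+-comm d (suc (suc i))) d≡
      i≤q : suc i ≤ q
      i≤q = ≤-trans (n≤1+n _) i<q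
      C : List ℕ
      C = up 1 i ++ down (suc (suc i)) d
      route : Closed (λ a b → y a ~ y b) C
      route = _ , _ , join (upRoute i (+-comm i 1) ≤-refl i≤q) (~-sym e₂) (downRoute d d≡′ (s≤s z≤n) ≤-refl) , ~-sym e₁
      block : Block 1 q C
      block = block-< ≤-refl (up-block i (+-comm i 1)) (down-block d d≡′) (s≤s z≤n) i≤q
      size : length C ≡ q
      size = trans (length-++ (up 1 i)) (trans (cong₂ _+_ (up-length 1 i) (down-length (suc (suc i)) d))
               (trans (+-suc (suc i) d) d≡))
      j∈C : j ∈ C
      j∈C with j ≤? suc i
      ... | yes j≤i = ∈-++⁺ˡ (∈-up i 1≤j (≤-trans j≤i (eq≤ (+-comm 1 i))))
      ... | no  j≰i = ∈-++⁺ʳ (up 1 i) (∈-resp-↭ (↭-sym (↭-reverse _)) (∈-up d (≰⇒> j≰i) (≤-trans j≤q (eq≥ d≡′))))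
      go : (∃ λ A → ∃ λ B → C ≡ A ++ j ∷ B) → ⊥
      go (A , B , C≡) = turned (rotate A (j ∷ B) (subst (Closed _) C≡ route))
        where
        turned : Closed (λ a b → y a ~ y b) (j ∷ B ++ A) → ⊥
        turned (a , b , p , _) with refl ← head-≡ p = longest
          (s≤s (eq≥ (trans (length-map y (j ∷ B ++ A)) (trans (↭-length (++-comm (j ∷ B) A)) (trans (cong length (sym C≡)) size)))))
          (extend Xz z∉ p (Unique-↭ (++-comm A (j ∷ B)) (subst Unique C≡ (proj₁ block)) ,
             All-resp-↭ (++-comm A (j ∷ B)) (subst (All _) C≡ (proj₂ block))) (~-sym e))

    Detached : Lasso q → Set
    Detached L = ∀ {j z} → 1 ≤ j → j ≤ q → InX z → elem (Routes.vertices L) z ≡ false → Lasso.y L j ~ z → ⊥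

    -- Each end has at least δ - 1 neighbours on the path besides `t`. A position i with y 1 ~ y (i
    -- + 1) and y q ~ y i would be a crossing and make the path detached, so the two sets of
    -- positions are disjoint among q - 1 places.
    longPath : (L : Lasso q) → 1 ≤ q → t ~ Lasso.y L 1 → t ~ Lasso.y L q → 2 ≤ δ → (Detached L → ⊥) → 2 * δ ≤ suc q
    longPath L 1≤q e₁ e₂ 2≤δ attached = go q refl
      where
      open Routes L
      A B : ℕ → Bool
      A i = E (y 1) (y i)
      B i = E (y q) (y i)
      A0 : A 0 ≡ true
      A0 = trans (cong (E (y 1)) y0) (~-sym e₁)
      B0 : B 0 ≡ true
      B0 = trans (cong (E (y q)) y0) (~-sym e₂)
      go : ∀ m → q ≡ m → 2 * δ ≤ suc m
      go zero       refl = ⊥-elim (n≮0 1≤q)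
      go (suc zero) refl = ⊥-elim (1+n≰n (≤-trans 2≤δ (≤-trans (degree-tally L 1≤q)
        (eq≤ (cong₂ (λ a b → b2n a + (b2n b + 0)) A0 (E-irr (y 1)))))))
      go (suc (suc d)) refl = degree-sum δ (tallyℕ A (up 2 d)) (tallyℕ B (up 1 d)) d
        (≤-trans (degree-tally L 1≤q) (eq≤ (cong₂ (λ a b → b2n a + (b2n b + tallyℕ A (up 2 d))) A0 (E-irr (y 1)))))
        (≤-trans (degree-tally-last L 1≤q) (eq≤ (trans (cong (λ a → b2n a + tallyℕ B (up 1 (suc d))) B0)
          (cong suc (trans (tally-snoc B 1 d) (trans (cong (λ a → tallyℕ B (up 1 d) + b2n a)
            (trans (cong B (+-comm (suc d) 1)) (E-irr (y q)))) (+-identityʳ _)))))))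
        (tally-pair d λ {z} h a b → attached (crossing L {z + 1} (≤-trans (eq≤ (+-comm 1 0)) (m≤n+m 1 z))
          (s≤s (≤-trans (+-monoˡ-≤ 1 h) (eq≤ (+-comm d 1)))) (trans (cong A (sym (+-suc z 1))) a) b))

-- Chords from the ends of a long path

tally-++ : ∀ f i d e → tallyℕ f (up i (d + suc e)) ≡ tallyℕ f (up i d) + tallyℕ f (up (suc d + i) e)
tally-++ f i zero    e = cong (_+ tallyℕ f (up (suc i) e)) (sym (+-identityʳ (b2n (f i))))
tally-++ f i (suc d) e = trans (cong (b2n (f i) +_) (trans (tally-++ f (suc i) d e)
  (cong (λ z → tallyℕ f (up (suc i) d) + tallyℕ f (up z e)) (+-suc (suc d) i)))) (sym (+-assoc (b2n (f i)) _ _))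

private
  regroup′ : ∀ a c {b e d} → a + c ≤ 1 → b + e ≤ d → (a + b) + (c + e) ≤ suc d
  regroup′ a c {b} {e} {d} h₁ h₂ = lin 0 (h₁ ⊹ h₂) (solve (a ⨾ b ⨾ c ⨾ d ⨾ e ⨾ ε))

tally-pair-strict : ∀ {f g : ℕ → Bool} d {i j} → (∀ {z} → z ≤ d → f (z + i) ≡ true → g (z + j) ≡ true → ⊥) →
                    ∀ {w} → w ≤ d → f (w + i) ≡ false → g (w + j) ≡ false → tallyℕ f (up i d) + tallyℕ g (up j d) ≤ d
tally-pair-strict zero {i} {j} h {zero} _ p q rewrite p | q = z≤n
tally-pair-strict {f} {g} (suc d) {i} {j} h {zero} _ p q rewrite p | q = tally-pair d λ {z} z≤d a b →
  h (s≤s z≤d) (trans (cong f (sym (+-suc z i))) a) (trans (cong g (sym (+-suc z j))) b)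
tally-pair-strict {f} {g} (suc d) {i} {j} h {suc w} (s≤s w≤d) p q = regroup′ (b2n (f i)) (b2n (g j)) (b2n-pair (h z≤n))
  (tally-pair-strict d (λ {z} z≤d a b → h (s≤s z≤d) (trans (cong f (sym (+-suc z i))) a) (trans (cong g (sym (+-suc z j))) b))
    w≤d (trans (cong f (+-suc w i)) p) (trans (cong g (+-suc w j)) q))

-- For a path y 1, …, y q with q = c + s whose ends are adjacent to t: x i says that t ~ y i and A i that y 1 ~ y i.
-- The last four fields exclude the following cycles on c + 2 vertices, in this order:
-- t, y j, …, y i, y 1, y l, …, y m;  t, y 1, y i, …, y j;  t, y i, …, y (c + i);  y 1, y i, …, y (c + i).
record Chorded (c s : ℕ) (x A : ℕ → Bool) : Set where
  field
    first  : x 1 ≡ true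
    last   : x (c + s) ≡ true
    second : A 2 ≡ true
    noG    : ∀ {i j l m} d e → 2 ≤ i → d + i ≡ j → j < l → e + l ≡ m → m ≤ c + s → d + e + 2 ≡ c →
             x j ≡ true → A i ≡ true → A l ≡ true → x m ≡ true → ⊥
    noH    : ∀ {i j} d → 2 ≤ i → d + i ≡ j → j ≤ c + s → d + 1 ≡ c → A i ≡ true → x j ≡ true → ⊥
    noF    : ∀ {i} → 1 ≤ i → i ≤ s → x i ≡ true → x (c + i) ≡ true → ⊥
    noF′   : ∀ {i} → 2 ≤ i → i ≤ s → A i ≡ true → A (c + i) ≡ true → ⊥

private
  total : ∀ a b a′ b′ c s → a + b ≤ suc c → a′ + b′ ≤ suc s → (1 + (a + a′)) + (b′ + b) ≤ 2 + c + suc s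
  total a b a′ b′ c s h₁ h₂ = lin 0 (h₁ ⊹ h₂) (solve (a ⨾ a′ ⨾ b ⨾ b′ ⨾ c ⨾ s ⨾ ε))
  total₁ : ∀ a b a′ b′ c s → a + b ≤ c → a′ + b′ ≤ suc s → 1 + ((1 + (a + a′)) + (b′ + b)) ≤ 2 + c + suc s
  total₁ a b a′ b′ c s h₁ h₂ = lin 0 (h₁ ⊹ h₂) (solve (a ⨾ a′ ⨾ b ⨾ b′ ⨾ c ⨾ s ⨾ ε))
  total₂ : ∀ a b a′ b′ c s → a + b ≤ suc c → a′ + b′ ≤ s → 1 + ((1 + (a + a′)) + (b′ + b)) ≤ 2 + c + suc s
  total₂ a b a′ b′ c s h₁ h₂ = lin 0 (h₁ ⊹ h₂) (solve (a ⨾ a′ ⨾ b ⨾ b′ ⨾ c ⨾ s ⨾ ε))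
  ahead : ∀ z s → z + 2 < z + (3 + s)
  ahead z s = lin s (z≤n {0}) (solve (s ⨾ z ⨾ ε))
  far : ∀ z e s → e + (z + (3 + s)) ≡ 2 + (z + e) + suc s
  far z e s = solve (e ⨾ s ⨾ z ⨾ ε)
  gap : ∀ z e → z + e + 2 ≡ 2 + (z + e)
  gap z e = solve (e ⨾ z ⨾ ε)
  nearby : ∀ z c → suc c + (z + 2) ≡ z + (3 + c)
  nearby z c = solve (c ⨾ z ⨾ ε)
  below : ∀ z c s → z ≤ s → z + (3 + c) ≤ 2 + c + suc s
  below z c s h = lin 0 h (solve (c ⨾ s ⨾ z ⨾ ε))
  above : ∀ z → 2 ≤ z + 2
  above z = lin z (z≤n {0}) (solve (z ⨾ ε))

module Tallies {c′ s′ x A} (C : Chorded (2 + c′) (suc s′) x A) where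
  open Chorded C
  private
    q₂ q₂′ : ℕ
    q₂  = c′ + suc s′
    q₂′ = s′ + suc c′
    pairG : ∀ {z} → z ≤ c′ → x (z + 2) ≡ true → A (z + (3 + s′)) ≡ true → ⊥
    pairG {z} h a b with e , refl ← m≤n⇒∃[o]m+o≡n h =
      noG z e ≤-refl refl (ahead z s′) (far z e s′) ≤-refl (gap z e) a second b last
    pairH : ∀ {z} → z ≤ s′ → x (z + (3 + c′)) ≡ true → A (z + 2) ≡ true → ⊥
    pairH {z} h a b = noH (suc c′) (above z) (nearby z c′) (below z c′ s′ h) (cong suc (+-comm c′ 1)) b a
    splitx : tallyℕ x (up 1 (suc q₂)) ≡ 1 + (tallyℕ x (up 2 c′) + tallyℕ x (up (suc c′ + 2) s′))
    splitx = cong₂ (λ a b → b2n a + b) first (tally-++ x 2 c′ s′)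
    splitA : tallyℕ A (up 2 q₂′) ≡ tallyℕ A (up 2 s′) + tallyℕ A (up (suc s′ + 2) c′)
    splitA = tally-++ A 2 s′ c′
    splits : tallyℕ x (up 1 (suc q₂)) + tallyℕ A (up 2 q₂′) ≡
             1 + (tallyℕ x (up 2 c′) + tallyℕ x (up (3 + c′) s′)) + (tallyℕ A (up 2 s′) + tallyℕ A (up (3 + s′) c′))
    splits = trans (cong₂ _+_ splitx splitA)
      (cong₂ (λ a b → 1 + (tallyℕ x (up 2 c′) + tallyℕ x (up (suc a) s′)) + (tallyℕ A (up 2 s′) + tallyℕ A (up (suc b) c′)))
        (+-comm c′ 2) (+-comm s′ 2))

  -- Apart from `x 1` the entries fall into pairs that cannot both be true. With c and s the
  -- parameters of `Chorded`, `x w` meets `A (w + s)` for 2 ≤ w ≤ c by `noG`, and `A i` meets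
  -- `x (i + c - 1)` for 2 ≤ i ≤ s + 1 by `noH`. This makes 1 + (c - 1) + s in all.
  bound : tallyℕ x (up 1 (suc q₂)) + tallyℕ A (up 2 q₂′) ≤ 2 + c′ + suc s′
  bound = ≤-trans (eq≤ splits) (total (tallyℕ x (up 2 c′)) _ _ (tallyℕ A (up 2 s′)) c′ s′ (tally-pair c′ pairG) (tally-pair s′ pairH))

  module Tight (tight : 2 + c′ + suc s′ ≤ tallyℕ x (up 1 (suc q₂)) + tallyℕ A (up 2 q₂′)) where

    exact₁ : ∀ {z} → z ≤ c′ → A (z + (3 + s′)) ≡ false → x (z + 2) ≡ true
    exact₁ {z} h a with x (z + 2) in eq
    ... | true  = refl
    ... | false = ⊥-elim (1+n≰n (≤-trans (s≤s (≤-trans tight (eq≤ splits)))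
      (total₁ (tallyℕ x (up 2 c′)) _ _ (tallyℕ A (up 2 s′)) c′ s′ (tally-pair-strict c′ pairG h eq a) (tally-pair s′ pairH))))

    exact₂ : ∀ {z} → z ≤ s′ → A (z + 2) ≡ false → x (z + (3 + c′)) ≡ true
    exact₂ {z} h a with x (z + (3 + c′)) in eq
    ... | true  = refl
    ... | false = ⊥-elim (1+n≰n (≤-trans (s≤s (≤-trans tight (eq≤ splits)))
      (total₂ (tallyℕ x (up 2 c′)) _ _ (tallyℕ A (up 2 s′)) c′ s′ (tally-pair c′ pairG) (tally-pair-strict s′ pairH h eq a))))

-- What equality in Tallies.bound forces.
record Exact (c s : ℕ) (x A : ℕ → Bool) : Set where
  field
    chorded : Chorded c s x A
    exact₁  : ∀ {w} → 2 ≤ w → w ≤ c → A (w + s) ≡ false → x w ≡ true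
    exact₂  : ∀ {z} → z < s → A (z + 2) ≡ false → x (z + (1 + c)) ≡ true

exact : ∀ {c′ s′ x A} → Chorded (2 + c′) (suc s′) x A →
        2 + c′ + suc s′ ≤ tallyℕ x (up 1 (suc (c′ + suc s′))) + tallyℕ A (up 2 (s′ + suc c′)) → Exact (2 + c′) (suc s′) x A
exact {c′} {s′} {x} {A} C tight = record
  { chorded = C
  ; exact₁  = λ { {suc (suc z)} (s≤s (s≤s _)) (s≤s (s≤s h)) a → trans (cong x (+-comm 2 z))
      (exact₁ h (trans (cong A (trans (+-suc z (2 + s′)) (cong suc (+-suc z (suc s′))))) a)) }
  ; exact₂  = λ { (s≤s h) a → exact₂ h a } }
  where
  open Tallies C
  open Tight tight

module _ {c s x A} (E : Exact c s x A) (2s≤c : 2 * s ≤ c) where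
  open Exact E
  open Chorded chorded

  -- The vertex y w with w = c + 2 - s: otherwise y 1 is adjacent to y 2 and y (c + 2).
  opposite : ∀ {w} → 2 ≤ s → w + s ≡ c + 2 → x w ≡ true
  opposite {w} 2≤s eq with A (w + s) in A≡
  ... | false = exact₁ (linᵍ 1 (1 + w) (2s≤c ⊹ 2≤s ⊹ eq≥ eq) (solve (c ⨾ s ⨾ w ⨾ ε))) (lin 0 (2≤s ⊹ eq≤ eq) (solve (c ⨾ s ⨾ w ⨾ ε))) A≡
  ... | true  = ⊥-elim (noF′ ≤-refl 2≤s second (subst (λ z → A z ≡ true) eq A≡))

  private
    x-s : 1 ≤ s → x s ≡ true → ⊥
    x-s h a = noF h ≤-refl a last

  -- Chords of t can be moved by δ towards the start. A chord at s + rδ then descends to one at s,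
  -- which forms a forbidden cycle with the last chord.
  Shift : ℕ → Set
  Shift δ = ∀ w → 2 ≤ w → w + δ ≤ c → x (w + δ) ≡ true → x w ≡ true

  -- Either `exact₁` gives `x w`, or `A (w + s)` holds. In the latter case the chords from y 1 at 2
  -- + δ and w + s and those from t at w + δ and c + s form the cycle of `noG`.
  shift₁ : ∀ {δ} → δ < s → A (2 + δ) ≡ true → Shift δ
  shift₁ {δ} δ<s a w 2≤w h b with A (w + s) in A≡ | m≤n⇒∃[o]m+o≡n 2≤w | m≤n⇒∃[o]m+o≡n (≤-trans (m≤m+n w δ) h)
  ... | false | _        | _        = exact₁ 2≤w (≤-trans (m≤m+n w δ) h) A≡
  ... | true  | d , refl | e , refl = ⊥-elim (noG {2 + δ} {2 + d + δ} {2 + d + s} {2 + d + e + s} d e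
    (s≤s (s≤s z≤n)) (solve (d ⨾ δ ⨾ ε)) (lin 0 δ<s (solve (d ⨾ s ⨾ δ ⨾ ε))) (solve (d ⨾ e ⨾ s ⨾ ε)) ≤-refl (solve (d ⨾ e ⨾ ε)) b a A≡ last)

  -- The argument of `shift₁` with 2 in place of 2 + δ and with the chord of t at c + s - δ in place
  -- of the last one.
  shift₂ : ∀ {δ η} → δ + suc η ≡ s → x (η + suc c) ≡ true → Shift δ
  shift₂ {δ} {η} refl a w 2≤w h b with A (w + s) in A≡ | m≤n⇒∃[o]m+o≡n 2≤w | m≤n⇒∃[o]m+o≡n h
  ... | false | _        | _        = exact₁ 2≤w (≤-trans (m≤m+n w δ) h) A≡
  ... | true  | d , refl | e , refl = ⊥-elim (noG {2} {2 + d + δ} {2 + d + s} {η + suc c} (d + δ) e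
    ≤-refl (solve (d ⨾ δ ⨾ ε)) (lin η (z≤n {0}) (solve (d ⨾ δ ⨾ η ⨾ ε))) (solve (d ⨾ e ⨾ δ ⨾ η ⨾ ε)) (lin δ (z≤n {0}) (solve (d ⨾ e ⨾ δ ⨾ η ⨾ ε))) (solve (d ⨾ e ⨾ δ ⨾ ε)) b second A≡ a)

  shifts : ∀ {δ} → Shift δ → ∀ r → 2 ≤ s → s + r * δ ≤ c → x (s + r * δ) ≡ true → ⊥
  shifts S zero    2≤s h a = x-s (≤-trans (s≤s z≤n) 2≤s) (trans (cong x (sym (+-identityʳ s))) a)
  shifts {δ} S (suc r) 2≤s h a = shifts S r 2≤s (lin δ h (solve (c ⨾ r ⨾ s ⨾ δ ⨾ ε))) (S (s + r * δ) (lin (r * δ) 2≤s (solve (r ⨾ s ⨾ δ ⨾ ε))) (≤-trans (eq≤ eq) h) (trans (cong x eq) a))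
    where
    eq : s + r * δ + δ ≡ s + (δ + r * δ)
    eq = solve (r ⨾ s ⨾ δ ⨾ ε)

  -- For each distance below s, `exact₂` leaves a choice between that shift and its complement to s
  -- - 1. The midpoint δ is its own complement, so both choices yield the same shift, and it carries
  -- 2s - 1 to s in two moves.
  noExact-odd : ∀ δ → 1 ≤ δ → s ≡ suc (2 * δ) → x (s + 2 * δ) ≡ true → ⊥
  noExact-odd δ 1≤δ s≡ a = shifts S 2 (linᵍ 2 (2 + s) (4 ⊠ 1≤δ ⊹ 2 ⊠ eq≥ s≡) (solve (s ⨾ δ ⨾ ε))) (lin 1 (2s≤c ⊹ eq≥ s≡) (solve (c ⨾ s ⨾ δ ⨾ ε))) a
    where
    S : Shift δ
    S with A (2 + δ) in A≡
    ... | true  = shift₁ {δ} (linᵍ 2 (2 + s) (1≤δ ⊹ 2 ⊠ eq≥ s≡) (solve (s ⨾ δ ⨾ ε))) A≡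
    ... | false = shift₂ {δ} {δ} (lin≡ (sym s≡) (solve (s ⨾ δ ⨾ ε))) (exact₂ {δ} (linᵍ 2 (2 + s) (1≤δ ⊹ 2 ⊠ eq≥ s≡) (solve (s ⨾ δ ⨾ ε))) (trans (cong A (+-comm δ 2)) A≡))

  -- There is no midpoint, so small shifts are tried. If y 1 ~ y 3, the shift by 1 descends from 2s
  -- - 1 to s. Otherwise the shift by s - 2 carries 2s - 1 to s + 1 and on to 3. Then y 1 ~ y 4
  -- would give the shift by 2, which descends to s from the `opposite` chord, as c is even; and
  -- without that edge there are chords of t at 3 and c + 3.
  noExact-even : ∀ e r {w δ} → 2 ≤ e → s ≡ 2 * e → c + 2 ≡ s + (s + r * 2) → suc w ≡ s → 2 + δ ≡ s → x (s + w) ≡ true → ⊥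
  noExact-even e r {w} {δ} 2≤e s≡ c≡ w≡ sd a = case₁ (A 3) refl
    where
    3<s : 3 < s
    3<s = lin 0 (2 ⊠ 2≤e ⊹ eq≥ s≡) (solve (e ⨾ s ⨾ ε))
    fits₁ : s + w * 1 ≤ c
    fits₁ = lin 1 (2s≤c ⊹ eq≤ w≡) (solve (c ⨾ s ⨾ w ⨾ ε))
    fits₂ : s + r * 2 ≤ c
    fits₂ = linᵍ 1 (1 + s) (2 ⊠ 2≤e ⊹ eq≥ s≡ ⊹ 2 ⊠ eq≥ c≡) (solve (c ⨾ e ⨾ r ⨾ s ⨾ ε))
    opp : (s + r * 2) + s ≡ c + 2
    opp = lin≡ (sym c≡) (solve (c ⨾ r ⨾ s ⨾ ε))
    bound₁ : 3 + δ ≤ c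
    bound₁ = linᵍ 3 (3 + c + 2 * δ) (6 ⊠ eq≤ sd ⊹ 3 ⊠ 2s≤c) (solve (c ⨾ s ⨾ δ ⨾ ε))
    eq₁ : 3 + δ ≡ suc s
    eq₁ = lin≡ sd (solve (s ⨾ δ ⨾ ε))
    bound₂ : suc s + δ ≤ c
    bound₂ = linᵍ 1 (1 + 2 * r) (2 ⊠ eq≤ sd ⊹ 2s≤c ⊹ eq≥ c≡) (solve (c ⨾ r ⨾ s ⨾ δ ⨾ ε))
    eq₂ : suc s + δ ≡ s + w
    eq₂ = lin≡ (sd ⊹≡ sym w≡) (solve (s ⨾ w ⨾ δ ⨾ ε))
    2≤s : 2 ≤ s
    2≤s = ≤-trans (s≤s (s≤s z≤n)) 3<s
    noShift : Shift 1 → ⊥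
    noShift S = shifts S w 2≤s fits₁ (trans (cong (λ z → x (s + z)) (*-identityʳ w)) a)
    case₁ : ∀ b → A 3 ≡ b → ⊥
    case₁ true  A3 = noShift (shift₁ {1} 2≤s A3)
    case₁ false A3 = case₂ (A 4) refl
      where
      S : Shift δ
      S = shift₂ {δ} {1} (trans (+-comm δ 2) sd) (exact₂ {1} 2≤s A3)
      x-3 : x 3 ≡ true
      x-3 = S 3 (s≤s (s≤s z≤n)) bound₁ (trans (cong x eq₁) (S (suc s) (s≤s (≤-trans (s≤s z≤n) 2≤s)) bound₂ (trans (cong x eq₂) a)))
      case₂ : ∀ b → A 4 ≡ b → ⊥
      case₂ true  A4 = shifts (shift₁ {2} (≤-trans (s≤s (s≤s (s≤s z≤n))) 3<s) A4) r 2≤s fits₂ (opposite 2≤s opp)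
      case₂ false A4 = noF {3} (s≤s z≤n) (≤-trans (n≤1+n 3) 3<s) x-3
        (trans (cong x (+-comm c 3)) (exact₂ {2} (≤-trans (n≤1+n 3) 3<s) A4))

-- Paths hanging off a longest path

tally-none : ∀ {f} d {a} → (∀ {j} → a ≤ j → j ≤ d + a → f j ≡ false) → tallyℕ f (up a d) ≡ 0
tally-none zero    h rewrite h ≤-refl ≤-refl = refl
tally-none {f} (suc d) {a} h rewrite h ≤-refl (m≤n+m a (suc d)) =
  tally-none {f} d λ l u → h (≤-trans (n≤1+n a) l) (≤-trans u (eq≤ (+-suc d a)))

private
  pair-sum : ∀ a b {c r} → a + b ≤ 1 → c ≤ r → a + (b + c) ≤ suc r
  pair-sum a b {c} {r} h₁ h₂ = lin 0 (h₁ ⊹ h₂) (solve (a ⨾ b ⨾ c ⨾ r ⨾ ε))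
  shifted : ∀ r a → suc ((2 + r * 2) + a) ≡ suc (r * 2 + (2 + a))
  shifted r a = lin≡ (refl {x = 0}) (solve (a ⨾ r ⨾ ε))

module _ {q : ℕ} {f : ℕ → Bool} (sparse : ∀ {j} → 1 ≤ j → j < q → f j ≡ true → f (suc j) ≡ true → ⊥) where

  tally-sparse : ∀ r {a} → 1 ≤ a → suc (r * 2) + a ≤ q → tallyℕ f (up a (suc (r * 2))) ≤ suc r
  tally-sparse zero    {a} 1≤a h = pair-sum (b2n (f a)) (b2n (f (suc a))) (b2n-pair (sparse 1≤a h)) z≤n
  tally-sparse (suc r) {a} 1≤a h = pair-sum (b2n (f a)) (b2n (f (suc a))) (b2n-pair (sparse 1≤a (≤-trans (s≤s (m≤n+m a _)) h)))
    (tally-sparse r (s≤s z≤n) (≤-trans (eq≥ (shifted r a)) h))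

  -- If every pair j, j + 1 with j - a even contained a point, then these points would propagate from a to the last pair.
  tally-sparse₃ : (∀ {j} → 1 ≤ j → 3 + j ≤ q → f j ≡ true → f (3 + j) ≡ true → ⊥) →
                  ∀ r {a} → 1 ≤ a → suc (r * 2) + a ≤ q → f (suc a) ≡ false → f (r * 2 + a) ≡ false →
                  tallyℕ f (up a (suc (r * 2))) ≤ r
  tally-sparse₃ sparse₃ zero    {a} 1≤a h p p′ rewrite p | p′ = z≤n
  tally-sparse₃ sparse₃ (suc r) {a} 1≤a h p p′ with f a in eq
  ... | true  rewrite p = s≤s (tally-sparse₃ sparse₃ r (s≤s z≤n) h′ (≢true (sparse₃ 1≤a (≤-trans (s≤s (s≤s (s≤s (m≤n+m a (r * 2))))) h) eq))
                             (trans (cong f (≤-antisym (eq≤ (suc-injective (sym (shifted r a)))) (eq≤ (suc-injective (shifted r a))))) p′))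
    where
    h′ : suc (r * 2) + (2 + a) ≤ q
    h′ = ≤-trans (eq≥ (shifted r a)) h
  ... | false rewrite p = tally-sparse r (s≤s z≤n) (≤-trans (eq≥ (shifted r a)) h)

tally-split₃ : ∀ f a {d} d₁ d₂ d₃ → d ≡ d₁ + suc (d₂ + suc d₃) →
  tallyℕ f (up a d) ≡ tallyℕ f (up a d₁) + (tallyℕ f (up (suc d₁ + a) d₂) + tallyℕ f (up (suc d₂ + (suc d₁ + a)) d₃))
tally-split₃ f a d₁ d₂ d₃ refl = trans (tally-++ f a d₁ (d₂ + suc d₃)) (cong (tallyℕ f (up a d₁) +_) (tally-++ f (suc d₁ + a) d₂ d₃))

-- Where a path on m vertices cannot be attached: at a position up to m it replaces an initial piece
-- by at least one vertex more, and at positions 3 to m + 2 a suitable part of it closes a cycle on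
-- q vertices through t. For m = 1 position 2 escapes both.
Near : ℕ → ℕ → Set
Near m j = 1 ≤ j × j ≤ m ⊎ 3 ≤ j × j ≤ m + 2

private
  small : ∀ {k m x y z} r → m + 3 + r ≡ k → x ≡ 0 → y ≤ suc r → z ≡ 0 → k ≤ x + (y + z) + m → ⊥
  small {k} {m} {x} {y} {z} r h₁ h₂ h₃ h₄ h₅ = lin⊥ 1 (eq≤ h₁ ⊹ eq≤ h₂ ⊹ h₃ ⊹ eq≤ h₄ ⊹ h₅) (solve (k ⨾ m ⨾ r ⨾ x ⨾ y ⨾ z ⨾ ε))
  small₁ : ∀ {a b c} r → a ≡ 0 → b ≤ 2 + r → c ≡ 0 → 4 + r ≤ a + (b + c) + 1 → ⊥
  small₁ {a} {b} {c} r h₂ h₃ h₄ h₅ = lin⊥ 0 (eq≤ h₂ ⊹ h₃ ⊹ eq≤ h₄ ⊹ h₅) (solve (a ⨾ b ⨾ c ⨾ r ⨾ ε))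
  range : ∀ m r {d} → 2 * (m + 3 + r) ≡ suc d → d ≡ (m + 1) + suc (suc (r * 2) + suc (m + 1))
  range m r {d} h = lin≡ (sym h) (solve (d ⨾ m ⨾ r ⨾ ε))
  range₁ : ∀ r {d} → 2 * (4 + r) ≡ suc d → d ≡ 0 + suc (suc ((2 + r) * 2) + suc 0)
  range₁ r {d} h = lin≡ (sym h) (solve (d ⨾ r ⨾ ε))
  middle : ∀ m r → suc (r * 2) + (suc (m + 1) + 1) ≤ 2 * (m + 3 + r)
  middle m r = lin (2 + m) (z≤n {0}) (solve (m ⨾ r ⨾ ε))
  middle₁ : ∀ r → suc ((2 + r) * 2) + 2 ≤ 2 * (4 + r)
  middle₁ r = lin 1 (z≤n {0}) (solve (r ⨾ ε))
  mirror₁ : ∀ r → 3 + ((2 + r) * 2 + 2) ≡ suc (2 * (4 + r))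
  mirror₁ r = lin≡ (refl {x = 0}) (solve (r ⨾ ε))
  mirror₂ : ∀ r {j} → j ≡ suc (suc ((2 + r) * 2)) + 2 → 1 + j ≡ suc (2 * (4 + r))
  mirror₂ r {j} h = lin≡ h (solve (j ⨾ r ⨾ ε))
  mirror : ∀ m r {j} i → suc (suc (r * 2)) + (suc (m + 1) + 1) ≤ j → j + i ≡ (m + 1) + (suc (suc (r * 2)) + (suc (m + 1) + 1)) →
           suc i + j ≡ suc (2 * (m + 3 + r)) × suc i ≤ m + 2
  mirror m r {j} i l eq = lin≡ eq (solve (i ⨾ j ⨾ m ⨾ r ⨾ ε)) , (lin 0 (l ⊹ eq≤ eq) (solve (i ⨾ j ⨾ m ⨾ r ⨾ ε)))

-- Here f j says that y j is adjacent to the end of a path on m vertices off the lasso y 1, …, y (2k).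
hanging : ∀ {k m d} {f : ℕ → Bool} → 1 ≤ m → m + 3 ≤ k → 2 * k ≡ suc d →
          (∀ {j} → 1 ≤ j → j < 2 * k → f j ≡ true → f (suc j) ≡ true → ⊥) →
          (m ≡ 1 → ∀ {j} → 1 ≤ j → 3 + j ≤ 2 * k → f j ≡ true → f (3 + j) ≡ true → ⊥) →
          (∀ {j} → Near m j → f j ≡ false) →
          (∀ {i j} → Near m i → i + j ≡ suc (2 * k) → f j ≡ false) →
          k ≤ tallyℕ f (up 1 d) + m → ⊥
hanging {m = m} {d} {f} 1≤m h d≡ sparse sparse₃ front back enough with m≤n⇒∃[o]m+o≡n h | m ≟ℕ 1
-- For m = 1 only the end positions are cut off. The sparse middle alone would allow one neighbour
-- too many; the excluded distance 3 removes it.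
... | r , refl | yes refl = small₁ r
  (tally-none 0 λ { {j} l u → front (inj₁ (l , u)) })
  (tally-sparse₃ sparse (sparse₃ refl) (2 + r) (s≤s z≤n) (middle₁ r) (front (inj₂ (≤-refl , ≤-refl))) (back (inj₂ (≤-refl , ≤-refl)) (mirror₁ r)))
  (tally-none 0 λ { {j} l u → back (inj₁ (≤-refl , ≤-refl)) (mirror₂ r (≤-antisym u l)) })
  (subst (λ z → 4 + r ≤ z + 1) (tally-split₃ f 1 0 (suc ((2 + r) * 2)) 0 (range₁ r d≡)) enough)
-- For m ≥ 2 the two ranges of `Near` overlap or meet, so m + 2 positions are lost at either end,
-- and at most half of the others are neighbours.
... | r , refl | no m≢1 = small r refl
  (tally-none (m + 1) λ l u → front (near l (≤-trans u (eq≤ (+-assoc m 1 1)))))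
  (tally-sparse sparse r (≤-trans (m≤n+m 1 (m + 1)) (n≤1+n _)) (middle m r))
  (tally-none (m + 1) λ l u → let i , eq = m≤n⇒∃[o]m+o≡n u
                                  eq′ , h′ = mirror m r i l eq in back (near (s≤s z≤n) h′) eq′)
  (subst (λ z → m + 3 + r ≤ z + m) (tally-split₃ f 1 (m + 1) (suc (r * 2)) (m + 1) (range m r d≡)) enough)
  where
  near : ∀ {j} → 1 ≤ j → j ≤ m + 2 → Near m j
  near {j} l u with j ≤? m
  ... | yes j≤m = inj₁ (l , j≤m)
  ... | no  j≰m = inj₂ (≤-trans (s≤s (≤∧≢⇒< 1≤m (m≢1 ∘ sym))) (≰⇒> j≰m) , u)

takePath : ∀ {A : Set} {R : A → A → Set} {a b xs} → Path R a xs b → ∀ {i} → 1 ≤ i → ∃ λ c → Path R a (take i xs) c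
takePath (stop a) {suc zero}    _ = _ , stop a
takePath (stop a) {suc (suc i)} _ = _ , stop a
takePath (e ∷ p) {suc zero}    _ = _ , stop _
takePath (e ∷ p) {suc (suc i)} _ = let c , p′ = takePath p (s≤s z≤n) in c , e ∷ p′

private
  len-G : ∀ d e {c} → d + e + 2 ≡ c → suc e + suc (suc d + 1) ≡ c + 2
  len-G d e {c} h = lin≡ h (solve (c ⨾ d ⨾ e ⨾ ε))
  len-H : ∀ d {c} → d + 1 ≡ c → 2 + suc d ≡ c + 2
  len-H d {c} h = lin≡ h (solve (c ⨾ d ⨾ ε))
  len-F : ∀ c → suc (suc c) ≡ c + 2
  len-F c = lin≡ (refl {x = 0}) (solve (c ⨾ ε))
  len-a : ∀ m j d {q} → j ≤ m → d + j ≡ q → q < m + suc d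
  len-a m j d {q} h eq = lin 0 (h ⊹ eq≥ eq) (solve (d ⨾ j ⨾ m ⨾ q ⨾ ε))
  len-b : ∀ i d {q} → d + (2 + i) ≡ q → suc (i + suc d) ≡ q
  len-b i d {q} h = lin≡ h (solve (d ⨾ i ⨾ q ⨾ ε))
  len-c : ∀ i d {q} → d + (2 + i) ≡ q → q < suc (suc i + suc d)
  len-c i d {q} h = lin 0 (eq≥ h) (solve (d ⨾ i ⨾ q ⨾ ε))
  len-d : ∀ i d {q} → d + (4 + i) ≡ q → suc (suc (suc i + suc d)) ≡ q
  len-d i d {q} h = lin≡ h (solve (d ⨾ i ⨾ q ⨾ ε))
  degreeBound : ∀ {k a b c m} → k ≤ a + b + c → a ≤ 1 → suc c ≤ m → k ≤ b + m
  degreeBound {k} {a} {b} {c} {m} h₁ h₂ h₃ = lin 0 (h₁ ⊹ h₂ ⊹ h₃) (solve (a ⨾ b ⨾ c ⨾ k ⨾ m ⨾ ε))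

module Ends {n : ℕ} (E : Fin n → Fin n → Bool) (E-sym : ∀ x y → E x y ≡ E y x) (E-irr : ∀ x → E x x ≡ false)
  (X : Subset n) (t : Fin n) where

  open Lasso E E-sym E-irr X t public

  module _ {c s} (noCycle : ¬ Cycles _~_ InX (c + 2)) (L : Lasso (c + s)) (1≤s : 1 ≤ s) (2≤c : 2 ≤ c)
    (t~first : t ~ Lasso.y L 1) (t~last : t ~ Lasso.y L (c + s)) where
    open Routes L
    private
      q = c + s
      x A : ℕ → Bool
      x i = E t (y i)
      A i = E (y 1) (y i)
      from-t : ∀ {i} → x i ≡ true → y 0 ~ y i
      from-t = subst (_~ y _) (sym y0)
      to-t : ∀ {i} → x i ≡ true → y i ~ y 0
      to-t h = ~-sym (from-t h)
      0<1 : 0 < 1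
      0<1 = s≤s z≤n
      none : ∀ {a b is} → Route a is b → y b ~ y a → Block 0 q is → length is ≡ c + 2 → ⊥
      none {is = is} r e bl eq = noCycle (subst (Cycles _~_ InX) eq (cycle r e bl))

    chorded : Chorded c s x A
    chorded = record
      { first  = t~first
      ; last   = t~last
      ; second = adj ≤-refl (≤-trans 2≤c (m≤m+n c s))
      ; noG    = λ {i} {j} {l} {m} d e 2≤i i≤j j<l l≤m m≤q eq xj Ai Al xm →
          let 1≤i = ≤-trans (n≤1+n 1) 2≤i
              l≥ = ≤-trans (m≤n+m l e) (eq≤ l≤m)
              j≤m = ≤-trans (n≤1+n j) (≤-trans j<l l≥)
              j≥i = ≤-trans (m≤n+m i d) (eq≤ i≤j)
          in none
            (join (upRoute e l≤m (≤-trans (s≤s z≤n) j<l) m≤q) (to-t xm)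
              (from-t xj ∷ join (downRoute d i≤j 1≤i (≤-trans j≤m m≤q)) (~-sym Ai) (stop 1)))
            Al
            (widen ≤-refl m≤q (block-> j<l (up-block e l≤m)
              (block-< 0<1 (single 0) (block-> 2≤i (down-block d i≤j) (single 1) 1≤i (≤-trans 1≤i j≥i)) z≤n z≤n) z≤n j≤m))
            (trans (length-++ (up l e)) (trans (cong₂ (λ a b → a + suc b) (up-length l e)
              (trans (length-++ (down i d)) (cong (_+ 1) (down-length i d)))) (len-G d e eq)))
      ; noH    = λ {i} {j} d 2≤i i≤j j≤q eq Ai xj → none
            (from-t t~first ∷ Ai ∷ upRoute d i≤j (≤-trans (n≤1+n 1) 2≤i) j≤q) (to-t xj)
            (widen ≤-refl j≤q (block-< 0<1 (single 0) (block-< 2≤i (single 1) (up-block d i≤j) (≤-trans (n≤1+n 1) 2≤i)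
               (≤-trans (≤-trans (n≤1+n 1) 2≤i) (≤-trans (m≤n+m i d) (eq≤ i≤j)))) z≤n z≤n))
            (trans (cong (2 +_) (up-length i d)) (len-H d eq))
      ; noF    = λ {i} 1≤i i≤s xi xj → none
            (from-t xi ∷ upRoute c refl 1≤i (+-monoʳ-≤ c i≤s)) (to-t xj)
            (widen ≤-refl (+-monoʳ-≤ c i≤s) (block-< 0<1 (single 0) (widen 1≤i ≤-refl (up-block c refl)) z≤n z≤n))
            (trans (cong suc (up-length i c)) (len-F c))
      ; noF′   = λ {i} 2≤i i≤s Ai Aj → none
            (Ai ∷ upRoute c refl (≤-trans (n≤1+n 1) 2≤i) (+-monoʳ-≤ c i≤s)) (~-sym Aj)
            (widen z≤n (+-monoʳ-≤ c i≤s) (block-< 2≤i (single 1) (up-block c refl) (≤-trans (n≤1+n 1) 2≤i)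
              (≤-trans (≤-trans (n≤1+n 1) 2≤i) (m≤n+m i c))))
            (trans (cong suc (up-length i c)) (len-F c))
      }

  Off : ∀ {q} → Lasso q → Fin n → Set
  Off {q} L z = InX z × (∀ {i} → i ≤ q → ¬ z ≡ Lasso.y L i)

  off : ∀ {q} (L : Lasso q) {z} → Off L z → elem (Routes.vertices L) z ≡ false
  off {q} L {z} (Xz , z≢) = ≢true λ h → go (up 0 q) (up-bounds q (+-identityʳ q)) (elem-∈ (Routes.vertices L) h)
    where
    go : ∀ is → All (λ i → 0 ≤ i × i ≤ q) is → z ∈ map (Lasso.y L) is → ⊥
    go (i ∷ is) ((_ , h) All.∷ _)  (here eq) = z≢ h eq
    go (i ∷ is) (_ All.∷ hs)       (there p) = go is hs p

  off⁻ : ∀ {q} (L : Lasso q) {z} → (X ∖ elem (Routes.vertices L)) z ≡ true → Off L z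
  off⁻ L {z} h = ∧-left h , λ i≤q eq → false-true (not-true (∧-right {X z} h)) (∈-elem (subst (_∈ Routes.vertices L) (sym eq) (Routes.∈-vertices L i≤q)))

  off-reversed : ∀ {q} (L : Lasso q) {z} → Off L z → Off (reversed L) z
  off-reversed L (Xz , z≢) = Xz , λ { {zero} _ eq → z≢ z≤n (trans eq (sym (Lasso.y0 L))) ; {suc i} h eq → z≢ (m∸n≤m _ i) eq }

  off-reversed⁻ : ∀ {q} (L : Lasso q) {z} → Off (reversed L) z → Off L z
  off-reversed⁻ {q} L (Xz , z≢) = Xz , λ
    { {zero}  _ eq → z≢ z≤n (trans eq (Lasso.y0 L))
    ; {suc i} h eq → z≢ (m∸n≤m q i) (trans eq (sym (reversed-at L {q ∸ i} (m<n⇒0<n∸m h)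
        (trans (+-suc (q ∸ i) i) (cong suc (m∸n+n≡m (≤-trans (n≤1+n i) h))))))) }

  -- A chord from the first vertex w of a path off the lasso to y 1, …, y q yields a longer lasso or a cycle on q vertices.
  module Hang {q} (longest : ∀ {q′} → q < q′ → Lasso q′ → ⊥) (noCycle : ¬ Cycles _~_ InX q) (L : Lasso q)
    (t~last : t ~ Lasso.y L q) (off~t : ∀ {z} → Off L z → t ~ z)
    {w w′ ws} (path : Path _~_ w ws w′) (unique : Unique ws) (offs : All (Off L) ws) where
    open Routes L

    private
      mixed : ∀ {us is zs} → Unique us → All (Off L) us → Block 1 q is → zs ↭ us ++ map y is →
              Unique (t ∷ zs) × All InX (t ∷ zs) × length zs ≡ length us + length is
      mixed {us} {is} u o bl@(_ , b) σ =
        All-resp-↭ (↭-sym σ) (All.++⁺ (All.map (λ (_ , z≢) eq → z≢ z≤n (trans (sym eq) (sym y0))) o)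
          (All.map⁺ (All.map (λ (l , h) eq → 1+n≰n (≤-trans l (eq≥ (inj z≤n h (trans y0 eq))))) b)))
        ∷ Unique-↭ (↭-sym σ) (AllPairs.++⁺ u (map-unique (widen z≤n ≤-refl bl))
            (All.map (λ (_ , z≢) → All.map⁺ (All.map (λ (_ , h) → z≢ h) b)) o)) ,
        subst InX y0 (inX z≤n) All.∷ All-resp-↭ (↭-sym σ) (All.++⁺ (All.map proj₁ o) (map-inX bl)) ,
        trans (↭-length σ) (trans (length-++ us) (cong (length us +_) (length-map y is)))

      longer : ∀ {us is zs a b} → Path _~_ a zs b → Unique us → All (Off L) us → Block 1 q is → zs ↭ us ++ map y is →
               q < length us + length is → ⊥
      longer π u o bl σ h = let u′ , all , len = mixed u o bl σ in longest (subst (q <_) (sym len) h) (fromPath π u′ all)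

      round : ∀ {us is zs a b} → Path _~_ a zs b → t ~ a → t ~ b → Unique us → All (Off L) us → Block 1 q is → zs ↭ us ++ map y is →
              suc (length us + length is) ≡ q → ⊥
      round π e e′ u o bl σ h = let u′ , all , len = mixed u o bl σ in
        noCycle (t ∷ _ , (_ , _ , e ∷ π , ~-sym e′) , u′ , all , trans (cong suc len) h)

      off-w : Off L w
      off-w = head-All path offs

    notNear : ∀ {j} → j ≤ q → Near (length ws) j → w ~ y j → ⊥
    notNear {j} j≤q (inj₁ (1≤j , j≤m)) e with d , d≡ ← m≤n⇒∃[o]m+o≡n j≤q = longer
      (join (reversePath ~-sym path) e (mapPath {Q = _~_} y id (upRoute d d≡′ 1≤j ≤-refl)))
      unique offs (widen 1≤j ≤-refl (up-block d d≡′)) (++⁺ʳ (map y (up j d)) (↭-reverse ws))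
      (subst (λ z → q < length ws + z) (sym (up-length j d)) (len-a (length ws) j d j≤m d≡′))
      where
      d≡′ = trans (+-comm d j) d≡
    notNear {suc (suc i)} j≤q (inj₂ (s≤s (s≤s 1≤i) , j≤m)) e with d , d≡ ← m≤n⇒∃[o]m+o≡n j≤q | v , π ← takePath path 1≤i = round
      (join (reversePath ~-sym π) e (mapPath {Q = _~_} y id (upRoute d d≡′ (s≤s z≤n) ≤-refl)))
      (off~t (last-All π (All.take⁺ i offs))) t~last
      (AllPairs.take⁺ i unique) (All.take⁺ i offs) (widen (s≤s z≤n) ≤-refl (up-block d d≡′))
      (++⁺ʳ (map y (up (suc (suc i)) d)) (↭-reverse (take i ws)))
      (trans (cong₂ (λ a b → suc (a + b)) (trans (length-take i ws) (m≤n⇒m⊓n≡m (+-cancelʳ-≤ 2 i (length ws) (≤-trans (eq≤ (+-comm i 2)) j≤m))))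
        (up-length (suc (suc i)) d)) (len-b i d d≡′))
      where
      d≡′ = trans (+-comm d (suc (suc i))) d≡

    private
      -- y 1, …, y (i + 1), w, y l, …, y q
      detour : ∀ i l d → suc i < l → d + l ≡ q → w ~ y (suc i) → w ~ y l →
               Path _~_ (y 1) (map y (up 1 i) ++ w ∷ map y (up l d)) (y q) ×
               Block 1 q (up 1 i ++ up l d) × map y (up 1 i) ++ w ∷ map y (up l d) ↭ (w ∷ []) ++ map y (up 1 i ++ up l d) ×
               length (up 1 i ++ up l d) ≡ suc i + suc d
      detour i l d i<l d≡ e e′ =
        join (mapPath {Q = _~_} y id (upRoute i (+-comm i 1) ≤-refl (≤-trans (n≤1+n _) (≤-trans i<l l≤q)))) (~-sym e)
          (e′ ∷ mapPath {Q = _~_} y id (upRoute d d≡ (≤-trans (s≤s z≤n) i<l) ≤-refl)) ,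
        block-< i<l (up-block i (+-comm i 1)) (up-block d d≡) (≤-trans (s≤s z≤n) i<l) (≤-trans (n≤1+n _) (≤-trans i<l l≤q)) ,
        ↭-trans (shift w (map y (up 1 i)) (map y (up l d))) (↭-reflexive (cong (w ∷_) (sym (map-++ y (up 1 i) (up l d))))) ,
        trans (length-++ (up 1 i)) (cong₂ _+_ (up-length 1 i) (up-length l d))
        where
        l≤q : l ≤ q
        l≤q = ≤-trans (m≤n+m l d) (eq≤ d≡)

    -- `w` could be inserted between the two vertices, giving a longer path.
    notConsecutive : ∀ {j} → 1 ≤ j → j < q → w ~ y j → w ~ y (suc j) → ⊥
    notConsecutive {suc i} _ j<q e e′ with d , d≡ ← m≤n⇒∃[o]m+o≡n j<q =
      let π , bl , σ , len = detour i (2 + i) d ≤-refl (trans (+-comm d _) d≡) e e′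
      in longer π (All.[] ∷ []) (off-w All.∷ All.[]) bl σ (subst (λ z → q < suc z) (sym len) (len-c i d (trans (+-comm d _) d≡)))

    -- `w` replaces the two vertices in between; as both ends are adjacent to `t`, a cycle on (q -
    -- 2) + 1 + 1 = q vertices results.
    notThird : t ~ y 1 → ∀ {j} → 1 ≤ j → 3 + j ≤ q → w ~ y j → w ~ y (3 + j) → ⊥
    notThird t~first {suc i} _ j<q e e′ with d , d≡ ← m≤n⇒∃[o]m+o≡n j<q =
      let π , bl , σ , len = detour i (4 + i) d (s≤s (s≤s (m≤n+m i 2))) (trans (+-comm d _) d≡) e e′
      in round π t~first t~last (All.[] ∷ []) (off-w All.∷ All.[]) bl σ (trans (cong (2 +_) len) (len-d i d (trans (+-comm d _) d≡)))

  module Maximal (S : Subset n) where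

    Stuck : Fin n → List (Fin n) → Set
    Stuck w ws = ∀ {z} → S z ≡ true → w ~ z → z ∈ ws

    maximalPath : ∀ fuel {w w′ ws} → Path _~_ w ws w′ → Unique ws → All (λ z → S z ≡ true) ws → count S ≤ fuel + length ws →
                  ∃ λ w → ∃ λ ws → Path _~_ w ws w′ × Unique ws × All (λ z → S z ≡ true) ws × Stuck w ws
    maximalPath fuel {w} {w′} {ws} π u a h
      with Fin.any? (λ z → (S z Bool.≟ true) ×-dec (E w z Bool.≟ true) ×-dec (elem ws z Bool.≟ false))
    ... | no ¬p = w , ws , π , u , a , stuck
      where
      stuck : Stuck w ws
      stuck {z} Sz e with elem ws z in eq
      ... | true  = elem-∈ ws eq
      ... | false = ⊥-elim (¬p (z , Sz , e , eq))
    ... | yes (z , Sz , e , z∉) = continue fuel h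
      where
      u′ : Unique (z ∷ ws)
      u′ = All.tabulate (λ {y} p z≡y → false-true z∉ (∈-elem (subst (_∈ ws) (sym z≡y) p))) ∷ u
      continue : ∀ fuel → count S ≤ fuel + length ws →
                 ∃ λ w → ∃ λ ws → Path _~_ w ws w′ × Unique ws × All (λ z → S z ≡ true) ws × Stuck w ws
      continue zero       h = ⊥-elim (1+n≰n (≤-trans (length≤count u′ (Sz All.∷ a)) h))
      continue (suc fuel) h = maximalPath fuel (~-sym e ∷ π) u′ (Sz All.∷ a) (≤-trans h (eq≥ (+-suc fuel (length ws))))

  tally-append : ∀ (S : Subset n) xs ys → tally S (xs ++ ys) ≡ tally S xs + tally S ys
  tally-append S []       ys = refl
  tally-append S (x ∷ xs) ys = trans (cong (b2n (S x) +_) (tally-append S xs ys)) (sym (+-assoc (b2n (S x)) _ _))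

  -- A path in the rest of `X` is extended until its first vertex w has no further neighbours there.
  -- All neighbours of w in `X` are then `t`, vertices of the lasso or vertices of this path, and
  -- `hanging` shows that they are fewer than k; the conditions at the far end come from the
  -- reversed lasso.
  noHanging : ∀ {d k} → 2 * k ≡ suc d → (∀ {q′} → suc d < q′ → Lasso q′ → ⊥) → ¬ Cycles _~_ InX (suc d) →
              (∀ {x} → InX x → k ≤ count (X ∩ E x)) →
              (L : Lasso (suc d)) → t ~ Lasso.y L 1 → t ~ Lasso.y L (suc d) → (∀ {z} → Off L z → t ~ z) →
              count (X ∖ elem (Routes.vertices L)) + 3 ≤ k → ∀ {z} → (X ∖ elem (Routes.vertices L)) z ≡ true → ⊥
  noHanging {d} {k} q≡ longest noCycle k≤ L e₁ e₂ off~t few {z} Rz =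
    let w , ws , π , u , a , stuck = maximalPath (count R) (stop z) (All.[] ∷ []) (Rz All.∷ All.[]) (m≤m+n (count R) 1)
    in attached π u a stuck
    where
    open Routes L
    R : Subset n
    R = X ∖ elem vertices
    open Maximal R
    attached : ∀ {w ws} → Path _~_ w ws z → Unique ws → All (λ z → R z ≡ true) ws → Stuck w ws → ⊥
    attached {w} {ws} π u a stuck = hanging {m = length ws} {d = d} {f = f} (nonempty π)
      (≤-trans (+-monoˡ-≤ 3 (length≤count u a)) few) q≡
      (λ 1≤j h → F.notConsecutive 1≤j (≤-trans h (eq≤ q≡)))
      (λ _ 1≤j h → F.notThird e₁ 1≤j (≤-trans h (eq≤ q≡)))
      (λ h → ≢true (F.notNear (near≤ h) h))
      (λ {i} {j} h eq → ≢true λ e → B.notNear (near≤ h) h (subst (w ~_) (sym (reversed-at L (1≤near h) (trans eq (cong suc q≡)))) e))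
      (degreeBound {a = b2n (f 0)} {c = tally (E w) ws} (begin
        k                                          ≤⟨ k≤ (∧-left (head-All π a)) ⟩
        count (X ∩ E w)                            ≤⟨ count≤tally (vertices ++ ws) (λ h → cover (∧-left h) (∧-right {X _} h)) ⟩
        tally (X ∩ E w) (vertices ++ ws)           ≤⟨ tally-mono (vertices ++ ws) (λ z → ∧-right {X z}) ⟩
        tally (E w) (vertices ++ ws)               ≡⟨ tally-append (E w) vertices ws ⟩
        tally (E w) vertices + tally (E w) ws      ≡⟨ cong (_+ tally (E w) ws) (tally-map (E w) y (up 0 (suc d))) ⟩
        tallyℕ f (up 0 (suc d)) + tally (E w) ws   ∎)
        (b2n≤1 (f 0)) (own π))
      where
      open ≤-Reasoning
      f : ℕ → Bool
      f i = E w (y i)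
      module F = Hang longest noCycle L e₂ off~t π u (All.map (off⁻ L) a)
      module B = Hang longest noCycle (reversed L)
        (subst (t ~_) (sym (reversed-at L {suc d} {1} (s≤s z≤n) (+-comm (suc d) 1))) e₁) (off~t ∘ off-reversed⁻ L)
        π u (All.map (off-reversed L ∘ off⁻ L) a)
      nonempty : ∀ {a zs b} → Path _~_ a zs b → 1 ≤ length zs
      nonempty (stop _) = s≤s z≤n
      nonempty (_ ∷ _)  = s≤s z≤n
      own : ∀ {a zs b} → Path _~_ a zs b → suc (tally (E a) zs) ≤ length zs
      own {zs = _ ∷ zs} (stop a) rewrite E-irr a = s≤s z≤n
      own {zs = _ ∷ zs} (_∷_ {a} _ _) rewrite E-irr a = s≤s (tally≤length (E a) zs)
      cover : ∀ {x} → InX x → w ~ x → x ∈ vertices ++ ws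
      cover {x} Xx e with elem vertices x in eq
      ... | true  = ∈-++⁺ˡ (elem-∈ vertices eq)
      ... | false = ∈-++⁺ʳ vertices (stuck (∧-true Xx (cong not eq)) e)
      1≤near : ∀ {i} → Near (length ws) i → 1 ≤ i
      1≤near (inj₁ (l , _)) = l
      1≤near (inj₂ (l , _)) = ≤-trans (s≤s z≤n) l
      near≤ : ∀ {i} → Near (length ws) i → i ≤ suc d
      near≤ {i} h = ≤-trans (i≤ h) (≤-trans (+-monoʳ-≤ (length ws) (n≤1+n 2)) (≤-trans (+-monoˡ-≤ 3 (length≤count u a))
        (≤-trans few (≤-trans (m≤m+n k _) (eq≤ q≡)))))
        where
        i≤ : Near (length ws) i → i ≤ length ws + 2
        i≤ (inj₁ (_ , h)) = ≤-trans h (m≤m+n (length ws) 2)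
        i≤ (inj₂ (_ , h)) = h

-- Refuting a long path with both ends adjacent to `t`

half : ∀ m → ∃ λ e → m ≡ 2 * e ⊎ m ≡ suc (2 * e)
half zero    = 0 , inj₁ refl
half (suc m) with half m
... | e , inj₁ eq = e , inj₂ (cong suc eq)
... | e , inj₂ eq = suc e , inj₁ (trans (cong suc eq) (sym (*-suc 2 e)))

private
  tightness : ∀ q {r θ p dt δ tx ta rt} → suc q + r ≤ p → p + θ ≤ dt + δ → dt ≤ tx + rt → δ ≤ 1 + ta → q + r + θ ≤ tx + ta + rt
  tightness q {r} {θ} {p} {dt} {δ} {tx} {ta} {rt} h₁ h₂ h₃ h₄ = lin 0 (h₁ ⊹ h₂ ⊹ h₃ ⊹ h₄) (solve (dt ⨾ p ⨾ q ⨾ r ⨾ rt ⨾ ta ⨾ tx ⨾ δ ⨾ θ ⨾ ε))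
  noSlack : ∀ {q r θ a rt} → q + r + θ ≤ a + rt → a ≤ q → rt ≤ r → θ ≡ 1 → ⊥
  noSlack {q} {r} {θ} {a} {rt} h₁ h₂ h₃ h₄ = lin⊥ 0 (h₁ ⊹ h₂ ⊹ h₃ ⊹ eq≥ h₄) (solve (a ⨾ q ⨾ r ⨾ rt ⨾ θ ⨾ ε))
  full : ∀ {q r θ a rt} → q + r + θ ≤ a + rt → a ≤ q → r ≤ rt
  full {q} {r} {θ} {a} {rt} h₁ h₂ = lin θ (h₁ ⊹ h₂) (solve (a ⨾ q ⨾ r ⨾ rt ⨾ θ ⨾ ε))
  full′ : ∀ {q r θ a rt} → q + r + θ ≤ a + rt → rt ≤ r → q ≤ a
  full′ {q} {r} {θ} {a} {rt} h₁ h₂ = lin θ (h₁ ⊹ h₂) (solve (a ⨾ q ⨾ r ⨾ rt ⨾ θ ⨾ ε))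
  4≤2k : ∀ k → 3 ≤ k → 4 ≤ 2 * k
  4≤2k k h = linᵍ 2 (2 + 2 * k) (4 ⊠ h) (solve (k ⨾ ε))
  nonzero : ∀ c k q → 4 + c ≡ 2 * k → 2 * k ≤ suc q → 3 + c ≤ q
  nonzero c k q h₁ h₂ = lin 0 (eq≤ h₁ ⊹ h₂) (solve (c ⨾ k ⨾ q ⨾ ε))
  outside : ∀ c k {p r} → 4 + c ≡ 2 * k → suc (2 + c + 2) + r ≤ p → p + 2 ≤ 3 * k → r + 3 ≤ k
  outside c k {p} {r} h₁ h₂ h₃ = lin 0 (eq≥ h₁ ⊹ h₂ ⊹ h₃) (solve (c ⨾ k ⨾ p ⨾ r ⨾ ε))
  sized : ∀ c k → 4 + c ≡ 2 * k → 2 + c + 2 ≡ 2 * k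
  sized c k h = lin≡ h (solve (c ⨾ k ⨾ ε))
  short : ∀ c k s {p r} → 4 + c ≡ 2 * k → suc (2 + c + s) + r ≤ p → p + 2 ≤ 3 * k → 2 * s ≤ 2 + c
  short c k s {p} {r} h₁ h₂ h₃ = lin (2 * r) (3 ⊠ eq≥ h₁ ⊹ 2 ⊠ h₂ ⊹ 2 ⊠ h₃) (solve (c ⨾ k ⨾ p ⨾ r ⨾ s ⨾ ε))
  opposite≡ : ∀ c s w v → w + s ≡ (2 + c) + 2 → suc v ≡ s → w + (s + v) ≡ suc (2 + c + s)
  opposite≡ c s w v h₁ h₂ = lin≡ (h₁ ⊹≡ h₂) (solve (c ⨾ s ⨾ v ⨾ w ⨾ ε))
  even≤ : ∀ c k s e → 4 + c ≡ 2 * k → 2 * s ≤ 2 + c → s ≡ 2 * e → s ≤ k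
  even≤ c k s e h₁ h₂ h₃ = linᵍ 1 3 (eq≤ h₁ ⊹ h₂) (solve (c ⨾ k ⨾ s ⨾ ε))
  even≡ : ∀ c k s r → 4 + c ≡ 2 * k → s + r ≡ k → (2 + c) + 2 ≡ s + (s + r * 2)
  even≡ c k s r h₁ h₂ = lin≡ (h₁ ⊹≡ 2 ⊠≡ sym h₂) (solve (c ⨾ k ⨾ r ⨾ s ⨾ ε))
  evenBig : ∀ s e → 3 + s ≡ 2 * e → 2 ≤ e
  evenBig s e h = linᵍ 1 s (eq≤ h) (solve (e ⨾ s ⨾ ε))
  oddBig : ∀ s e → 3 + s ≡ suc (2 * e) → 1 ≤ e
  oddBig s e h = linᵍ 1 (1 + s) (eq≤ h) (solve (e ⨾ s ⨾ ε))
  room : ∀ c s → 2 * (3 + s) ≤ 2 + c → ∃ λ w → w + (3 + s) ≡ (2 + c) + 2 × 1 ≤ w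
  room c s h with w , w≡ ← m≤n⇒∃[o]m+o≡n h = w + s + 5 , (lin≡ w≡ (solve (c ⨾ s ⨾ w ⨾ ε))) , (lin (4 + s + w) (z≤n {0}) (solve (s ⨾ w ⨾ ε)))

module NoLasso {n : ℕ} (E : Fin n → Fin n → Bool) (E-sym : ∀ x y → E x y ≡ E y x) (E-irr : ∀ x → E x x ≡ false)
  (X : Subset n) (t : Fin n) where

  open Ends E E-sym E-irr X t public

  vertices-size : ∀ {q} (L : Lasso q) → suc q + count (X ∖ elem (Routes.vertices L)) ≤ count X
  vertices-size {q} L = subst (λ z → z + count (X ∖ elem vertices) ≤ count X) (trans (length-map y (up 0 q)) (up-length 0 q))
    (count-∖elem (map-unique bl) (map-inX bl))
    where
    open Routes L
    bl = up-block q {0} (+-identityʳ q)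

  private
    -- The degree of `t` splits into chords to the path and neighbours off it. The degree of y 1
    -- consists of `t` and chords only, since the path is longest.
    tight : ∀ {d δ θ} → (∀ {q′} → suc (suc d) < q′ → Lasso q′ → ⊥) → (∀ {x} → InX x → δ ≤ count (X ∩ E x)) →
            count X + θ ≤ count (X ∩ E t) + δ → (L : Lasso (suc (suc d))) → t ~ Lasso.y L 1 →
            let open Routes L using (y) in
            suc (suc d) + count (X ∖ elem (Routes.vertices L)) + θ ≤
            tallyℕ (λ i → E t (y i)) (up 1 (suc d)) + tallyℕ (λ i → E (y 1) (y i)) (up 2 d) + count (X ∩ E t ∖ elem (Routes.vertices L))
    tight {d} {δ} {θ} longest δ≤ dominating L e = tightness (suc (suc d)) {tx = tallyℕ (λ i → E t (y i)) (up 1 (suc d))} (vertices-size L) dominating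
      (≤-trans (count-off (X ∩ E t) vertices) (+-monoˡ-≤ _ (≤-trans (tally-mono vertices (λ z → ∧-right {X z}))
        (eq≤ (trans (tally-map (E t) y (up 0 (suc (suc d)))) (cong (λ b → b2n b + tallyℕ (λ i → E t (y i)) (up 1 (suc d))) (trans (cong (E t) y0) (E-irr t))))))))
      (≤-trans (Longest.degree-tally longest δ≤ (≤-trans (m≤m+n _ θ) dominating) L (s≤s z≤n))
        (eq≤ (cong₂ (λ a b → b2n a + (b2n b + tallyℕ (λ i → E (y 1) (y i)) (up 2 d)))
          (trans (cong (E (y 1)) y0) (~-sym e)) (E-irr (y 1)))))
      where open Routes L

    module Sized {c k s δ θ} (c≡ : 4 + c ≡ 2 * k) (longest : ∀ {q′} → 2 + c + suc s < q′ → Lasso q′ → ⊥)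
      (δ≤ : ∀ {x} → InX x → δ ≤ count (X ∩ E x)) (dominating : count X + θ ≤ count (X ∩ E t) + δ)
      (3≤k : 3 ≤ k) (k≤δ : k ≤ δ) (noCycle : ¬ Cycles _~_ InX ((2 + c) + 2)) (few : count X + 2 ≤ 3 * k) where

      module _ (L : Lasso (2 + c + suc s)) (e₁ : t ~ Lasso.y L 1) (e₂ : t ~ Lasso.y L (2 + c + suc s)) where
        open Routes L

        x A : ℕ → Bool
        x i = E t (y i)
        A i = E (y 1) (y i)
        R T : Subset n
        R = X ∖ elem vertices
        T = X ∩ E t ∖ elem vertices

        C : Chorded (2 + c) (suc s) x A
        C = chorded noCycle L (s≤s z≤n) (s≤s (s≤s z≤n)) e₁ e₂

        T⊆R : T ⊆ R
        T⊆R z h = ∧-true (∧-left (∧-left h)) (∧-right {(X ∩ E t) z} h)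

        S : ℕ
        S = tallyℕ x (up 1 (suc (c + suc s))) + tallyℕ A (up 2 (s + suc c))

        S≤q : S ≤ 2 + c + suc s
        S≤q = Tallies.bound C

        slack : 2 + c + suc s + count R + θ ≤ S + count T
        slack = subst (λ z → 2 + c + suc s + count R + θ ≤ tallyℕ x (up 1 (suc (c + suc s))) + tallyℕ A (up 2 z) + count T)
          (trans (+-comm c (suc s)) (sym (+-suc s c))) (tight longest δ≤ dominating L e₁)

        θ≢1 : θ ≡ 1 → ⊥
        θ≢1 = noSlack slack S≤q (count-mono T⊆R)

        -- The chords contribute at most q, so `slack` forces `T` to be as large as `R`: no vertex
        -- off the lasso is missed by `t`.
        attached : ∀ {z} → Off L z → t ~ z
        attached {z} (Xz , z≢) with E t z in eq
        ... | true  = refl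
        ... | false = ⊥-elim (1+n≰n (≤-trans (eq≥ (count-remove Rz))
              (≤-trans (full slack S≤q) (count-mono λ x h → ∖⁅⁆ {S = R} (T⊆R x h) λ { refl → false-true eq (∧-right {X x} (∧-left h)) }))))
          where
          Rz : R z ≡ true
          Rz = ∧-true Xz (cong not (off L (Xz , z≢)))

        E! : Exact (2 + c) (suc s) x A
        E! = exact C (full′ slack (count-mono T⊆R))

        2s≤c : 2 * suc s ≤ 2 + c
        2s≤c = short c k (suc s) c≡ (vertices-size L) few

    -- The path has 2k - 2 + (s + 1) vertices. For θ = 1 the chord count is contradictory. For θ = 0
    -- a path on 2k - 1 vertices closes up with `t`, one on 2k vertices needs a vertex of `X`
    -- hanging off it, and a longer one falls to the propagation of chords.
    noLassoSized : ∀ {c k δ θ} s → 4 + c ≡ 2 * k → (∀ {q′} → 2 + c + suc s < q′ → Lasso q′ → ⊥) →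
              (∀ {x} → InX x → δ ≤ count (X ∩ E x)) → count X + θ ≤ count (X ∩ E t) + δ → 3 ≤ k → k ≤ δ →
              ¬ Cycles _~_ InX ((2 + c) + 2) → count X + 2 ≤ 3 * k → θ ≡ 1 ⊎ ¬ count X ≡ suc (2 * k) →
              (L : Lasso (2 + c + suc s)) → t ~ Lasso.y L 1 → t ~ Lasso.y L (2 + c + suc s) → ⊥
    noLassoSized s c≡ longest δ≤ dominating 3≤k k≤δ noCycle few (inj₁ θ≡1) L e₁ e₂ =
      Sized.θ≢1 c≡ longest δ≤ dominating 3≤k k≤δ noCycle few L e₁ e₂ θ≡1
    noLassoSized {c} zero c≡ longest δ≤ dominating 3≤k k≤δ noCycle few (inj₂ _) L e₁ e₂ =
      Chorded.noF C ≤-refl ≤-refl e₁ (Chorded.last C)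
      where C = Sized.C c≡ longest δ≤ dominating 3≤k k≤δ noCycle few L e₁ e₂
    noLassoSized {c} {k} (suc zero) c≡ longest δ≤ dominating 3≤k k≤δ noCycle few (inj₂ excess) L e₁ e₂ =
      let z , Rz = inhabited {S = R} nonempty
      in noHanging (trans (sym (sized c k c≡)) refl) longest noCycle (λ h → ≤-trans k≤δ (δ≤ h)) L e₁ e₂ (M.attached L e₁ e₂)
           (outside c k c≡ (vertices-size L) few) Rz
      where
      module M = Sized {s = 1} c≡ longest δ≤ dominating 3≤k k≤δ noCycle few
      R : Subset n
      R = M.R L e₁ e₂
      open Routes L using (vertices; y)
      q≡ : suc (2 + c + 2) ≡ suc (2 * k)
      q≡ = cong suc (sized c k c≡)
      -- Otherwise `X` would consist of `t` and the 2k vertices of the path.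
      nonempty : 0 < count R
      nonempty with count R in eq
      ... | suc _ = s≤s z≤n
      ... | zero  = ⊥-elim (excess (≤-antisym
        (≤-trans (count-off X vertices) (≤-trans (+-mono-≤ (tally≤length X vertices) (eq≤ eq))
          (eq≤ (trans (+-identityʳ _) (trans (length-map y (up 0 (2 + c + 2))) (trans (up-length 0 (2 + c + 2)) q≡))))))
        (≤-trans (eq≥ q≡) (≤-trans (m≤m+n _ (count R)) (vertices-size L)))))
    noLassoSized {c} {k} (suc (suc s)) c≡ longest δ≤ dominating 3≤k k≤δ noCycle few (inj₂ _) L e₁ e₂ = byParity (half (3 + s))
      where
      open Sized {s = 2 + s} c≡ longest δ≤ dominating 3≤k k≤δ noCycle few
      open Routes L using (y)
      2s-bound : 2 * (3 + s) ≤ 2 + c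
      2s-bound = 2s≤c L e₁ e₂
      q : ℕ
      q = 2 + c + (3 + s)
      L′ : Lasso q
      L′ = reversed L
      last′ : t ~ Lasso.y L′ q
      last′ = subst (t ~_) (sym (reversed-at L {q} {1} (s≤s z≤n) (+-comm q 1))) e₁
      -- The `opposite` chord of the reversed path, numbered from the original start; with σ = 3 + s
      -- it sits at 2σ - 1.
      mirrored : E t (y ((3 + s) + (2 + s))) ≡ true
      mirrored = let w , w≡ , 1≤w = room c s 2s-bound in
        trans (cong (E t) (sym (reversed-at L 1≤w (opposite≡ c (3 + s) w (2 + s) w≡ refl))))
          (opposite (E! L′ e₂ last′) 2s-bound (s≤s (s≤s z≤n)) w≡)
      byParity : (∃ λ e → 3 + s ≡ 2 * e ⊎ 3 + s ≡ suc (2 * e)) → ⊥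
      byParity (e , inj₁ eq) = let r , r≡ = m≤n⇒∃[o]m+o≡n (even≤ c k (3 + s) e c≡ 2s-bound eq) in
        noExact-even (E! L e₁ e₂) 2s-bound e r {2 + s} {1 + s} (evenBig s e eq) eq (even≡ c k (3 + s) r c≡ r≡) refl refl mirrored
      byParity (e , inj₂ eq) = noExact-odd (E! L e₁ e₂) 2s-bound e (oddBig s e eq) eq
        (subst (λ z → E t (y (3 + s + z)) ≡ true) (suc-injective eq) mirrored)

  noLasso : ∀ {q k δ θ} → (∀ {q′} → q < q′ → Lasso q′ → ⊥) → (∀ {x} → InX x → δ ≤ count (X ∩ E x)) →
            count X + θ ≤ count (X ∩ E t) + δ → 3 ≤ k → k ≤ δ → ¬ Cycles _~_ InX (2 * k) → count X + 2 ≤ 3 * k →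
            θ ≡ 1 ⊎ ¬ count X ≡ suc (2 * k) →
            (L : Lasso q) → t ~ Lasso.y L 1 → t ~ Lasso.y L q → 2 * k ≤ suc q → ⊥
  noLasso {q} {k} longest δ≤ dominating 3≤k k≤δ noCycle few excess L e₁ e₂ long
    with c , c≡ ← m≤n⇒∃[o]m+o≡n (4≤2k k 3≤k)
    with s , q≡ ← m≤n⇒∃[o]m+o≡n (nonzero c k q c≡ long)
    with refl ← trans (cong (2 +_) (+-suc c s)) q≡ =
    noLassoSized s c≡ longest δ≤ dominating 3≤k k≤δ (subst (λ z → ¬ Cycles _~_ InX z) (sym (sized c k c≡)) noCycle) few excess L e₁ e₂

-- The upper bound

private
  odd-product : ∀ a b m → suc (2 * a) * suc (2 * b) ≡ 2 * m → ⊥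
  odd-product a b m eq = even≢odd m (a + b + 2 * (a * b)) (trans (sym eq) (expand a b))
    where
    expand : ∀ a b → suc (2 * a) * suc (2 * b) ≡ suc (2 * (a + b + 2 * (a * b)))
    expand = solve-∀

∑-scale : ∀ {n} (f : Fin n → ℕ) c → ∑ (λ x → f x * c) ≡ ∑ f * c
∑-scale {zero}  f c = refl
∑-scale {suc n} f c = trans (cong (f zero * c +_) (∑-scale (f ∘ suc) c)) (sym (*-distribʳ-+ c (f zero) (∑ (f ∘ suc))))

count-cong : ∀ {n} {S T : Subset n} → (∀ x → S x ≡ T x) → count S ≡ count T
count-cong h = ≤-antisym (count-mono λ x p → trans (sym (h x)) p) (count-mono λ x p → trans (h x) p)

-- The handshake lemma for the subgraph induced on `B`, extended by isolated vertices: an odd order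
-- times an odd degree would be even.
noOddRegular : ∀ {n} (E : Fin n → Fin n → Bool) → (∀ x y → E x y ≡ E y x) → (∀ x → E x x ≡ false) →
               ∀ (B : Subset n) a b → count B ≡ suc (2 * a) → (∀ x → B x ≡ true → count (B ∩ E x) ≡ suc (2 * b)) → ⊥
noOddRegular {n} E sy ir B a b odd regular =
  let m , eq = handshake F F-sym (λ x → trans (cong (λ e → B x ∧ (B x ∧ e)) (ir x)) (falsify (B x)))
  in odd-product a b m (begin
    suc (2 * a) * suc (2 * b)            ≡⟨ cong (_* suc (2 * b)) odd ⟨
    count B * suc (2 * b)                ≡⟨ cong (_* suc (2 * b)) (count-∑ B) ⟩
    ∑ (b2n ∘ B) * suc (2 * b)            ≡⟨ ∑-scale (b2n ∘ B) (suc (2 * b)) ⟨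
    ∑ (λ x → b2n (B x) * suc (2 * b))    ≡⟨ ∑-cong local ⟨
    ∑ (λ x → count (F x))                ≡⟨ eq ⟩
    2 * m                                ∎)
  where
  open ≡-Reasoning
  F : Fin n → Fin n → Bool
  F x y = B x ∧ (B y ∧ E x y)
  falsify : ∀ a → a ∧ (a ∧ false) ≡ false
  falsify true  = refl
  falsify false = refl
  swap : ∀ a b c → a ∧ (b ∧ c) ≡ b ∧ (a ∧ c)
  swap true  true  c = refl
  swap true  false c = refl
  swap false true  c = refl
  swap false false c = refl
  F-sym : ∀ x y → F x y ≡ F y x
  F-sym x y = trans (cong (λ e → B x ∧ (B y ∧ e)) (sy x y)) (swap (B x) (B y) (E y x))
  local : ∀ x → count (F x) ≡ b2n (B x) * suc (2 * b)
  local x with B x in eq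
  ... | true  = trans (regular x eq) (sym (+-identityʳ _))
  ... | false = count≡0 λ _ → refl

argmin : ∀ {n} (f : Fin n → ℕ) (S : Subset n) {x} → S x ≡ true → ∃ λ u → S u ≡ true × (∀ y → S y ≡ true → f u ≤ f y)
argmin f S {x} Sx = go (f x) Sx ≤-refl
  where
  go : ∀ m {x} → S x ≡ true → f x ≤ m → ∃ λ u → S u ≡ true × (∀ y → S y ≡ true → f u ≤ f y)
  go m {x} Sx h with Fin.any? (λ y → (S y Bool.≟ true) ×-dec (f y <? f x))
  ... | no  ¬p = x , Sx , λ y Sy → ≮⇒≥ λ lt → ¬p (y , Sy , lt)
  go zero    Sx h | yes (y , Sy , lt) = ⊥-elim (n≮0 (≤-trans lt h))
  go (suc m) Sx h | yes (y , Sy , lt) = go m Sy (≤-pred (≤-trans lt h))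

weave : ∀ {A : Set} → List A → List A → List A
weave (p ∷ ps) (q ∷ qs) = p ∷ q ∷ weave ps qs
weave ps       _        = ps

weave-↭ : ∀ {A : Set} (ps qs : List A) → suc (length qs) ≡ length ps → weave ps qs ↭ ps ++ qs
weave-↭ (p ∷ [])      []       _  = ↭-refl
weave-↭ (p ∷ p′ ∷ ps) (q ∷ qs) eq = prep p
  (↭-trans (prep q (weave-↭ (p′ ∷ ps) qs (suc-injective eq))) (↭-sym (shift q (p′ ∷ ps) qs)))

weavePath : ∀ {A : Set} {R : A → A → Set} {P Q : A → Set} → (∀ {x y} → P x → Q y → R x y × R y x) →
            ∀ p ps qs → All P (p ∷ ps) → All Q qs → length qs ≡ length ps → ∃ λ p′ → Path R p (weave (p ∷ ps) qs) p′ × P p′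
weavePath c p []        []       (Pp All.∷ _) _ _ = p , stop p , Pp
weavePath c p (p₂ ∷ ps) (q ∷ qs) (Pp All.∷ Ps@(Pp₂ All.∷ _)) (Qq All.∷ Qs) eq =
  let p′ , π , Pp′ = weavePath c p₂ ps qs Ps Qs (suc-injective eq)
  in p′ , proj₁ (c Pp Qq) ∷ proj₂ (c Pp₂ Qq) ∷ π , Pp′

private
  A-size≡ : ∀ {N n k θ a} → suc N ≡ 2 * n + k + θ → n + k + a ≡ N → suc a ≡ n + θ
  A-size≡ {N} {n} {k} {θ} {a} h₁ h₂ = lin≡ (h₁ ⊹≡ h₂) (solve (N ⨾ a ⨾ k ⨾ n ⨾ θ ⨾ ε))
  deg≥ : ∀ {N n k θ dX dA a} → suc N ≡ 2 * n + k + θ → N ≤ dX + dA + n → dA ≤ a → suc a ≡ n + θ → k ≤ dX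
  deg≥ {N} {n} {k} {θ} {dX} {dA} {a} h₁ h₂ h₃ h₄ = lin 0 (eq≥ h₁ ⊹ h₂ ⊹ h₃ ⊹ eq≤ h₄) (solve (N ⨾ a ⨾ dA ⨾ dX ⨾ k ⨾ n ⨾ θ ⨾ ε))
  common : ∀ {N n k θ dXu dXp dAu dAp a c} → suc N ≡ 2 * n + k + θ → N ≤ dXu + dAu + n → N ≤ dXp + dAp + n → suc a ≡ n + θ →
           dAu + dAp ≤ a + c → dXu + dXp + 1 ≤ n + k + θ → k ≤ c
  common {N} {n} {k} {θ} {dXu} {dXp} {dAu} {dAp} {a} {c} h₁ h₂ h₃ h₄ h₅ h₆ = lin 0 (2 ⊠ eq≥ h₁ ⊹ h₂ ⊹ h₃ ⊹ eq≤ h₄ ⊹ h₅ ⊹ h₆) (solve (N ⨾ a ⨾ c ⨾ dAp ⨾ dAu ⨾ dXp ⨾ dXu ⨾ k ⨾ n ⨾ θ ⨾ ε))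
  thin : ∀ {n k θ a b} → suc a ≡ n + θ → n + 2 ≤ 2 * k → θ ≤ 1 → b ≤ a → b + 2 ≤ 2 * k
  thin {n} {k} {θ} {a} {b} h₁ h₂ h₃ h₄ = lin 0 (eq≤ h₁ ⊹ h₂ ⊹ h₃ ⊹ h₄) (solve (a ⨾ b ⨾ k ⨾ n ⨾ θ ⨾ ε))
  degLow : ∀ {N n k d} → suc N ≡ 2 * n + k + 0 → N ≤ d + n → d < n + k → suc d ≡ n + k
  degLow {N} {n} {k} {d} h₁ h₂ h₃ = ≤-antisym (lin 0 h₃ (solve (d ⨾ k ⨾ n ⨾ ε))) (lin 0 (eq≥ h₁ ⊹ h₂) (solve (N ⨾ d ⨾ k ⨾ n ⨾ ε)))
  degHigh : ∀ {N n k d} → suc N ≡ 2 * n + k + 1 → N ≤ d + n → n + k ≤ d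
  degHigh {N} {n} {k} {d} h₁ h₂ = lin 0 (eq≥ h₁ ⊹ h₂) (solve (N ⨾ d ⨾ k ⨾ n ⨾ ε))
  oddN : ∀ {N n k b} → suc N ≡ 2 * n + k + 0 → k ≡ 2 * suc b → N ≡ suc (2 * (n + b))
  oddN {N} {n} {k} {b} h₁ h₂ = lin≡ (h₁ ⊹≡ h₂) (solve (N ⨾ b ⨾ k ⨾ n ⨾ ε))
  oddD : ∀ {n k d a b} → suc d ≡ n + k → n ≡ 2 * a → k ≡ 2 * suc b → d ≡ suc (2 * (a + b))
  oddD {n} {k} {d} {a} {b} h₁ h₂ h₃ = lin≡ (h₁ ⊹≡ h₂ ⊹≡ h₃) (solve (a ⨾ b ⨾ d ⨾ k ⨾ n ⨾ ε))
  dominates : ∀ {n k θ du dt} → ¬ du + dt + 1 ≤ n + k + θ → n + k + θ ≤ dt + du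
  dominates {n} {k} {θ} {du} {dt} h = lin 0 (≰⇒> h) (solve (dt ⨾ du ⨾ k ⨾ n ⨾ θ ⨾ ε))
  3k-bound : ∀ {n k x} → n + 2 ≤ 2 * k → x ≡ n + k → x + 2 ≤ 3 * k
  3k-bound {n} {k} {x} h₁ h₂ = lin 0 (h₁ ⊹ eq≤ h₂) (solve (k ⨾ n ⨾ x ⨾ ε))
  remaining : ∀ {n k x q r} → k < n → suc x ≡ n + k → suc q < 2 * k → x ≤ q + r → 0 < r
  remaining {n} {k} {x} {q} {r} h₁ h₂ h₃ h₄ = linᵍ 1 (1 + r) (h₁ ⊹ eq≥ h₂ ⊹ h₃ ⊹ h₄) (solve (k ⨾ n ⨾ q ⨾ r ⨾ x ⨾ ε))
  smaller : ∀ {a b x m} → a + b ≡ x → suc x ≡ m → ¬ 2 * a + 1 ≤ m → 2 * b + 1 ≤ m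
  smaller {a} {b} {x} {m} h₁ h₂ h₃ = lin 1 (2 ⊠ eq≤ h₁ ⊹ 2 ⊠ eq≤ h₂ ⊹ ≰⇒> h₃) (solve (a ⨾ b ⨾ m ⨾ x ⨾ ε))

  k≤A : ∀ {n k θ a} → suc a ≡ n + θ → k < n → k ≤ a
  k≤A {n} {k} {θ} {a} h₁ h₂ = lin θ (eq≥ h₁ ⊹ h₂) (solve (a ⨾ k ⨾ n ⨾ θ ⨾ ε))
  lightS : ∀ {n k θ s a b} → 2 * s + 1 ≤ n + k → a ≤ s → b ≤ s → a + b + 1 ≤ n + k + θ
  lightS {n} {k} {θ} {s} {a} {b} h₁ h₂ h₃ = lin θ (h₁ ⊹ h₂ ⊹ h₃) (solve (a ⨾ b ⨾ k ⨾ n ⨾ s ⨾ θ ⨾ ε))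
  complete : ∀ {N n k θ dx da a} → suc N ≡ 2 * n + k + θ → N ≤ dx + da + n → suc a ≡ n + θ → dx ≤ k → suc da ≤ a → ⊥
  complete {N} {n} {k} {θ} {dx} {da} {a} h₁ h₂ h₃ h₄ h₅ = lin⊥ 0 (eq≥ h₁ ⊹ h₂ ⊹ eq≤ h₃ ⊹ h₄ ⊹ h₅) (solve (N ⨾ a ⨾ da ⨾ dx ⨾ k ⨾ n ⨾ θ ⨾ ε))
  spare : ∀ {m w k a r} → m + w ≤ k → k ≤ a → a ≤ w + r → m ≤ r
  spare {m} {w} {k} {a} {r} h₁ h₂ h₃ = lin 0 (h₁ ⊹ h₂ ⊹ h₃) (solve (a ⨾ k ⨾ m ⨾ r ⨾ w ⨾ ε))
  θ-zero : ∀ {N n k e b} → suc N ≡ 2 * n + k + 1 → N ≤ e + n → suc b ≡ n + k → e ≤ b → ⊥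
  θ-zero {N} {n} {k} {e} {b} h₁ h₂ h₃ h₄ = lin⊥ 0 (eq≥ h₁ ⊹ h₂ ⊹ eq≤ h₃ ⊹ h₄) (solve (N ⨾ b ⨾ e ⨾ k ⨾ n ⨾ ε))
  saturated : ∀ {N n k e b} → suc N ≡ 2 * n + k + 0 → N ≤ e + n → suc b ≡ n + k → suc e ≤ b → ⊥
  saturated {N} {n} {k} {e} {b} h₁ h₂ h₃ h₄ = lin⊥ 0 (eq≥ h₁ ⊹ h₂ ⊹ eq≤ h₃ ⊹ h₄) (solve (N ⨾ b ⨾ e ⨾ k ⨾ n ⨾ ε))
  oddB : ∀ {n k c a b} → suc c ≡ n + k → n ≡ 2 * a → k ≡ 2 * suc b → c ≡ suc (2 * (a + b))
  oddB {n} {k} {c} {a} {b} h₁ h₂ h₃ = lin≡ (h₁ ⊹≡ h₂ ⊹≡ h₃) (solve (a ⨾ b ⨾ c ⨾ k ⨾ n ⨾ ε))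
  oddK : ∀ {k d b} → k ≡ 2 * suc b → k ≤ suc d → ¬ k ≤ d → d ≡ suc (2 * b)
  oddK {k} {d} {b} h₁ h₂ h₃ = ≤-antisym (lin 0 (eq≤ h₁ ⊹ ≰⇒> h₃) (solve (b ⨾ d ⨾ k ⨾ ε))) (lin 0 (eq≥ h₁ ⊹ h₂) (solve (b ⨾ d ⨾ k ⨾ ε)))

  two : ∀ {n θ k a} → suc a ≡ n + θ → k < n → 3 ≤ k → 1 < a
  two {n} {θ} {k} {a} h₁ h₂ h₃ = linᵍ 2 (2 + a + 2 * θ) (2 ⊠ eq≥ h₁ ⊹ 2 ⊠ h₂ ⊹ 2 ⊠ h₃) (solve (a ⨾ k ⨾ n ⨾ θ ⨾ ε))
  length₅ : ∀ {m k} → 3 + m ≡ k → 5 + suc (m + m) ≡ 2 * k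
  length₅ {m} {k} h = lin≡ (2 ⊠≡ h) (solve (k ⨾ m ⨾ ε))
  length₃ : ∀ {m k} → 2 + m ≡ k → 3 + suc (m + m) ≡ 2 * k
  length₃ {m} {k} h = lin≡ (2 ⊠≡ h) (solve (k ⨾ m ⨾ ε))
  fits : ∀ {m k t} w → w + m ≡ k → t ≤ w → m + t ≤ k
  fits {m} {k} {t} w h₁ h₂ = lin 0 (eq≤ h₁ ⊹ h₂) (solve (k ⨾ m ⨾ t ⨾ w ⨾ ε))

-- A certificate for explicit lists whose vertices are only partly known: an entry proved to lie
-- outside `S` is free, any other may be charged one.
data AtMost {n} (S : Subset n) : List (Fin n) → ℕ → Set where
  nil : AtMost S [] 0
  absent : ∀ {x xs m} → S x ≡ false → AtMost S xs m → AtMost S (x ∷ xs) m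
  maybe : ∀ {x xs m} → AtMost S xs m → AtMost S (x ∷ xs) (suc m)

atMost : ∀ {n} {S : Subset n} {xs m} → AtMost S xs m → tally S xs ≤ m
atMost nil       = z≤n
atMost (absent p h) rewrite p = atMost h
atMost {S = S} (maybe {x} h) = +-mono-≤ (b2n≤1 (S x)) (atMost h)

count-drop : ∀ {n} (S : Subset n) x → count S ≤ suc (count (S ∖ ⁅ x ⁆))
count-drop S x with S x in eq
... | true  = eq≤ (count-remove eq)
... | false = ≤-trans (count-mono λ y p → ∖⁅⁆ {S = S} p λ { refl → false-true eq p }) (n≤1+n _)

-- The order of the graph is 2 n + k - 1 + θ.
Extremal : ℕ → ℕ → ℕ → Set
Extremal n k θ = θ ≡ 1 ⊎ θ ≡ 0 × ∃ λ a → ∃ λ b → n ≡ 2 * a × k ≡ 2 * suc b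

module Upper {N n k θ : ℕ} (E : Fin N → Fin N → Bool) (E-sym : ∀ x y → E x y ≡ E y x) (E-irr : ∀ x → E x x ≡ false)
  (size : suc N ≡ 2 * n + k + θ) (degree : ∀ x → N ≤ count (E x) + n) (n+2≤2k : n + 2 ≤ 2 * k) (k<n : k < n) (3≤k : 3 ≤ k)
  (extremal : Extremal n k θ) where

  _~_ : Fin N → Fin N → Set
  x ~ y = E x y ≡ true

  ~-sym : ∀ {x y} → x ~ y → y ~ x
  ~-sym {x} {y} h = trans (E-sym y x) h

  In : Subset N → Fin N → Set
  In S x = S x ≡ true

  NoWheel : Set
  NoWheel = ∀ u → ¬ Cycles _~_ (In (E u)) (2 * k)

  θ≤1 : θ ≤ 1
  θ≤1 = bound extremal
    where
    bound : Extremal n k θ → θ ≤ 1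
    bound (inj₁ refl)       = ≤-refl
    bound (inj₂ (refl , _)) = z≤n

  largeDegree : ∃ λ v → n + k ≤ count (E v)
  largeDegree with Fin.any? (λ v → n + k ≤? count (E v))
  ... | yes p = p
  ... | no ¬p = ⊥-elim (absurd extremal size)
    where
    vertex : Fin N
    vertex = proj₁ (inhabited {S = const true} (≤-trans (positive size k<n) (eq≥ count-full)))
      where
      positive : suc N ≡ 2 * n + k + θ → k < n → 0 < N
      positive h₁ h₂ = linᵍ 9 (9 + 9 * N + θ) (3 ⊠ 3≤k ⊹ eq≥ size ⊹ 2 ⊠ k<n) (solve (N ⨾ k ⨾ n ⨾ θ ⨾ ε))
    absurd : Extremal n k θ → suc N ≡ 2 * n + k + θ → ⊥
    absurd (inj₁ refl) size′ = ¬p (vertex , degHigh {n = n} size′ (degree vertex))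
    absurd (inj₂ (refl , a , b , n≡ , k≡)) size′ = noOddRegular E E-sym E-irr (const true) (n + b) (a + b)
      (trans count-full (oddN {N} {n} size′ k≡))
      (λ x _ → oddD {n} {k} {_} {a} {b} (degLow {n = n} size′ (degree x) (≰⇒> λ h → ¬p (x , h))) n≡ k≡)

  module _ (noWheel : NoWheel) {v X} (X⊆ : X ⊆ E v) (X-size : count X ≡ n + k) where

    A : Subset N
    A = ∁ X

    dX dA : Fin N → ℕ
    dX x = count (X ∩ E x)
    dA x = count (A ∩ E x)

    A-size : suc (count A) ≡ n + θ
    A-size = A-size≡ {N} {n} {k} size (trans (cong (_+ count A) (sym X-size)) (count-∁ X))

    degrees : ∀ x → N ≤ dX x + dA x + n
    degrees x = ≤-trans (degree x) (eq≤ (cong (_+ n) (trans (count-split (E x) X)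
      (cong₂ _+_ (count-cong {S = E x ∩ X} {T = X ∩ E x} λ y → ∧-comm (E x y) (X y)) (count-cong {S = E x ∖ X} {T = A ∩ E x} λ y → ∧-comm (E x y) (A y))))))

    dA≤ : ∀ x → dA x ≤ count A
    dA≤ x = count-mono λ _ → ∧-left

    k≤dX : ∀ x → k ≤ dX x
    k≤dX x = deg≥ {N} {n} {k} {θ} size (degrees x) (dA≤ x) A-size

    X-A : ∀ x → X x ≡ true → A x ≡ true → ⊥
    X-A x h h′ = false-true (not-true h′) h

    weaken : ∀ {S S′ : Fin N → Set} {m} → (∀ {x} → S x → S′ x) → Cycles _~_ S m → Cycles _~_ S′ m
    weaken h (xs , c , u , a , l) = xs , c , u , All.map h a , l

    -- By inclusion-exclusion in `A`, u and p have at least 2(n + k - 1 + θ) - (n + k - 1 + θ) - (n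
    -- - 1 + θ) = k common neighbours there: twice the least degree, less the two degrees in `X`,
    -- less |A|.
    noCrowd : ∀ u (P : Subset N) → P ⊆ X ∩ E u → k ≤ count P → (∀ {p} → P p ≡ true → dX u + dX p + 1 ≤ n + k + θ) → ⊥
    noCrowd u P P⊆ k≤P light = Bipartite.alternatingCycle E E-sym P (A ∩ E u) (λ x Px Qx → X-A x (∧-left (P⊆ x Px)) (∧-left Qx))
      (≤-trans (s≤s z≤n) 3≤k) k≤P (thin {n} {k} {θ} A-size n+2≤2k θ≤1 (dA≤ u))
      (λ p Pp → ≤-trans (common {N} {n} {k} {θ} {dX u} size (degrees u) (degrees p) A-size
         (count-∪ {S = A ∩ E u} {T = A ∩ E p} {U = A} (λ _ → ∧-left) (λ _ → ∧-left)) (light Pp))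
         (count-mono λ x h → ∧-true (∧-left h) (∧-right {A x} (∧-right {(A ∩ E u) x} h))))
      (noWheel u ∘ weaken λ { (inj₁ h) → ∧-right {X _} (P⊆ _ h) ; (inj₂ h) → ∧-right {A _} h })

    module Isolated {t} (Xt : X t ≡ true) (S : Subset N) (S⊆X : S ⊆ X) (t∉S : S t ≡ false) (small : 2 * count S + 1 ≤ n + k)
      (closed : ∀ {x z} → S x ≡ true → X z ≡ true → x ~ z → ¬ z ≡ t → S z ≡ true) {u} (Su : S u ≡ true) where

      dS : Fin N → ℕ
      dS x = count (S ∩ E x)

      v∈A : A v ≡ true
      v∈A = cong not (≢true λ Xv → false-true (E-irr v) (X⊆ v Xv))

      t∉A : A t ≡ false
      t∉A = cong not Xt

      dX≤ : ∀ {x} → S x ≡ true → dX x ≤ suc (dS x)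
      dX≤ {x} Sx = ≤-trans (count-drop (X ∩ E x) t) (s≤s (count-mono λ z h →
        ∧-true (closed Sx (∧-left (∧-left h)) (∧-right {X z} (∧-left h)) (∖⁅⁆-≢ {S = X ∩ E x} h)) (∧-right {X z} (∧-left h))))

      dS< : ∀ {x} → S x ≡ true → suc (dS x) ≤ count S
      dS< {x} Sx = ≤-trans (s≤s (count-mono λ z h → ∖⁅⁆ {S = S} (∧-left h) λ { refl → false-true (E-irr x) (∧-right {S z} h) }))
        (eq≥ (count-remove Sx))

      -- Vertices of `S` have at most |S| neighbours in `X`, and 2|S| < n + k, so any two of them
      -- are light enough for `noCrowd`.
      dS<k : ∀ {x} → S x ≡ true → suc (dS x) ≤ k
      dS<k {x} Sx = ≰⇒> λ k≤ → noCrowd x (S ∩ E x) (λ z h → ∧-true (S⊆X z (∧-left h)) (∧-right {S z} h)) k≤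
        λ h → lightS {n} {k} {θ} small (≤-trans (dX≤ Sx) (dS< Sx)) (≤-trans (dX≤ (∧-left h)) (dS< (∧-left h)))

      -- At least k neighbours in `X` but at most k - 1 in `S`: the missing one can only be `t`.
      S~t : ∀ {x} → S x ≡ true → x ~ t
      S~t {x} Sx with E x t in eq
      ... | true  = refl
      ... | false = ⊥-elim (1+n≰n (≤-trans (dS<k Sx) (≤-trans (k≤dX x) (count-mono λ z h →
        ∧-true (closed Sx (∧-left h) (∧-right {X z} h) λ { refl → false-true eq (∧-right {X z} h) }) (∧-right {X z} h)))))

      -- With only k neighbours in `X`, at least n - 1 + θ are needed in `A`, and this is all of
      -- `A`.
      S~A : ∀ {x a} → S x ≡ true → A a ≡ true → x ~ a
      S~A {x} {a} Sx Aa with E x a in eq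
      ... | true  = refl
      ... | false = ⊥-elim (complete {N} {n} {k} {θ} size (degrees x) A-size (≤-trans (dX≤ Sx) (dS<k Sx))
        (≤-trans (s≤s (count-mono λ z h → ∖⁅⁆ {S = A} (∧-left h) λ { refl → false-true eq (∧-right {A z} h) })) (eq≥ (count-remove Aa))))

      A′ : Fin N → Set
      A′ a = A a ≡ true ⊎ a ≡ t

      S~A′ : ∀ {x a} → S x ≡ true → A′ a → x ~ a
      S~A′ Sx (inj₁ Aa)   = S~A Sx Aa
      S~A′ Sx (inj₂ refl) = S~t Sx

      S-A : ∀ {x} → S x ≡ true → A x ≡ true → ⊥
      S-A Sx Ax = X-A _ (S⊆X _ Sx) Ax

      k≤count-A : k ≤ count A
      k≤count-A = k≤A {n} {k} {θ} A-size k<n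

      k≤1+dS : k ≤ suc (dS u)
      k≤1+dS = ≤-trans (k≤dX u) (dX≤ Su)

      -- A path between vertices of A ∪ {t} is closed up by alternating between S and A.
      braid : ∀ {α β αs} m → Path _~_ α αs β → A′ α → A′ β → Unique αs → All (In (E u)) αs → length αs + suc (m + m) ≡ 2 * k →
              ∀ {a s} → AtMost A αs a → a + m ≡ k → AtMost S αs s → s + (2 + m) ≡ k → ⊥
      braid {α} {β} {αs} m π Aα Aβ uα allα len mostA roomA≡ mostS roomS≡
        with qs , uq , allq , lenq ← sublist (A ∖ elem αs) m (spare {m} (fits _ roomA≡ (atMost mostA)) k≤count-A (count-off A αs))
        with sublist (S ∩ E u ∖ elem αs) (suc m)
               (spare {suc m} {tally S αs} (≤-pred roomS′) ≤-refl (≤-trans (count-off (S ∩ E u) αs) (+-monoˡ-≤ _ (tally-mono αs λ _ → ∧-left))))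
        where
        roomS′ : suc (suc m + tally S αs) ≤ suc (dS u)
        roomS′ = ≤-trans (fits _ roomS≡ (atMost mostS)) k≤1+dS
      ... | p ∷ ps , up , allp , lenp = noWheel u
        (αs ++ weave (p ∷ ps) qs ,
         (α , proj₁ woven , join π (~-sym (S~A′ (∧-left (∧-left (All.head allp))) Aβ)) (proj₁ (proj₂ woven)) , S~A′ (∧-left (∧-left (proj₂ (proj₂ woven)))) Aα) ,
         AllPairs.++⁺ uα (Unique-↭ (↭-sym σ) (AllPairs.++⁺ up uq (All.map (λ Sp → All.map (λ { Aq refl → S-A (∧-left (∧-left Sp)) (∧-left Aq) }) allq) allp)))
           (All.tabulate λ {a} a∈ → All-resp-↭ (↭-sym σ) (All.++⁺ (All.map (λ h eq → avoid a∈ eq (∧-right {(S ∩ E u) _} h)) allp)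
             (All.map (λ h eq → avoid a∈ eq (∧-right {A _} h)) allq))) ,
         All.++⁺ allα (All-resp-↭ (↭-sym σ) (All.++⁺ (All.map (λ h → ∧-right {S _} (∧-left h)) allp) (All.map (λ h → S~A Su (∧-left h)) allq))) ,
         trans (length-++ αs) (trans (cong (length αs +_) (trans (↭-length σ) (trans (length-++ (p ∷ ps)) (cong₂ _+_ lenp lenq)))) len))
        where
        lens : length qs ≡ length ps
        lens = trans lenq (sym (suc-injective lenp))
        σ : weave (p ∷ ps) qs ↭ (p ∷ ps) ++ qs
        σ = weave-↭ (p ∷ ps) qs (cong suc lens)
        woven : ∃ λ p′ → Path _~_ p (weave (p ∷ ps) qs) p′ × (S ∩ E u ∖ elem αs) p′ ≡ true
        woven = weavePath {P = In (S ∩ E u ∖ elem αs)} {Q = In (A ∖ elem αs)} (λ Sp Aq → let e = S~A (∧-left (∧-left Sp)) (∧-left Aq) in e , ~-sym e) p ps qs allp allq lens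
        avoid : ∀ {a x} → a ∈ αs → a ≡ x → not (elem αs x) ≡ true → ⊥
        avoid a∈ refl h = false-true (not-true h) (∈-elem a∈)

      private
        v≢t : ¬ v ≡ t
        v≢t refl = false-true t∉A v∈A
        v~t : v ~ t
        v~t = X⊆ t Xt
        u~t : u ~ t
        u~t = S~t Su
        not-S : ∀ {a} → A a ≡ true → S a ≡ false
        not-S Aa = ≢true λ Sa → S-A Sa Aa
        2≤dS : 2 ≤ dS u
        2≤dS = ≤-pred (≤-trans 3≤k k≤1+dS)

      -- `u` is sure of only k - 1 neighbours in `S`, so the cycle takes k + 1 vertices from `A` and
      -- `t` and must use two edges among them. Here these are v t and a b, linked through p.
      disjointEdges : ∀ {p a b} → (S ∩ E u) p ≡ true → A a ≡ true → A b ≡ true → ¬ a ≡ v → ¬ b ≡ v → a ~ b → ⊥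
      disjointEdges {p} {a} {b} h Aa Ab a≢v b≢v a~b =
        let Sp = ∧-left h
            m , m≡ = m≤n⇒∃[o]m+o≡n 3≤k
        in braid m (v~t ∷ ~-sym (S~t Sp) ∷ S~A Sp Aa ∷ a~b ∷ stop b) (inj₁ v∈A) (inj₁ Ab)
          ((v≢t All.∷ (λ { refl → S-A Sp v∈A }) All.∷ (λ eq → a≢v (sym eq)) All.∷ (λ eq → b≢v (sym eq)) All.∷ All.[]) ∷
           ((λ { refl → false-true t∉S Sp }) All.∷ (λ { refl → false-true t∉A Aa }) All.∷ (λ { refl → false-true t∉A Ab }) All.∷ All.[]) ∷
           ((λ { refl → S-A Sp Aa }) All.∷ (λ { refl → S-A Sp Ab }) All.∷ All.[]) ∷
           ((λ { refl → false-true (E-irr a) a~b }) All.∷ All.[]) ∷ All.[] ∷ [])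
          (S~A Su v∈A All.∷ u~t All.∷ ∧-right {S p} h All.∷ S~A Su Aa All.∷ S~A Su Ab All.∷ All.[])
          (length₅ m≡)
          (maybe (absent t∉A (absent (≢true (S-A Sp)) (maybe (maybe nil))))) m≡ (absent (not-S v∈A) (absent t∉S (maybe (absent (not-S Aa) (absent (not-S Ab) nil))))) m≡

      -- As in `disjointEdges`, but the two edges meet in b and no link in `S` is spent. The
      -- `AtMost` hypothesis reflects that one of b and c is `t`, so that k vertices of `A` suffice.
      sharedEdges : ∀ {a b c} → A a ≡ true → ¬ a ≡ b → ¬ a ≡ c → ¬ b ≡ c → A′ b → A′ c → S b ≡ false → S c ≡ false →
                    AtMost A (b ∷ c ∷ []) 1 → a ~ b → b ~ c → ⊥
      sharedEdges Aa a≢b a≢c b≢c A′b A′c Sb Sc mostA e e′ =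
        let m , m≡ = m≤n⇒∃[o]m+o≡n (≤-trans (n≤1+n 2) 3≤k)
        in braid m (e ∷ e′ ∷ stop _) (inj₁ Aa) A′c
          ((a≢b All.∷ a≢c All.∷ All.[]) ∷ (b≢c All.∷ All.[]) ∷ All.[] ∷ [])
          (S~A Su Aa All.∷ S~A′ Su A′b All.∷ S~A′ Su A′c All.∷ All.[])
          (length₃ m≡) (maybe mostA) m≡ (absent (not-S Aa) (absent Sb (absent Sc nil))) m≡

      -- One edge is always present, namely v t. Any other edge at a vertex of `A` besides v either
      -- meets it or is disjoint from it.
      secondEdge : ∀ {a b} → A a ≡ true → ¬ a ≡ v → A′ b → a ~ b → ⊥
      secondEdge {a} {b} Aa a≢v (inj₂ refl) e = sharedEdges Aa (λ { refl → false-true t∉A Aa }) a≢v (λ eq → v≢t (sym eq))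
        (inj₂ refl) (inj₁ v∈A) t∉S (not-S v∈A) (absent t∉A (maybe nil)) e (~-sym v~t)
      secondEdge {a} {b} Aa a≢v (inj₁ Ab) e with b ≟ v
      ... | no  b≢v  = disjointEdges (proj₂ (inhabited {S = S ∩ E u} (≤-trans (s≤s z≤n) 2≤dS))) Aa Ab a≢v b≢v e
      ... | yes refl = sharedEdges Aa a≢v (λ { refl → false-true t∉A Aa }) v≢t
        (inj₁ v∈A) (inj₂ refl) (not-S v∈A) t∉S (maybe (absent t∉A nil)) e v~t

      B : Subset N
      B = X ∖ ⁅ t ⁆

      B-size : suc (count B) ≡ n + k
      B-size = trans (sym (count-remove Xt)) X-size

      E⊆B : ∀ {a} → A a ≡ true → ¬ a ≡ v → E a ⊆ B
      E⊆B {a} Aa a≢v z e with X z in eq | z ≟ t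
      ... | false | _        = ⊥-elim (secondEdge Aa a≢v (inj₁ (cong not eq)) e)
      ... | true  | yes refl = ⊥-elim (secondEdge Aa a≢v (inj₂ refl) e)
      ... | true  | no  _    = refl

      -- A vertex of `A` other than v has at least n + k - 1 neighbours, all in `B`, which has
      -- exactly that many vertices.
      A~B : suc N ≡ 2 * n + k + 0 → ∀ {a z} → A a ≡ true → B z ≡ true → a ~ z
      A~B size′ {a} {z} Aa Bz with a ≟ v
      ... | yes refl = X⊆ z (∧-left Bz)
      ... | no a≢v with E a z in eq
      ...   | true  = refl
      ...   | false = ⊥-elim (saturated {N} {n} {k} size′ (degree a) B-size
        (≤-trans (s≤s (count-mono λ x h → ∖⁅⁆ {S = B} (E⊆B Aa a≢v x h) λ { refl → false-true eq h })) (eq≥ (count-remove Bz))))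

      absurd : ⊥
      absurd = byCase extremal size
        where
        byCase : Extremal n k θ → suc N ≡ 2 * n + k + θ → ⊥
        byCase (inj₁ refl) size′ =
          -- A second vertex of `A` has at least n + k neighbours, all in `B`, which has one vertex
          -- fewer.
          let a , Aa , a∉ = escape {S = A} (v ∷ []) (two {n} {θ} A-size k<n 3≤k)
          in θ-zero {N} {n} {k} size′ (degree a) B-size (count-mono (E⊆B Aa (All.head a∉)))
        byCase (inj₂ (refl , a , b , n≡ , k≡)) size′ with Fin.any? (λ z → (B z Bool.≟ true) ×-dec (k ≤? count (B ∩ E z)))
        -- Removing `t` costs at most one neighbour, so every degree within `B` is exactly k - 1;
        -- this and the order n + k - 1 are odd.
        ... | no ¬p = noOddRegular E E-sym E-irr B (a + b) b (oddB {n} {k} {_} {a} {b} B-size n≡ k≡) λ z Bz →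
          oddK {k} k≡ (≤-trans (k≤dX z) (≤-trans (count-drop (X ∩ E z) t) (s≤s (count-mono λ x h →
            ∧-true (∧-true (∧-left (∧-left h)) (∧-right {(X ∩ E z) x} h)) (∧-right {X x} (∧-left h))))))
            (λ h → ¬p (z , Bz , h))
        -- `A` is complete to `B`, so each of the k neighbours of z in `B` has all of `A` as
        -- neighbours, and so has the hub z.
        ... | yes (z , Bz , h) = Bipartite.alternatingCycle E E-sym (B ∩ E z) A (λ x Px Ax → X-A x (∧-left (∧-left Px)) Ax)
          (≤-trans (s≤s z≤n) 3≤k) h (thin {n} {k} {θ} A-size n+2≤2k θ≤1 ≤-refl)
          (λ p Pp → ≤-trans k≤count-A (count-mono λ x Ax → ∧-true Ax (~-sym (A~B size′ Ax (∧-left Pp)))))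
          (noWheel z ∘ weaken λ { (inj₁ h) → ∧-right {B _} h ; (inj₂ Ax) → ~-sym (A~B size′ Ax Bz) })

    module _ {t} (Xt : X t ≡ true) where
      open NoLasso E E-sym E-irr X t using (Lasso; module Routes; module Longest; noLasso)

      module _ {q} (longest : ∀ {q′} → q < q′ → Lasso q′ → ⊥) {δ} (δ≤ : ∀ {x} → X x ≡ true → δ ≤ count (X ∩ E x))
        (dominating : count X ≤ count (X ∩ E t) + δ) (L : Lasso q) (1≤q : 1 ≤ q) (short : suc q < 2 * k)
        (detached : Longest.Detached longest δ≤ dominating L) where

        open Routes L using (y; y0; inj; inX; vertices; ∈-vertices)

        private
          Y : Subset N
          Y = elem vertices

          X-t : Subset N
          X-t = X ∖ ⁅ t ⁆

          onPath : ∀ {z} → Y z ≡ true → ¬ z ≡ t → ∃ λ j → 1 ≤ j × j ≤ q × z ≡ y j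
          onPath {z} h z≢t = go (up 0 q) (up-bounds q (+-identityʳ q)) (elem-∈ vertices h)
            where
            go : ∀ is → All (λ i → 0 ≤ i × i ≤ q) is → z ∈ map y is → ∃ λ j → 1 ≤ j × j ≤ q × z ≡ y j
            go (zero  ∷ is) _                   (here eq) = ⊥-elim (z≢t (trans eq y0))
            go (suc i ∷ is) ((_ , h) All.∷ _)  (here eq) = suc i , s≤s z≤n , h , eq
            go (i     ∷ is) (_ All.∷ hs)        (there p) = go is hs p

          skipFirst : ∀ m {f : ℕ → Fin N} → X-t (f 0) ≡ false → tally X-t (map f (up 0 m)) ≤ m
          skipFirst zero    p rewrite p = z≤n
          skipFirst (suc m) {f} p rewrite p = ≤-trans (tally≤length X-t (map f (up 1 m)))
            (eq≤ (trans (length-map f (up 1 m)) (up-length 1 m)))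

          apart : ∀ {x z} → Y x ≡ true → ¬ x ≡ t → X z ≡ true → Y z ≡ false → x ~ z → ⊥
          apart Yx x≢t Xz Yz e with j , 1≤j , j≤q , refl ← onPath Yx x≢t = detached 1≤j j≤q Xz Yz e

          sizes : count (X-t ∩ Y) + count (X-t ∖ Y) ≡ count X-t
          sizes = sym (count-split X-t Y)

          X-t-size : suc (count X-t) ≡ n + k
          X-t-size = trans (sym (count-remove Xt)) X-size

          t∉ : ∀ {S} → (X-t ∩ S) t ≡ false
          t∉ {S} = ≢true λ h → ∖⁅⁆-≢ {S = X} (∧-left h) refl

        -- No edge of X - t leaves the path, so both the path and the rest of X - t are closed under
        -- adjacency; one of them has fewer than half of n + k vertices.
        isolated : ⊥
        isolated with 2 * count (X-t ∩ Y) + 1 ≤? n + k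
        ... | yes small = Isolated.absurd Xt (X-t ∩ Y) (λ _ h → ∧-left (∧-left h)) (t∉ {Y}) small
              (λ {x} {z} Cx Xz e z≢t → ∧-true (∖⁅⁆ {S = X} Xz z≢t) (inside Cx Xz e)) {y 1}
              (∧-true (∖⁅⁆ {S = X} (inX 1≤q) (λ eq → 1+n≰n (eq≤ (inj 1≤q z≤n (trans eq (sym y0)))))) (∈-elem (∈-vertices 1≤q)))
          where
          inside : ∀ {x z} → (X-t ∩ Y) x ≡ true → X z ≡ true → x ~ z → Y z ≡ true
          inside {x} {z} Cx Xz e with Y z in eq
          ... | true  = refl
          ... | false = ⊥-elim (apart (∧-right {X-t x} Cx) (∖⁅⁆-≢ {S = X} (∧-left Cx)) Xz eq e)
        ... | no large =
              Isolated.absurd Xt (X-t ∖ Y) (λ _ h → ∧-left (∧-left h)) (t∉ {∁ Y}) (smaller {count (X-t ∩ Y)} sizes X-t-size large)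
              (λ {x} {z} Dx Xz e z≢t → ∧-true (∖⁅⁆ {S = X} Xz z≢t) (cong not (≢true λ Yz →
                apart Yz z≢t (∧-left (∧-left Dx)) (not-true (∧-right {X-t x} Dx)) (~-sym e))))
              -- The path has at most 2k - 2 vertices, fewer than the n + k - 1 of X - t, so
              -- something remains.
              (proj₂ (inhabited {S = X-t ∖ Y} (remaining {n} {k} {q = q} k<n X-t-size short
                (≤-trans (count-off X-t vertices) (+-monoˡ-≤ _ (skipFirst q {y} (≢true λ h → ∖⁅⁆-≢ {S = X} h y0)))))))

    impossible : ⊥
    impossible =
      let x , Xx = inhabited {S = X} (≤-trans (≤-trans (s≤s z≤n) 3≤k) (≤-trans (m≤n+m k n) (eq≥ X-size)))
          u , Xu , least = argmin dX X Xx
      in attach u Xu least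
      where
      fewX : count X + 2 ≤ 3 * k
      fewX = 3k-bound {n} {k} n+2≤2k X-size
      excess : Extremal n k θ → θ ≡ 1 ⊎ ¬ count X ≡ suc (2 * k)
      excess (inj₁ θ≡1) = inj₁ θ≡1
      -- n + k is even and 2k + 1 is odd.
      excess (inj₂ (_ , a , b , n≡ , k≡)) = inj₂ λ eq → even≢odd (a + suc b) k
        (trans (trans (*-distribˡ-+ 2 a (suc b)) (cong₂ _+_ (sym n≡) (sym k≡))) (trans (sym X-size) eq))
      module Dominated {t u} (Xt : X t ≡ true) (Xu : X u ≡ true) (u~t : u ~ t) (least : ∀ y → X y ≡ true → dX u ≤ dX y)
        (strong : n + k + θ ≤ dX t + dX u) where
        open NoLasso E E-sym E-irr X t using (Lasso; module Lasso; module Routes; module Longest; InX; fromPath; noLasso; vertices-size)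

        dominating : count X + θ ≤ count (X ∩ E t) + dX u
        dominating = ≤-trans (eq≤ (cong (_+ θ) X-size)) strong

        δ≤ : ∀ {x} → InX x → dX u ≤ count (X ∩ E x)
        δ≤ {x} h = least x h

        noCycle : ¬ Cycles _~_ InX (2 * k)
        noCycle = noWheel v ∘ weaken (X⊆ _)

        start : Lasso 1
        start = fromPath (stop u) (((λ { refl → false-true (E-irr u) u~t }) All.∷ All.[]) ∷ All.[] ∷ []) (Xt All.∷ Xu All.∷ All.[])

        noLongest : ∀ {q} → 1 ≤ q → Lasso q → (∀ {q′} → q < q′ → Lasso q′ → ⊥) → ⊥
        noLongest {q} 1≤q L longest = Longest.bothEnds longest δ≤ dom L 1≤q (≤-trans (≤-trans (s≤s z≤n) 3≤k) (k≤dX u)) ends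
          where
          dom : count X ≤ count (X ∩ E t) + dX u
          dom = ≤-trans (m≤m+n _ θ) dominating
          ends : (L : Lasso q) → t ~ Lasso.y L 1 → t ~ Lasso.y L q → ⊥
          ends L e₁ e₂ = noLasso longest δ≤ dominating 3≤k (k≤dX u) noCycle fewX (excess extremal) L e₁ e₂ long
            where
            long : 2 * k ≤ suc q
            long with 2 * k ≤? suc q
            ... | yes h = h
            ... | no ¬h = ≤-trans (*-monoʳ-≤ 2 (k≤dX u)) (Longest.longPath longest δ≤ dom L 1≤q e₁ e₂
                            (≤-trans (≤-trans (n≤1+n 2) 3≤k) (k≤dX u)) (isolated Xt longest δ≤ dom L 1≤q (≰⇒> ¬h)))

        -- Downward induction on the length: once all longer lassos are refuted, the given one is
        -- longest. The fuel bounds how far the length can still grow within `X`.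
        noneLonger : ∀ fuel {q} → 1 ≤ q → Lasso q → count X ≤ fuel + q → ⊥
        noneLonger fuel {q} 1≤q L h = noLongest 1≤q L (longer fuel h)
          where
          longer : ∀ fuel → count X ≤ fuel + q → ∀ {q′} → q < q′ → Lasso q′ → ⊥
          longer zero       h lt L′ = 1+n≰n (≤-trans (s≤s (≤-trans (n≤1+n q) lt)) (≤-trans (m≤m+n _ _) (≤-trans (vertices-size L′) h)))
          longer (suc fuel) h {q′} lt L′ = noneLonger fuel (≤-trans (s≤s z≤n) lt) L′ (≤-trans h (≤-trans (eq≥ (+-suc fuel q)) (+-monoʳ-≤ fuel lt)))

      attach : ∀ u → X u ≡ true → (∀ y → X y ≡ true → dX u ≤ dX y) → ⊥
      attach u Xu least with Fin.any? (λ t → (X t Bool.≟ true) ×-dec (E u t Bool.≟ true) ×-dec (n + k + θ ≤? dX t + dX u))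
      ... | yes (t , Xt , e , strong) = noneLonger (count X) ≤-refl start (m≤m+n (count X) 1)
        where open Dominated Xt Xu e least strong
      ... | no ¬p = noCrowd u (X ∩ E u) (λ _ h → h) (k≤dX u) λ {p} h → ≰⇒≥′ λ big →
        ¬p (p , ∧-left h , ∧-right {X p} h , dominates {n} {k} {θ} {dX u} {dX p} big)
        where
        ≰⇒≥′ : ∀ {a b} → (¬ a ≤ b → ⊥) → a ≤ b
        ≰⇒≥′ {a} {b} h with a ≤? b
        ... | yes p = p
        ... | no ¬p = ⊥-elim (h ¬p)

  wheel : NoWheel → ⊥
  wheel noWheel = let v , h = largeDegree
                      X , X⊆ , X-size = subset (E v) (n + k) h
                  in impossible noWheel X⊆ X-size

-- Stars and wheels as subgraphs

isYes-true : ∀ {P : Set} (d : Dec P) → ⌊ d ⌋ ≡ true → P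
isYes-true (yes p) _ = p

true-isYes : ∀ {P : Set} (d : Dec P) → P → ⌊ d ⌋ ≡ true
true-isYes (yes _) _ = refl
true-isYes (no ¬p) p = ⊥-elim (¬p p)

∨-true : ∀ {a b} → a ∨ b ≡ true → a ≡ true ⊎ b ≡ true
∨-true {true}  _ = inj₁ refl
∨-true {false} h = inj₂ h

anyVec? : ∀ {n} m {P : Vec (Fin n) m → Set} → (∀ xs → Dec (P xs)) → Dec (∃ P)
anyVec? zero    P? = map′ ([] ,_) (λ { ([] , p) → p }) (P? [])
anyVec? (suc m) P? = map′ (λ (x , xs , p) → x ∷ xs , p) (λ { (x ∷ xs , p) → x , xs , p }) (any? λ x → anyVec? m λ xs → P? (x ∷ xs))

-- This licenses the proof by contradiction: from the impossibility of having no wheel an actual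
-- embedding is recovered.
contains? : ∀ {n m} (G : Graph n) (H : Graph m) → Dec (Contains G H)
contains? {n} {m} G H = map′
  (λ (xs , inj , hom) → Vec.lookup xs , (λ {i} {j} → inj i j) , hom)
  (λ (f , inj , hom) → Vec.tabulate f ,
    (λ i j eq → inj (trans (sym (lookup∘tabulate f i)) (trans eq (lookup∘tabulate f j)))) ,
    (λ i j h → trans (cong₂ G (lookup∘tabulate f i) (lookup∘tabulate f j)) (hom i j h)))
  (anyVec? m λ xs → all? (λ i → all? λ j → (Vec.lookup xs i ≟ Vec.lookup xs j) →-dec (i ≟ j)) ×-dec
                    all? (λ i → all? λ j → (H i j Bool.≟ true) →-dec (G (Vec.lookup xs i) (Vec.lookup xs j) Bool.≟ true)))

lookup-at : ∀ {A : Set} (t : A) xs i → List.lookup xs i ≡ at t xs (suc (toℕ i))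
lookup-at t (x ∷ xs) zero    = refl
lookup-at t (x ∷ xs) (suc i) = lookup-at x xs i

lookup-injective : ∀ {A : Set} {xs : List A} → Unique xs → ∀ {i j} → List.lookup xs i ≡ List.lookup xs j → i ≡ j
lookup-injective (_ ∷ _)  {zero}  {zero}  _  = refl
lookup-injective {xs = x ∷ xs} (x∉ ∷ _) {zero}  {suc j} eq = ⊥-elim (All.lookup x∉ (∈-lookup {xs = xs} j) eq)
lookup-injective {xs = x ∷ xs} (x∉ ∷ _) {suc i} {zero}  eq = ⊥-elim (All.lookup x∉ (∈-lookup {xs = xs} i) (sym eq))
lookup-injective (_ ∷ u)  {suc i} {suc j} eq = cong suc (lookup-injective u eq)

module _ {N} (G : Graph N) (simple : IsSimple G) where

  private
    G-sym = proj₁ simple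
    G-irr = proj₂ simple

  complement-sym : ∀ i j → complement G i j ≡ complement G j i
  complement-sym i j = cong₂ (λ a b → not a ∧ not b) (⁅⁆-sym j i) (G-sym i j)

  complement-irr : ∀ i → complement G i i ≡ false
  complement-irr i = cong (λ a → not a ∧ not (G i i)) (⁅⁆-refl i)

  starFromDegree : ∀ {n x} → n ≤ count (G x) → Contains G (Star n)
  starFromDegree {n} {x} h with xs , u , a , refl ← sublist (G x) n h = f , inj , hom
    where
    f : Fin (suc (length xs)) → Fin N
    f zero    = x
    f (suc i) = List.lookup xs i
    leaf : ∀ i → G x (List.lookup xs i) ≡ true
    leaf i = All.lookup a (∈-lookup {xs = xs} i)
    inj : ∀ {i j} → f i ≡ f j → i ≡ j
    inj {zero}  {zero}  _  = refl
    inj {zero}  {suc j} eq = ⊥-elim (false-true (G-irr x) (subst (λ z → G x z ≡ true) (sym eq) (leaf j)))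
    inj {suc i} {zero}  eq = ⊥-elim (false-true (G-irr x) (subst (λ z → G x z ≡ true) eq (leaf i)))
    inj {suc i} {suc j} eq = cong suc (lookup-injective u eq)
    hom : ∀ i j → Star (length xs) i j ≡ true → G (f i) (f j) ≡ true
    hom zero    (suc j) _ = leaf j
    hom (suc i) zero    _ = trans (G-sym (List.lookup xs i) x) (leaf i)

  complement-degree : ∀ {n} x → count (G x) < n → N ≤ count (complement G x) + n
  complement-degree {n} x h = begin
    N                                                   ≡⟨ count-∁ (G x) ⟨
    count (G x) + count (∁ (G x))                       ≤⟨ +-monoʳ-≤ (count (G x)) (count-drop (∁ (G x)) x) ⟩
    count (G x) + suc (count (∁ (G x) ∖ ⁅ x ⁆))         ≡⟨ +-suc (count (G x)) _ ⟩
    suc (count (G x)) + count (∁ (G x) ∖ ⁅ x ⁆)         ≤⟨ +-mono-≤ h (count-mono λ y p →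
      ∧-true (trans (cong not (⁅⁆-sym y x)) (∧-right {not (G x y)} p)) (∧-left p)) ⟩
    n + count (complement G x)                          ≡⟨ +-comm n _ ⟩
    count (complement G x) + n                          ∎
    where open ≤-Reasoning

  -- The modulus is the length, written as a successor to match `Cycle`. The remainder differs from
  -- the successor only at the last vertex, where the closing edge is used.
  rim-adjacent : ∀ {E : Graph N} {xs} → Closed (λ i j → E i j ≡ true) xs → ∀ i j → toℕ j ≡ suc (toℕ i) % suc (pred (length xs)) →
                 E (List.lookup xs i) (List.lookup xs j) ≡ true
  rim-adjacent {E} {xs} (a , b , π , e) i j eq = go xs π i j eq
    where
    go : ∀ xs → Path (λ i j → E i j ≡ true) a xs b → ∀ i j → toℕ j ≡ suc (toℕ i) % suc (pred (length xs)) →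
         E (List.lookup xs i) (List.lookup xs j) ≡ true
    go (y ∷ ys) π i j eq with suc (toℕ i) <? suc (length ys)
    ... | yes lt = trans (cong₂ E (lookup-at a (y ∷ ys) i) (trans (lookup-at a (y ∷ ys) j) (cong (at a (y ∷ ys) ∘ suc) (trans eq (m<n⇒m%n≡m lt)))))
                     (at-adj a π (s≤s z≤n) lt)
    ... | no ¬lt = trans (cong₂ E (trans (lookup-at a (y ∷ ys) i) (trans (cong (at a (y ∷ ys)) i≡) (at-last a π)))
                     (trans (lookup-at a (y ∷ ys) j) (trans (cong (at a (y ∷ ys) ∘ suc) (trans eq (trans (cong (_% suc (length ys)) i≡) (n%n≡0 (suc (length ys)))))) (sym (head-≡ π))))) e
      where
      i≡ : suc (toℕ i) ≡ suc (length ys)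
      i≡ = ≤-antisym (toℕ<n i) (≮⇒≥ ¬lt)

  wheelFromCycle : ∀ {u m} → Cycles (λ i j → complement G i j ≡ true) (λ i → complement G u i ≡ true) m → Contains (complement G) (Wheel m)
  wheelFromCycle ([] , (_ , _ , () , _) , _)
  wheelFromCycle {u} (xs@(_ ∷ _) , closed , unique , spokes , refl) = f , inj , hom
    where
    E = complement G
    f : Fin (suc (length xs)) → Fin N
    f zero    = u
    f (suc i) = List.lookup xs i
    spoke : ∀ i → E u (List.lookup xs i) ≡ true
    spoke i = All.lookup spokes (∈-lookup {xs = xs} i)
    inj : ∀ {i j} → f i ≡ f j → i ≡ j
    inj {zero}  {zero}  _  = refl
    inj {zero}  {suc j} eq = ⊥-elim (false-true (complement-irr u) (subst (λ z → E u z ≡ true) (sym eq) (spoke j)))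
    inj {suc i} {zero}  eq = ⊥-elim (false-true (complement-irr u) (subst (λ z → E u z ≡ true) eq (spoke i)))
    inj {suc i} {suc j} eq = cong suc (lookup-injective unique eq)
    hom : ∀ i j → Wheel (length xs) i j ≡ true → E (f i) (f j) ≡ true
    hom zero    (suc j) _ = spoke j
    hom (suc i) zero    _ = trans (complement-sym (List.lookup xs i) u) (spoke i)
    hom (suc i) (suc j) h with ∨-true h
    ... | inj₁ p = rim-adjacent closed i j (isYes-true (_ ≟ℕ _) p)
    ... | inj₂ p = trans (complement-sym (List.lookup xs i) (List.lookup xs j))
                     (rim-adjacent closed j i (isYes-true (_ ≟ℕ _) p))

upperBound : ∀ {n k θ N} → n + 2 ≤ 2 * k → k < n → 3 ≤ k → Extremal n k θ → suc N ≡ 2 * n + k + θ → Arrows N (Star n) (Wheel (2 * k))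
upperBound {n} {k} {θ} {N} n+2≤2k k<n 3≤k extremal size G simple with any? (λ x → n ≤? count (G x))
... | yes (x , h) = inj₁ (starFromDegree G simple h)
... | no ¬star with contains? (complement G) (Wheel (2 * k))
...   | yes w = inj₂ w
...   | no ¬w = ⊥-elim (Upper.wheel (complement G) (complement-sym G simple) (complement-irr G simple) size
                  (λ x → complement-degree G simple x (≰⇒> λ h → ¬star (x , h))) n+2≤2k k<n 3≤k extremal (λ u c → ¬w (wheelFromCycle G simple c)))

-- The lower bound

opaque
  unfolding count

  count-splitAt : ∀ m {n} (S : Fin m ⊎ Fin n → Bool) → count (S ∘ splitAt m) ≡ count (S ∘ inj₁) + count (S ∘ inj₂)
  count-splitAt zero    S = refl
  count-splitAt (suc m) S = trans (cong (b2n (S (inj₁ zero)) +_) (count-splitAt m (S ∘ Sum.map₁ suc))) (sym (+-assoc (b2n (S (inj₁ zero))) _ _))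

  private
    exchange : ∀ x y z {c d} → c + x ≡ d + z → (x + c) + y ≡ (y + d) + z
    exchange x y z {c} {d} h = lin≡ h (solve (c ⨾ d ⨾ x ⨾ y ⨾ z ⨾ ε))

  -- Sliding a window by one position loses the value at 0 and gains the value at c; for a function
  -- of period c these agree.
  count-slide : ∀ c (h : ℕ → Bool) → count {c} (λ j → h (suc (toℕ j))) + b2n (h 0) ≡ count {c} (λ j → h (toℕ j)) + b2n (h c)
  count-slide zero    h = refl
  count-slide (suc c) h = exchange (b2n (h 1)) (b2n (h 0)) (b2n (h (suc c))) (count-slide c (h ∘ suc))

  count-initial : ∀ c d → d ≤ c → count {c} (λ j → toℕ j <ᵇ d) ≡ d
  count-initial zero    zero    _       = refl
  count-initial (suc c) zero    _       = count-initial c zero z≤n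
  count-initial (suc c) (suc d) (s≤s h) = cong suc (count-initial c d h)

count-rotate : ∀ c (h : ℕ → Bool) → (∀ m → h (m + c) ≡ h m) → ∀ a → count {c} (λ j → h (a + toℕ j)) ≡ count {c} (λ j → h (toℕ j))
count-rotate c h periodic zero    = refl
count-rotate c h periodic (suc a) = trans (+-cancelʳ-≡ (b2n (h (a + 0))) _ _ (begin
  count {c} (λ j → h (suc a + toℕ j)) + b2n (h (a + 0))    ≡⟨ cong (_+ b2n (h (a + 0))) (count-cong λ j → cong h (sym (+-suc a (toℕ j)))) ⟩
  count {c} (λ j → h (a + suc (toℕ j))) + b2n (h (a + 0))  ≡⟨ count-slide c (h ∘ (a +_)) ⟩
  count {c} (λ j → h (a + toℕ j)) + b2n (h (a + c))        ≡⟨ cong (λ b → count {c} (λ j → h (a + toℕ j)) + b2n b) (trans (periodic a) (cong h (sym (+-identityʳ a)))) ⟩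
  count {c} (λ j → h (a + toℕ j)) + b2n (h (a + 0))        ∎)) (count-rotate c h periodic a)
  where open ≡-Reasoning

-- Regular graphs and the extremal graph

record Regular (b d : ℕ) : Set where
  field
    adjacent   : Fin b → Fin b → Bool
    symmetric  : ∀ x y → adjacent x y ≡ adjacent y x
    loopless   : ∀ x → adjacent x x ≡ false
    degree     : ∀ x → count (adjacent x) ≡ d

edgeless : ∀ b → Regular b 0
edgeless b = record { adjacent = λ _ _ → false ; symmetric = λ _ _ → refl ; loopless = λ _ → refl ; degree = λ _ → count≡0 λ _ → refl }

-- A bipartite graph between two copies of the residues modulo c, with i and j adjacent when i + j
-- reduces to a value below d. Using the sum rather than the difference makes the relation
-- symmetric.
circulant : ∀ c {d} → d ≤ c → Regular (c + c) d
circulant zero _ = record { adjacent = λ () ; symmetric = λ () ; loopless = λ () ; degree = λ () }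
circulant c@(suc c-1) {d} d≤c = record
  { adjacent  = λ x y → across (splitAt c x) (splitAt c y)
  ; symmetric = λ x y → across-sym (splitAt c x) (splitAt c y)
  ; loopless  = λ x → across-irr (splitAt c x)
  ; degree    = λ x → across-degree (splitAt c x)
  }
  where
  h : ℕ → Bool
  h m = (m % c) <ᵇ d
  across : Fin c ⊎ Fin c → Fin c ⊎ Fin c → Bool
  across (inj₁ i) (inj₁ j) = false
  across (inj₁ i) (inj₂ j) = h (toℕ i + toℕ j)
  across (inj₂ i) (inj₁ j) = h (toℕ i + toℕ j)
  across (inj₂ i) (inj₂ j) = false
  across-sym : ∀ x y → across x y ≡ across y x
  across-sym (inj₁ i) (inj₁ j) = refl
  across-sym (inj₁ i) (inj₂ j) = cong h (+-comm (toℕ i) (toℕ j))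
  across-sym (inj₂ i) (inj₁ j) = cong h (+-comm (toℕ i) (toℕ j))
  across-sym (inj₂ i) (inj₂ j) = refl
  across-irr : ∀ x → across x x ≡ false
  across-irr (inj₁ _) = refl
  across-irr (inj₂ _) = refl
  side : ∀ i → count {c} (λ j → h (i + toℕ j)) ≡ d
  side i = trans (count-rotate c h (λ m → cong (_<ᵇ d) ([m+n]%n≡m%n m c)) i)
    (trans (count-cong {c} λ j → cong (_<ᵇ d) (m<n⇒m%n≡m (toℕ<n j))) (count-initial c d d≤c))
  empty : count {c} (const false) ≡ 0
  empty = count≡0 λ _ → refl
  across-degree : ∀ x → count (across x ∘ splitAt c) ≡ d
  across-degree (inj₁ i) = trans (count-splitAt c (across (inj₁ i))) (cong₂ _+_ empty (side (toℕ i)))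
  across-degree (inj₂ i) = trans (count-splitAt c (across (inj₂ i))) (trans (cong₂ _+_ (side (toℕ i)) empty) (+-identityʳ d))

starCentre : ∀ {N n} (G : Graph N) → Contains G (Star n) → ∃ λ x → n ≤ count (G x)
starCentre {n = n} G (f , inj , hom) = f zero , subst (_≤ count (G (f zero))) (length-tabulate (f ∘ suc))
  (length≤count (Unique.tabulate⁺ (λ eq → Fin.suc-injective (inj eq))) (All.tabulate⁺ λ i → hom zero (suc i) refl))

tabulatePath : ∀ {A : Set} {R : A → A → Set} m (g : Fin (suc m) → A) → (∀ i → R (g (inject₁ i)) (g (suc i))) →
               Path R (g zero) (tabulate g) (g (fromℕ m))
tabulatePath zero    g h = stop _
tabulatePath (suc m) g h = h zero ∷ tabulatePath m (g ∘ suc) (h ∘ suc)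

∨-left : ∀ {a b} → a ≡ true → a ∨ b ≡ true
∨-left refl = refl

rim : ∀ {N m} (G : Graph N) → Contains G (Wheel (suc m)) →
      ∃ λ u → ∃ λ xs → (∃ λ a → ∃ λ b → Path (λ x y → G x y ≡ true) a xs b) × Unique xs × All (λ x → G u x ≡ true) xs × length xs ≡ suc m
rim {m = m} G (f , inj , hom) = f zero , tabulate (f ∘ suc) ,
  (_ , _ , tabulatePath m (f ∘ suc) λ i → hom (suc (inject₁ i)) (suc (suc i)) (∨-left (true-isYes (_ ≟ℕ _) (consecutive i)))) ,
  Unique.tabulate⁺ (λ eq → Fin.suc-injective (inj eq)) ,
  All.tabulate⁺ (λ i → hom zero (suc i) refl) , length-tabulate (f ∘ suc)
  where
  consecutive : ∀ i → toℕ (suc i) ≡ suc (toℕ (inject₁ i)) % suc m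
  consecutive i = sym (trans (cong (λ z → suc z % suc m) (toℕ-inject₁ i)) (m<n⇒m%n≡m (s≤s (toℕ<n i))))

private
  cover-sum : ∀ {a b} j {m} → a ≡ true ⊎ b ≡ true → j ≤ m → suc j ≤ b2n a + (b2n b + m)
  cover-sum {true}  {b} j {m} _ h = s≤s (≤-trans h (m≤n+m m (b2n b)))
  cover-sum {false} {true} j _ h = s≤s h
  cover-sum {false} {false} j (inj₁ ()) h
  cover-sum {false} {false} j (inj₂ ()) h

-- The path splits into j disjoint edges, and each has an end in `S`.
alternate : ∀ {N} {R : Fin N → Fin N → Set} (S : Subset N) → (∀ {x y} → R x y → S x ≡ true ⊎ S y ≡ true) →
            ∀ j {a b xs} → Path R a xs b → length xs ≡ j * 2 → j ≤ tally S xs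
alternate S cover zero    π eq = z≤n
alternate S cover (suc j)       (e ∷ e′ ∷ π) eq = cover-sum j (cover e) (alternate S cover j π (suc-injective (suc-injective eq)))
alternate S cover (suc zero)    (e ∷ stop b) _  = cover-sum 0 (cover e) z≤n
alternate S cover (suc (suc j)) (e ∷ stop b) ()

pathAll : ∀ {A : Set} {R : A → A → Set} {P Q : A → Set} → (∀ {x y} → R x y → P x → Q y → P y) →
          ∀ {a b xs} → Path R a xs b → P a → All Q xs → All P xs
pathAll h (stop _) Pa _            = Pa All.∷ All.[]
pathAll h (e ∷ π)  Pa (_ All.∷ Qs) = Pa All.∷ pathAll h π (h e Pa (head-All π Qs)) Qs

-- An induced subgraph of a counterexample is again one, so a single graph settles all smaller
-- orders.
restrict : ∀ {s N a b} {G₁ : Graph a} {G₂ : Graph b} → s ≤ N → (G : Graph N) → IsSimple G →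
           ¬ Contains G G₁ → ¬ Contains (complement G) G₂ → ¬ Arrows s G₁ G₂
restrict {s} {N} s≤N G (sym , irr) no₁ no₂ arrows = result (arrows G′ ((λ i j → sym (ι i) (ι j)) , λ i → irr (ι i)))
  where
  ι : Fin s → Fin N
  ι i = inject≤ i s≤N
  ι-inj : ∀ {i j} → ι i ≡ ι j → i ≡ j
  ι-inj {i} {j} = inject≤-injective s≤N s≤N i j
  G′ : Graph s
  G′ i j = G (ι i) (ι j)
  co : ∀ i j → complement G′ i j ≡ true → complement G (ι i) (ι j) ≡ true
  co i j h = ∧-true (cong not (⁅⁆-≢ λ eq → false-true (not-true (∧-left {not (⁅ j ⁆ i)} h)) (trans (cong ⁅ j ⁆ (ι-inj eq)) (⁅⁆-refl j))))
                    (∧-right {not (⁅ j ⁆ i)} h)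
  result : Contains G′ _ ⊎ Contains (complement G′) _ → ⊥
  result (inj₁ (f , inj , hom)) = no₁ (ι ∘ f , inj ∘ ι-inj , hom)
  result (inj₂ (f , inj , hom)) = no₂ (ι ∘ f , inj ∘ ι-inj , λ i j e → co (f i) (f j) (hom i j e))

-- The first two inequalities keep degrees in the join below n. The next two leave each of its
-- vertices at most k non-neighbours in the join, itself included. The last two make either side too
-- small for a rim.
module Construction {n k b₁ b₂ d₁ d₂} (R₁ : Regular b₁ d₁) (R₂ : Regular b₂ d₂)
  (star₁ : d₁ + b₂ < n) (star₂ : d₂ + b₁ < n) (half₁ : b₁ ≤ k + d₁) (half₂ : b₂ ≤ k + d₂) (b₁<2k : b₁ < 2 * k) (b₂<2k : b₂ < 2 * k) where
  open Regular

  V : Set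
  V = Fin n ⊎ Fin b₁ ⊎ Fin b₂

  N : ℕ
  N = n + (b₁ + b₂)

  place : Fin N → V
  place = Sum.map₂ (splitAt b₁) ∘ splitAt n

  adj : V → V → Bool
  adj (inj₁ _) (inj₁ _) = true
  adj (inj₁ _) (inj₂ _) = false
  adj (inj₂ _) (inj₁ _) = false
  adj (inj₂ (inj₁ x)) (inj₂ (inj₁ y)) = adjacent R₁ x y
  adj (inj₂ (inj₁ _)) (inj₂ (inj₂ _)) = true
  adj (inj₂ (inj₂ _)) (inj₂ (inj₁ _)) = true
  adj (inj₂ (inj₂ x)) (inj₂ (inj₂ y)) = adjacent R₂ x y

  adj-sym : ∀ v w → adj v w ≡ adj w v
  adj-sym (inj₁ _) (inj₁ _) = refl
  adj-sym (inj₁ _) (inj₂ _) = refl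
  adj-sym (inj₂ _) (inj₁ _) = refl
  adj-sym (inj₂ (inj₁ x)) (inj₂ (inj₁ y)) = symmetric R₁ x y
  adj-sym (inj₂ (inj₁ _)) (inj₂ (inj₂ _)) = refl
  adj-sym (inj₂ (inj₂ _)) (inj₂ (inj₁ _)) = refl
  adj-sym (inj₂ (inj₂ x)) (inj₂ (inj₂ y)) = symmetric R₂ x y

  G : Graph N
  G i j = not (⁅ j ⁆ i) ∧ adj (place i) (place j)

  count-place : ∀ S → count (S ∘ place) ≡ count (S ∘ inj₁) + (count (S ∘ inj₂ ∘ inj₁) + count (S ∘ inj₂ ∘ inj₂))
  count-place S = trans (count-splitAt n (S ∘ Sum.map₂ (splitAt b₁))) (cong (count (S ∘ inj₁) +_) (count-splitAt b₁ (S ∘ inj₂)))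

  inA inB₁ inB₂ inB : V → Bool
  inA  (inj₁ _)        = true
  inA  (inj₂ _)        = false
  inB₁ (inj₁ _)        = false
  inB₁ (inj₂ (inj₁ _)) = true
  inB₁ (inj₂ (inj₂ _)) = false
  inB₂ (inj₁ _)        = false
  inB₂ (inj₂ (inj₁ _)) = false
  inB₂ (inj₂ (inj₂ _)) = true
  inB  v               = not (inA v)

  private
    none : ∀ {m} → count {m} (const false) ≡ 0
    none = count≡0 λ _ → refl

    sizeA : count (inA ∘ place) ≡ n
    sizeA = trans (count-place inA) (trans (cong₂ _+_ count-full (cong₂ _+_ none none)) (+-identityʳ n))

    sizeB₁ : count (inB₁ ∘ place) ≡ b₁
    sizeB₁ = trans (count-place inB₁) (trans (cong₂ _+_ none (cong₂ _+_ count-full none)) (+-identityʳ b₁))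

    sizeB₂ : count (inB₂ ∘ place) ≡ b₂
    sizeB₂ = trans (count-place inB₂) (cong₂ _+_ none (cong₂ _+_ none count-full))

    degreeB : ∀ v → inA v ≡ false → count (adj v ∘ place) < n
    degreeB v@(inj₂ (inj₁ x)) _ = ≤-trans (s≤s (eq≤ (trans (count-place (adj v)) (cong₂ _+_ none (cong₂ _+_ (degree R₁ x) count-full))))) star₁
    degreeB v@(inj₂ (inj₂ x)) _ = ≤-trans (s≤s (eq≤ (trans (count-place (adj v)) (trans (cong₂ _+_ none (cong₂ _+_ count-full (degree R₂ x))) (+-comm b₁ d₂))))) star₂

    co-degree : ∀ {b d} (R : Regular b d) → b ≤ k + d → ∀ x → count (λ y → not (adjacent R x y) ∧ true) ≤ k
    co-degree {b} {d} R b≤ x = +-cancelˡ-≤ d _ _ (≤-trans (eq≤ (trans (cong₂ _+_ (sym (degree R x)) (count-cong λ y → ∧-identityʳ (not (adjacent R x y))))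
      (count-∁ (adjacent R x)))) (≤-trans b≤ (eq≤ (+-comm k d))))

    co-degreeB : ∀ v → inA v ≡ false → count ((λ w → not (adj v w) ∧ inB w) ∘ place) ≤ k
    co-degreeB v@(inj₂ (inj₁ x)) _ = ≤-trans (eq≤ (trans (count-place (λ w → not (adj v w) ∧ inB w)) (trans (cong₂ _+_ none (cong₂ _+_ refl none)) (+-identityʳ _)))) (co-degree R₁ half₁ x)
    co-degreeB v@(inj₂ (inj₂ x)) _ = ≤-trans (eq≤ (trans (count-place (λ w → not (adj v w) ∧ inB w)) (cong₂ _+_ none (cong₂ _+_ none refl)))) (co-degree R₂ half₂ x)

    adj-irrB : ∀ v → inA v ≡ false → adj v v ≡ false
    adj-irrB (inj₂ (inj₁ x)) _ = loopless R₁ x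
    adj-irrB (inj₂ (inj₂ x)) _ = loopless R₂ x

    fromA : ∀ v w → inA v ≡ true → adj v w ≡ true → inA w ≡ true
    fromA (inj₁ _) (inj₁ _) _ _ = refl

    fromA′ : ∀ v w → inA v ≡ true → adj v w ≡ false → inB₁ w ≡ true ⊎ inB₂ w ≡ true
    fromA′ (inj₁ _) (inj₂ (inj₁ _)) _ _ = inj₁ refl
    fromA′ (inj₁ _) (inj₂ (inj₂ _)) _ _ = inj₂ refl

    fromB : ∀ v w → adj v w ≡ false → inB v ≡ true ⊎ inB w ≡ true
    fromB (inj₁ _) (inj₂ _) _ = inj₂ refl
    fromB (inj₂ _) w        _ = inj₁ refl

    stay₁ : ∀ v w → adj v w ≡ false → inB₁ v ≡ true → inB₁ w ≡ true ⊎ inB₂ w ≡ true → inB₁ w ≡ true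
    stay₁ (inj₂ (inj₁ _)) (inj₂ (inj₁ _)) _ _ _ = refl
    stay₁ (inj₂ (inj₁ _)) (inj₁ _) _ _ (inj₁ ())
    stay₁ (inj₂ (inj₁ _)) (inj₁ _) _ _ (inj₂ ())

    stay₂ : ∀ v w → adj v w ≡ false → inB₂ v ≡ true → inB₁ w ≡ true ⊎ inB₂ w ≡ true → inB₂ w ≡ true
    stay₂ (inj₂ (inj₂ _)) (inj₂ (inj₂ _)) _ _ _ = refl
    stay₂ (inj₂ (inj₂ _)) (inj₁ _) _ _ (inj₁ ())
    stay₂ (inj₂ (inj₂ _)) (inj₁ _) _ _ (inj₂ ())

    distinct : ∀ {i j} → complement G i j ≡ true → ¬ i ≡ j
    distinct {i} {j} h refl = false-true (not-true (∧-left {not (⁅ j ⁆ i)} h)) (⁅⁆-refl i)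

    nonadjacent : ∀ {i j} → complement G i j ≡ true → adj (place i) (place j) ≡ false
    nonadjacent {i} {j} h = go (∧-left {not (⁅ j ⁆ i)} h) (∧-right {not (⁅ j ⁆ i)} h)
      where
      go : ∀ {a b} → a ≡ true → not (a ∧ b) ≡ true → b ≡ false
      go refl = not-true

  simple : IsSimple G
  simple = (λ i j → cong₂ (λ a b → not a ∧ b) (⁅⁆-sym j i) (adj-sym (place i) (place j))) ,
           (λ i → cong (λ a → not a ∧ adj (place i) (place i)) (⁅⁆-refl i))

  noStar : ¬ Contains G (Star n)
  noStar c with x , n≤ ← starCentre G c = byPart (inA (place x)) refl
    where
    byPart : ∀ b → inA (place x) ≡ b → ⊥
    byPart false eq = 1+n≰n (≤-trans (s≤s n≤) (≤-trans (s≤s (count-mono λ y h → ∧-right {not (⁅ y ⁆ x)} h)) (degreeB (place x) eq)))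
    byPart true  eq = 1+n≰n (≤-trans (s≤s n≤) (≤-trans (s≤s (count-mono λ y h →
      ∖⁅⁆ {S = inA ∘ place} (fromA (place x) (place y) eq (∧-right {not (⁅ y ⁆ x)} h))
        λ { refl → false-true (not-true (∧-left {not (⁅ y ⁆ x)} h)) (⁅⁆-refl x) }))
      (eq≤ (trans (sym (count-remove {S = inA ∘ place} eq)) sizeA))))

  -- In the complement K_n becomes independent. With the hub in the join, at least k of the 2k rim
  -- vertices lie in the join, but the hub has at most k - 1 non-neighbours there besides itself.
  -- With the hub in K_n, the rim lies in the join and, being connected in the complement, on one
  -- side of it.
  noWheel : ∀ {m} → 2 * k ≡ suc m → ¬ Contains (complement G) (Wheel (suc m))
  noWheel {m} 2k≡ c with u , xs , (a , b , π) , unique , spokes , len ← rim (complement G) c = byPart (inA (place u)) refl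
    where
    byPart : ∀ b → inA (place u) ≡ b → ⊥
    byPart false eq = 1+n≰n (≤-trans (s≤s (alternate S (λ {x} {y} e → fromB (place x) (place y) (nonadjacent e)) k π (trans len (trans (sym 2k≡) (*-comm 2 k)))))
      (≤-trans (s≤s (≤-trans (eq≤ (tally-cong xs (All.map (λ {x} h → cong (_∧ S x) (sym h)) spokes))) (tally≤count unique)))
        (≤-trans (s≤s (count-mono λ z h → ∖⁅⁆ {S = T} (∧-true (cong not (nonadjacent (∧-left h))) (∧-right {complement G u z} h)) λ eq → distinct (∧-left h) (sym eq)))
          (≤-trans (eq≥ (count-remove {S = T} (∧-true (cong not (adj-irrB (place u) eq)) (cong not eq)))) (co-degreeB (place u) eq)))))
      where
      S T : Subset N
      S = inB ∘ place
      T z = not (adj (place u) (place z)) ∧ inB (place z)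
    byPart true eq = sides (head-All π B-spokes)
      where
      B-spokes : All (λ x → inB₁ (place x) ≡ true ⊎ inB₂ (place x) ≡ true) xs
      B-spokes = All.map (λ {x} h → fromA′ (place u) (place x) eq (nonadjacent h)) spokes
      tooMany : ∀ {S : Subset N} {b} → count S ≡ b → b < 2 * k → All (λ x → S x ≡ true) xs → ⊥
      tooMany {b = b} size b< all = 1+n≰n (≤-trans b< (≤-trans (eq≤ (trans 2k≡ (sym len))) (≤-trans (length≤count unique all) (eq≤ size))))
      sides : inB₁ (place a) ≡ true ⊎ inB₂ (place a) ≡ true → ⊥
      sides (inj₁ h) = tooMany sizeB₁ b₁<2k (pathAll (λ {x} {y} e → stay₁ (place x) (place y) (nonadjacent e)) π h B-spokes)
      sides (inj₂ h) = tooMany sizeB₂ b₂<2k (pathAll (λ {x} {y} e → stay₂ (place x) (place y) (nonadjacent e)) π h B-spokes)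

  notArrows : 3 ≤ k → ∀ {s} → s ≤ N → ¬ Arrows s (Star n) (Wheel (2 * k))
  notArrows 3≤k s≤N with m , m≡ ← m≤n⇒∃[o]m+o≡n (≤-trans (≤-trans (s≤s z≤n) 3≤k) (m≤m+n k (k + 0))) =
    restrict s≤N G simple noStar (subst (λ m → ¬ Contains (complement G) (Wheel m)) m≡ (noWheel (sym m≡)))

-- Parities, and the orders and degrees for the construction

even-% : ∀ e → 2 * e % 2 ≡ 0
even-% e = trans (cong (_% 2) (*-comm 2 e)) (m*n%n≡0 e 2)

odd-% : ∀ e → ¬ suc (2 * e) % 2 ≡ 0
odd-% e h with trans (sym (trans (cong (λ z → suc z % 2) (*-comm 2 e)) ([m+kn]%n≡m%n 1 e 2))) h
... | ()

private
  k<n′ : ∀ n k {z} → n + 2 ≤ 2 * k → 2 * k ≤ z → z + 2 ≡ 2 * n → k < n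
  k<n′ n k {z} h₁ h₂ h₃ = linᵍ 1 1 (h₂ ⊹ eq≤ h₃) (solve (k ⨾ n ⨾ z ⨾ ε))
  3≤k′ : ∀ n k → n + 2 ≤ 2 * k → k < n → 3 ≤ k
  3≤k′ n k h₁ h₂ = lin 0 (h₁ ⊹ h₂) (solve (k ⨾ n ⨾ ε))

k<n : ∀ n k → n + 2 ≤ 2 * k → 2 * k ≤ 2 * n ∸ 2 → k < n
k<n zero    k h₁ h₂ = ⊥-elim (n≮0 (≤-trans h₁ h₂))
k<n (suc n) k h₁ h₂ = k<n′ (suc n) k h₁ h₂ (m∸n+n≡m (≤-trans (s≤s (s≤s z≤n)) (eq≥ (*-suc 2 n))))

private
  even≤even : ∀ a e → 2 * e < 2 * suc a → 2 * e ≤ 2 * a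
  even≤even a e h = *-monoʳ-≤ 2 (≤-pred (*-cancelˡ-< 2 e (suc a) h))
  d≤a : ∀ n k a d → n + 2 ≤ 2 * k → 2 * a < n → k + d ≡ 2 * a → d ≤ a
  d≤a n k a d h₁ h₂ h₃ = linᵍ 1 4 (h₁ ⊹ h₂ ⊹ 2 ⊠ eq≤ h₃) (solve (a ⨾ d ⨾ k ⨾ n ⨾ ε))
  a+a<2k : ∀ n k a → n + 2 ≤ 2 * k → 2 * a < n → a + a < 2 * k
  a+a<2k n k a h₁ h₂ = lin 2 (h₁ ⊹ h₂) (solve (a ⨾ k ⨾ n ⨾ ε))
  k<2k : ∀ k → 3 ≤ k → k < 2 * k
  k<2k k h = linᵍ 2 (2 + 2 * k) h (solve (k ⨾ ε))
  d+k<n : ∀ n k a d → 2 * a < n → k + d ≡ 2 * a → d + k < n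
  d+k<n n k a d h₁ h₂ = lin 0 (h₁ ⊹ eq≤ h₂) (solve (a ⨾ d ⨾ k ⨾ n ⨾ ε))
  a+a<n : ∀ n a → 2 * a < n → a + a < n
  a+a<n n a h = lin 0 h (solve (a ⨾ n ⨾ ε))
  a+a≤k+d : ∀ k a d → k + d ≡ 2 * a → a + a ≤ k + d
  a+a≤k+d k a d h = lin 0 (eq≥ h) (solve (a ⨾ d ⨾ k ⨾ ε))
  order₁ : ∀ n k a s → n ≡ 2 * suc a → s < 2 * n + k ∸ 1 → suc (2 * n + k ∸ 1) ≡ 2 * n + k → s ≤ n + (k + (a + a))
  order₁ n k a s h₁ h₂ h₃ = lin 0 (eq≤ h₁ ⊹ h₂ ⊹ eq≤ h₃) (((∀ b a k n s → n + (k + (a + a)) + (n + (suc s + (suc b))) ≡ s + (2 * suc a + (b + (2 * n + k))) + 0) ∋ solve-∀) (2 * n + k ∸ 1) a k n s)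
  order₂ : ∀ n k a s → n ≡ suc (2 * a) → s < 2 * n + k → s ≤ n + (k + (a + a))
  order₂ n k a s h₁ h₂ = lin 0 (eq≤ h₁ ⊹ h₂) (solve (a ⨾ k ⨾ n ⨾ s ⨾ ε))
  order₃ : ∀ n k s → n ≡ suc k → s < 2 * n + k → s ≤ n + (k + k)
  order₃ n k s h₁ h₂ = lin 0 (eq≤ h₁ ⊹ h₂) (solve (k ⨾ n ⨾ s ⨾ ε))
  order₄ : ∀ n k a e s → n ≡ 2 * suc a → k ≡ suc (2 * e) → s < 2 * n + k → s ≤ n + ((suc e + suc e) + (a + a))
  order₄ n k a e s h₁ h₂ h₃ = lin 0 (eq≤ h₁ ⊹ eq≤ h₂ ⊹ h₃) (solve (a ⨾ e ⨾ k ⨾ n ⨾ s ⨾ ε))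
  1+2a<n : ∀ n a → n ≡ 2 * suc a → 1 + (a + a) < n
  1+2a<n n a h = lin 0 (eq≥ h) (solve (a ⨾ n ⨾ ε))
  d+b₁<n : ∀ n k a e d → n ≡ 2 * suc a → k ≡ suc (2 * e) → k + d ≡ 2 * a → d + (suc e + suc e) < n
  d+b₁<n n k a e d h₁ h₂ h₃ = lin 0 (eq≥ h₁ ⊹ eq≥ h₂ ⊹ eq≤ h₃) (solve (a ⨾ d ⨾ e ⨾ k ⨾ n ⨾ ε))
  e+e≤1+k : ∀ k e → k ≡ suc (2 * e) → suc e + suc e ≤ k + 1
  e+e≤1+k k e h = lin 0 (eq≥ h) (solve (e ⨾ k ⨾ ε))
  e+e<2k : ∀ k e → k ≡ suc (2 * e) → 3 ≤ k → suc e + suc e < 2 * k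
  e+e<2k k e h₁ h₂ = linᵍ 2 (2 + k) (3 ⊠ eq≥ h₁ ⊹ 2 ⊠ h₂) (solve (e ⨾ k ⨾ ε))
  2a<n : ∀ n a → n ≡ 2 * suc a → 2 * a < n
  2a<n n a h = lin 1 (eq≥ h) (solve (a ⨾ n ⨾ ε))
  n≡1+k : ∀ n k a → n ≡ 2 * suc a → k < n → ¬ k ≤ 2 * a → n ≡ suc k
  n≡1+k n k a h₁ h₂ h₃ = ≤-antisym (lin 0 (eq≤ h₁ ⊹ ≰⇒> h₃) (solve (a ⨾ k ⨾ n ⨾ ε))) (lin 0 h₂ (solve (k ⨾ n ⨾ ε)))
  suc-pred-order : ∀ n k → 3 ≤ k → suc (2 * n + k ∸ 1) ≡ 2 * n + k
  suc-pred-order n (suc k) _ rewrite +-suc (2 * n) k = refl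
  predecessor : ∀ n {k} e → n ≡ 2 * e → k < n → ∃ λ e′ → e ≡ suc e′
  predecessor n zero    h k<n = ⊥-elim (n≮0 (subst (_ <_) h k<n))
  predecessor n (suc e) h k<n = e , refl

module Cases (n k : ℕ) (n+2≤2k : n + 2 ≤ 2 * k) (2k≤2n-2 : 2 * k ≤ 2 * n ∸ 2) where

  k-below-n : k < n
  k-below-n = k<n n k n+2≤2k 2k≤2n-2

  3≤k : 3 ≤ k
  3≤k = 3≤k′ n k n+2≤2k k-below-n

  -- The sides have orders k and n - 2, the second of degree n - 2 - k. A side of order n - 1 would
  -- need degree n - 1 - k here, and both are odd; this is what lowers the Ramsey number by one.
  lowerEven : ∀ {a e} → n ≡ 2 * a → k ≡ 2 * e → ∀ s → s < 2 * n + k ∸ 1 → ¬ Arrows s (Star n) (Wheel (2 * k))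
  lowerEven {a} {e} n≡ k≡ s s< with a′ , refl ← predecessor n a n≡ k-below-n
    with d , d≡ ← m≤n⇒∃[o]m+o≡n {k} {2 * a′} (≤-trans (eq≤ k≡) (even≤even a′ e (≤-trans (s≤s (eq≥ k≡)) (≤-trans k-below-n (eq≤ n≡))))) =
    Construction.notArrows (edgeless k) (circulant a′ (d≤a n k a′ d n+2≤2k lt d≡)) (a+a<n n a′ lt) (d+k<n n k a′ d lt d≡)
      (m≤m+n k 0) (a+a≤k+d k a′ d d≡) (k<2k k 3≤k) (a+a<2k n k a′ n+2≤2k lt) 3≤k (order₁ n k a′ s n≡ s< (suc-pred-order n k 3≤k))
    where lt = 2a<n n a′ n≡

  -- The sides must have n + k - 1 vertices together. For odd n they have orders k and n - 1, the
  -- first without edges and the second of degree n - 1 - k.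
  lowerOdd : ¬ (n % 2 ≡ 0 × k % 2 ≡ 0) → ∀ s → s < 2 * n + k → ¬ Arrows s (Star n) (Wheel (2 * k))
  lowerOdd odd s s< with half n
  ... | a , inj₂ n≡ with d , d≡ ← m≤n⇒∃[o]m+o≡n {k} {2 * a} (≤-pred (≤-trans k-below-n (eq≤ n≡))) =
    Construction.notArrows (edgeless k) (circulant a (d≤a n k a d n+2≤2k lt d≡)) (a+a<n n a lt) (d+k<n n k a d lt d≡)
      (m≤m+n k 0) (a+a≤k+d k a d d≡) (k<2k k 3≤k) (a+a<2k n k a n+2≤2k lt) 3≤k (order₂ n k a s n≡ s<)
    where
    lt : 2 * a < n
    lt = eq≥ n≡
  lowerOdd odd s s< | a , inj₁ n≡ with half k
  ... | e , inj₁ k≡ = ⊥-elim (odd (trans (cong (_% 2) n≡) (even-% a) , trans (cong (_% 2) k≡) (even-% e)))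
  ... | e , inj₂ k≡ with a′ , refl ← predecessor n a n≡ k-below-n with k ≤? 2 * a′
  -- Here k = n - 1, and the join is the complete bipartite graph with k vertices on each side.
  ...   | no k≰ = Construction.notArrows (edgeless k) (edgeless k) k-below-n k-below-n (m≤m+n k 0) (m≤m+n k 0) (k<2k k 3≤k) (k<2k k 3≤k) 3≤k
                    (order₃ n k s (n≡1+k n k a′ n≡ k-below-n k≰) s<)
  ...   | yes k≤ with d , d≡ ← m≤n⇒∃[o]m+o≡n k≤ =
    -- As n - 1 is odd, one vertex moves to the other side: a perfect matching on k + 1 vertices and
    -- a graph of degree n - 2 - k on n - 2 vertices, both of even order.
    Construction.notArrows (circulant (suc e) (s≤s z≤n)) (circulant a′ (d≤a n k a′ d n+2≤2k (2a<n n a′ n≡) d≡))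
      (1+2a<n n a′ n≡) (d+b₁<n n k a′ e d n≡ k≡ d≡) (e+e≤1+k k e k≡) (a+a≤k+d k a′ d d≡) (e+e<2k k e k≡ 3≤k) (a+a<2k n k a′ n+2≤2k (2a<n n a′ n≡)) 3≤k
      (order₄ n k a′ e s n≡ k≡ s<)

  ramseyEven : n % 2 ≡ 0 × k % 2 ≡ 0 → IsRamseyNumber (Star n) (Wheel (2 * k)) (2 * n + k ∸ 1)
  ramseyEven (n-even , k-even) with half n | half k
  ... | a , inj₂ n≡ | _           = ⊥-elim (odd-% a (subst (λ z → z % 2 ≡ 0) n≡ n-even))
  ... | _           | e , inj₂ k≡ = ⊥-elim (odd-% e (subst (λ z → z % 2 ≡ 0) k≡ k-even))
  ... | a , inj₁ n≡ | e , inj₁ k≡ with e′ , refl ← predecessor k e k≡ (≤-trans (s≤s z≤n) 3≤k) =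
    upperBound n+2≤2k k-below-n 3≤k (inj₂ (refl , a , e′ , n≡ , k≡)) (trans (suc-pred-order n k 3≤k) (sym (+-identityʳ _))) , lowerEven {a} {suc e′} n≡ k≡

  ramseyOdd : ¬ (n % 2 ≡ 0 × k % 2 ≡ 0) → IsRamseyNumber (Star n) (Wheel (2 * k)) (2 * n + k)
  ramseyOdd odd = upperBound n+2≤2k k-below-n 3≤k (inj₁ refl) (+-comm 1 _) , lowerOdd odd

theorem4 : (n k : ℕ) → n + 2 ≤ 2 * k → 2 * k ≤ 2 * n ∸ 2 →
    ((n % 2 ≡ 0 × k % 2 ≡ 0) → IsRamseyNumber (Star n) (Wheel (2 * k)) (2 * n + k ∸ 1))
    × (¬ (n % 2 ≡ 0 × k % 2 ≡ 0) → IsRamseyNumber (Star n) (Wheel (2 * k)) (2 * n + k))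
theorem4 n k h₁ h₂ = Cases.ramseyEven n k h₁ h₂ , Cases.ramseyOdd n k h₁ h₂
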